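{- There exists a function $f(k,\ell) = O(k+\ell)$ such that for all integers $k \geq 2$ and $\ell \geq 2$, every graph $G$ of order $n \geq f(k,\ell)$ with $\delta(G) \geq \frac{n+k-2}{2}$ contains $\ell$ pairwise edge-disjoint Hamiltonian cycles $H_1,H_2,\ldots,H_\ell$ such that $G-\bigcup_{1 \leq i \leq \ell}E(H_i)$ is $k$-connected.
   Context: All graphs are finite, simple and undirected. $\delta(G)$ denotes the minimum degree. For $F \subseteq E(G)$, $G-F$ is the graph obtained from $G$ by deleting the edges in $F$ (keeping all vertices). A graph is $k$-connected if its vertex connectivity is at least $k$. $f(k,\ell)=O(k+\ell)$ means there is a constant $C$ with $f(k,\ell) \leq C(k+\ell)$ for all $k,\ell \geq 2$. -}

module Defs where

open import Data.Nat using (ℕ; zero; suc; _+_; _*_; _≤_; _<_)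
open import Data.Fin using (Fin; toℕ)
open import Data.Fin.Subset using (Subset; _∈_; _∉_; ∣_∣)
open import Data.List using (allFin; filter; length)
open import Data.Product using (Σ; ∃; _×_; _,_)
open import Data.Sum using (_⊎_)
open import Relation.Nullary using (¬_; Dec)
open import Relation.Binary.PropositionalEquality using (_≡_; _≢_)
open import Function.Definitions using (Injective)

record Graph (n : ℕ) : Set₁ where
  field
    Adj     : Fin n → Fin n → Set
    adj?    : (u v : Fin n) → Dec (Adj u v)
    sym     : ∀ {u v} → Adj u v → Adj v u
    irrefl  : ∀ {u} → ¬ Adj u u
open Graph public

degree : ∀ {n} → Graph n → Fin n → ℕ
degree {n} G v = length (filter (adj? G v) (allFin n))

-- δ(G) ≥ (n + k - 2)/2, stated without division: 2·deg(v) ≥ n + k - 2,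
-- i.e. n + k ≤ 2·deg(v) + 2, for every vertex v.
MinDegreeCond : ∀ {n} → Graph n → ℕ → Set
MinDegreeCond {n} G k = ∀ v → n + k ≤ 2 * degree G v + 2

Consec : ∀ {n} → Fin n → Fin n → Set
Consec {n} i j = (suc (toℕ i) ≡ toℕ j) ⊎ ((suc (toℕ i) ≡ n) × (toℕ j ≡ 0))

-- A Hamiltonian cycle of G: n ≥ 3 and a cyclic ordering σ of all vertices
-- (a bijection Fin n → Fin n; injective suffices on a finite set) in which
-- cyclically consecutive vertices are adjacent in G.
record HamCycle {n : ℕ} (G : Graph n) : Set where
  field
    three≤n : 3 ≤ n
    σ       : Fin n → Fin n
    σ-inj   : Injective _≡_ _≡_ σ
    σ-adj   : ∀ i j → Consec i j → Adj G (σ i) (σ j)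
open HamCycle public

HamEdge : ∀ {n} {G : Graph n} → HamCycle G → Fin n → Fin n → Set
HamEdge H u v = ∃ λ i → ∃ λ j → Consec i j ×
  (((σ H i ≡ u) × (σ H j ≡ v)) ⊎ ((σ H i ≡ v) × (σ H j ≡ u)))

EdgeDisjoint : ∀ {n ℓ} {G : Graph n} → (Fin ℓ → HamCycle G) → Set
EdgeDisjoint {n} {ℓ} H =
  ∀ (a b : Fin ℓ) → a ≢ b → ∀ (u v : Fin n) → HamEdge (H a) u v → ¬ HamEdge (H b) u v

RemoveCycles : ∀ {n ℓ} (G : Graph n) → (Fin ℓ → HamCycle G) → Fin n → Fin n → Set
RemoveCycles G H u v = Adj G u v × (¬ ∃ λ a → HamEdge (H a) u v)

data WalkAvoiding {n : ℕ} (R : Fin n → Fin n → Set) (S : Subset n) : Fin n → Fin n → Set where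
  here : ∀ {u} → u ∉ S → WalkAvoiding R S u u
  step : ∀ {u w v} → u ∉ S → R u w → WalkAvoiding R S w v → WalkAvoiding R S u v

KConnected : ∀ {n} → ℕ → (Fin n → Fin n → Set) → Set
KConnected {n} k R =
  (k < n) × (∀ (S : Subset n) → ∣ S ∣ < k → ∀ u v → u ∉ S → v ∉ S → WalkAvoiding R S u v)

-- Let R have minimum degree at least n/2 − O(s), where s = k + ℓ.  Rotating a maximal path closes it
-- to a cycle missing O(s) vertices, and a long cycle absorbs a missing vertex v unless the predecessors
-- of the neighbours of v are independent.  So R is Hamiltonian, or it has an independent set of size
-- n/2 − O(s), or two sets of size n/2 − O(s) without edges between them.  Removing Hamiltonian cycles
-- from G greedily thus works unless G is close to a complete bipartite graph or to two disjoint cliques,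
-- and if the remaining graph is not k-connected, then G is again close to two disjoint cliques.
--
-- Two cliques: let w "hubs" have many neighbours on both sides.  By the degree condition each vertex of
-- the smaller side has at least (k − w)/2 neighbours across, so a matching of k − w crossing edges
-- survives when every cycle spends at most two of them; with the hubs it gives k disjoint connectors.
-- Two of these carry the next cycle, and all k of them witness the k-connectivity at the end.
--
-- Bipartite: let the sides differ by m.  Each vertex of the larger side has at least m/2 neighbours
-- inside it, so there is always a fresh matching of m inner edges to balance the next cycle.
--
-- In both cases the exceptional vertices and special edges are first flanked by private typical vertices
-- and arranged in a cyclic order; the links between typical vertices that are not edges of the graph are
-- then exchanged for edges by rotations that never touch the other links.

module Submission where

import Algebra.Solver.CommutativeMonoid as CMSolver
open import Data.Bool using (Bool; true; false; T; _∧_; not; if_then_else_)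
open import Data.Bool.Properties using (T-∧; not-involutive; not-injective) renaming (_≟_ to _≟ᵇ_)
open import Data.Empty using (⊥)
open import Data.Fin using (Fin; zero; suc; cast; toℕ; fromℕ<)
open import Data.Fin.Properties using (any?; toℕ-injective; toℕ<n; toℕ-cast) renaming (_≟_ to _≟ᶠ_)
import Data.Fin.Subset as Subset
import Data.Fin.Subset.Properties as Subsetₚ
open import Data.List
  using (List; []; _∷_; [_]; _++_; length; filter; allFin; reverse; map; concat; concatMap; cartesianProduct; lookup; take)
open import Data.List.Properties
  using (filter-++; filter-accept; filter-reject; length-filter; length-++; length-map; length-reverse; length-tabulate;
         length-take; unfold-reverse; ++-assoc; ++-identityʳ; concat-++)
open import Data.List.Membership.DecPropositional using () renaming (_∈?_ to mem?)
open import Data.List.Membership.Propositional using (_∈_; _∉_)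
open import Data.List.Membership.Propositional.Properties
open import Data.List.Relation.Binary.Permutation.Propositional
  using (_↭_; ↭-sym; ↭-reflexive; ↭-refl; ↭-trans; prep; swap; refl) renaming (trans to ↭-step)
open import Data.List.Relation.Binary.Permutation.Propositional.Properties
  using (↭-length; filter-↭; ↭-reverse; ++-comm; ++-commutativeMonoid; shift; ∈-resp-↭; All-resp-↭)
  renaming (++⁺ to ↭-++⁺; ++⁺ˡ to ↭-++⁺ˡ; ++⁺ʳ to ↭-++⁺ʳ)
open import Data.List.Relation.Unary.All as All using (All; []; _∷_)
import Data.List.Relation.Unary.All.Properties as Allₚ
open import Data.List.Relation.Unary.AllPairs as AllPairs using (AllPairs; []; _∷_)
open import Data.List.Relation.Unary.Any using (here; there)
open import Data.List.Relation.Unary.Unique.Propositional using (Unique)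
import Data.List.Relation.Unary.Unique.Propositional.Properties as Uniqueₚ
open import Data.Nat
open import Data.Nat.Properties hiding (_≟_)
open import Data.Nat.DivMod using (m≡m%n+[m/n]*n; m%n<n)
open import Data.Nat.Tactic.RingSolver using (solve-∀)
open import Data.Product using (Σ; ∃; ∃₂; _×_; _,_; proj₁; proj₂)
import Data.Product.Properties as ×ₚ
open import Data.Sum using (_⊎_; inj₁; inj₂; [_,_]′)
open import Data.Vec as Vec using (Vec; []; _∷_)
open import Function using (_∘_; id; Equivalence; case_of_)
open import Relation.Binary using (Symmetric)
open import Relation.Binary.PropositionalEquality
  using (_≡_; _≢_; refl; cong; cong₂; sym; trans; subst; subst₂; module ≡-Reasoning)
open import Relation.Nullary using (¬_; Dec; does; yes; no; contradiction)
open import Relation.Nullary.Decidable using (¬?; _×-dec_; _⊎-dec_; map′; dec-true; dec-false)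
open import Relation.Unary using (Decidable)
open import Defs renaming (sym to adj-sym; irrefl to adj-irrefl)

-- Linear arithmetic over ℕ

-- The extremal structure is found in what a partial packing leaves over, and that packing may
-- already have spent the few edges on which the extremal case depends. It is therefore discarded
-- and all `ℓ` cycles are packed anew in `G`; the structure survives the way back because each
-- vertex has lost at most `2ℓ` edges. The new packing works by rationing: each cycle takes few
-- special edges (two crossing edges, or `m` inner ones), whereas their number is of order `n` times
-- what one matching needs. A greedy matching therefore survives as long as the degrees among the
-- special edges are `O(s)`, and this comparison is why a linear bound on `n` is enough. The full
-- strength of the degree condition, with its `k`, enters at `cross-degree`, where the smaller
-- clique leaves no slack. Case distinctions are finite searches on decidable relations, so
-- alternatives are returned as sums.

infixl 6 _:+_
infixl 7 _:*_
infix  4 _:≤_ _:<_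
infix  2 _⊢_

data Lin (k : ℕ) : Set where
  con  : ℕ → Lin k
  var  : Fin k → Lin k
  _:+_ : Lin k → Lin k → Lin k
  _:*_ : ℕ → Lin k → Lin k

⟦_⟧ : ∀ {k} → Lin k → Vec ℕ k → ℕ
⟦ con c ⟧ ρ = c
⟦ var i ⟧ ρ = Vec.lookup ρ i
⟦ d :+ e ⟧ ρ = ⟦ d ⟧ ρ + ⟦ e ⟧ ρ
⟦ c :* e ⟧ ρ = c * ⟦ e ⟧ ρ

record Ineq (k : ℕ) : Set where
  constructor _:≤_
  field lhs rhs : Lin k
open Ineq

_:<_ : ∀ {k} → Lin k → Lin k → Ineq k
d :< e = (con 1 :+ d) :≤ e

⟦_⟧≤ : ∀ {k} → Ineq k → Vec ℕ k → Set
⟦ d :≤ e ⟧≤ ρ = ⟦ d ⟧ ρ ≤ ⟦ e ⟧ ρ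

record Sequent (k : ℕ) : Set where
  constructor _⊢_
  field
    hyps : List (Ineq k)
    goal : Ineq k
open Sequent

coeffs : ∀ {k} → Lin k → Vec ℕ k
coeffs (con c)  = Vec.replicate _ 0
coeffs (var i)  = Vec.updateAt (Vec.replicate _ 0) i (λ _ → 1)
coeffs (d :+ e) = Vec.zipWith _+_ (coeffs d) (coeffs e)
coeffs (c :* e) = Vec.map (c *_) (coeffs e)

constant : ∀ {k} → Lin k → ℕ
constant (con c)  = c
constant (var i)  = 0
constant (d :+ e) = constant d + constant e
constant (c :* e) = c * constant e

dot : ∀ {k} → Vec ℕ k → Vec ℕ k → ℕ
dot [] [] = 0
dot (c ∷ cs) (x ∷ ρ) = c * x + dot cs ρ

dot-0 : ∀ {k} (ρ : Vec ℕ k) → dot (Vec.replicate k 0) ρ ≡ 0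
dot-0 [] = refl
dot-0 (x ∷ ρ) = dot-0 ρ

dot-unit : ∀ {k} (i : Fin k) ρ → dot (Vec.updateAt (Vec.replicate k 0) i (λ _ → 1)) ρ ≡ Vec.lookup ρ i
dot-unit zero (x ∷ ρ) = trans (cong₂ _+_ (*-identityˡ x) (dot-0 ρ)) (+-identityʳ x)
dot-unit (suc i) (x ∷ ρ) = dot-unit i ρ

dot-+ : ∀ {k} (cs ds ρ : Vec ℕ k) → dot (Vec.zipWith _+_ cs ds) ρ ≡ dot cs ρ + dot ds ρ
dot-+ [] [] [] = refl
dot-+ (c ∷ cs) (d ∷ ds) (x ∷ ρ) rewrite dot-+ cs ds ρ = interchange c d x (dot cs ρ) (dot ds ρ)
  where
  interchange : ∀ c d x y z → (c + d) * x + (y + z) ≡ c * x + y + (d * x + z)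
  interchange = solve-∀

dot-* : ∀ {k} c (cs ρ : Vec ℕ k) → dot (Vec.map (c *_) cs) ρ ≡ c * dot cs ρ
dot-* c [] [] = sym (*-zeroʳ c)
dot-* c (d ∷ cs) (x ∷ ρ) rewrite dot-* c cs ρ = factor c d x (dot cs ρ)
  where
  factor : ∀ c d x y → c * d * x + c * y ≡ c * (d * x + y)
  factor = solve-∀

⟦⟧-normal : ∀ {k} (e : Lin k) ρ → ⟦ e ⟧ ρ ≡ constant e + dot (coeffs e) ρ
⟦⟧-normal (con c) ρ rewrite dot-0 ρ = sym (+-identityʳ c)
⟦⟧-normal (var i) ρ = sym (dot-unit i ρ)
⟦⟧-normal (d :+ e) ρ rewrite ⟦⟧-normal d ρ | ⟦⟧-normal e ρ | dot-+ (coeffs d) (coeffs e) ρ =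
  interchange (constant d) (constant e) (dot (coeffs d) ρ) (dot (coeffs e) ρ)
  where
  interchange : ∀ a b x y → a + x + (b + y) ≡ a + b + (x + y)
  interchange = solve-∀
⟦⟧-normal (c :* e) ρ rewrite ⟦⟧-normal e ρ | dot-* c (coeffs e) ρ = *-distribˡ-+ c _ _

pointwise≤ : ∀ {k} → Vec ℕ k → Vec ℕ k → Bool
pointwise≤ [] [] = true
pointwise≤ (c ∷ cs) (d ∷ ds) = (c ≤ᵇ d) ∧ pointwise≤ cs ds

dot-mono : ∀ {k} (cs ds ρ : Vec ℕ k) → T (pointwise≤ cs ds) → dot cs ρ ≤ dot ds ρ
dot-mono [] [] [] _ = z≤n
dot-mono (c ∷ cs) (d ∷ ds) (x ∷ ρ) t with Equivalence.to (T-∧ {c ≤ᵇ d}) t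
... | c≤d , cs≤ds = +-mono-≤ (*-monoˡ-≤ x (≤ᵇ⇒≤ c d c≤d)) (dot-mono cs ds ρ cs≤ds)

_≤ᶜ_ : ∀ {k} → Lin k → Lin k → Bool
d ≤ᶜ e = (constant d ≤ᵇ constant e) ∧ pointwise≤ (coeffs d) (coeffs e)

≤ᶜ-sound : ∀ {k} (d e : Lin k) ρ → T (d ≤ᶜ e) → ⟦ d ⟧ ρ ≤ ⟦ e ⟧ ρ
≤ᶜ-sound d e ρ t with Equivalence.to (T-∧ {constant d ≤ᵇ constant e}) t
... | c , cs rewrite ⟦⟧-normal d ρ | ⟦⟧-normal e ρ =
  +-mono-≤ (≤ᵇ⇒≤ _ _ c) (dot-mono (coeffs d) (coeffs e) ρ cs)

combine : ∀ {k} → (Ineq k → Lin k) → List ℕ → List (Ineq k) → Lin k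
combine side (c ∷ cs) (h ∷ hs) = c :* side h :+ combine side cs hs
combine side _ _ = con 0

combine-mono : ∀ {k} cs (hs : List (Ineq k)) ρ → All (λ h → ⟦ h ⟧≤ ρ) hs →
               ⟦ combine lhs cs hs ⟧ ρ ≤ ⟦ combine rhs cs hs ⟧ ρ
combine-mono [] _ ρ _ = z≤n
combine-mono (c ∷ cs) [] ρ _ = z≤n
combine-mono (c ∷ cs) (h ∷ hs) ρ (p ∷ ps) = +-mono-≤ (*-monoʳ-≤ c p) (combine-mono cs hs ρ ps)

-- Sequents are written with λ-bound variables, so that inequalities read with named quantities;
-- `applyVars` feeds in the variables in the order of the environment.
Vars : ℕ → ℕ → Set → Set
Vars zero    m A = A
Vars (suc k) m A = Lin m → Vars k m A

applyVars : ∀ {k m A} → (Fin k → Fin m) → Vars k m A → A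
applyVars {zero}  ι s = s
applyVars {suc k} ι s = applyVars (ι ∘ suc) (s (var (ι zero)))

-- Farkas: the goal d ≤ e follows once (g+1)·d + Σ cᵢ·rhsᵢ is dominated coefficientwise by
-- (g+1)·e + g + Σ cᵢ·lhsᵢ; the extra g is the rounding that integrality allows.  Below, the numbers g
-- and cᵢ of such a certificate follow its sequent, and the proofs of the hypotheses come last.
Certifies : ∀ {k} → ℕ → List ℕ → Sequent k → Set
Certifies g cs (hs ⊢ (d :≤ e)) =
  T ((suc g :* d :+ combine rhs cs hs) ≤ᶜ (suc g :* e :+ con g :+ combine lhs cs hs))

farkas : ∀ {k} (ρ : Vec ℕ k) (s : Sequent k) (g : ℕ) (cs : List ℕ) → Certifies g cs s →
         All (λ h → ⟦ h ⟧≤ ρ) (hyps s) → ⟦ goal s ⟧≤ ρ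
farkas ρ (hs ⊢ (d :≤ e)) g cs t ps = ≤-pred (*-cancelˡ-< (suc g) _ _ (begin-strict
  suc g * ⟦ d ⟧ ρ        ≤⟨ +-cancelʳ-≤ (⟦ combine rhs cs hs ⟧ ρ) _ _ (≤-trans
                              (≤ᶜ-sound (suc g :* d :+ combine rhs cs hs) (suc g :* e :+ con g :+ combine lhs cs hs)
                                  ρ t)
                              (+-monoʳ-≤ _ (combine-mono cs hs ρ ps))) ⟩
  suc g * ⟦ e ⟧ ρ + g    <⟨ n<1+n _ ⟩
  suc (suc g * ⟦ e ⟧ ρ + g) ≡⟨ round g (⟦ e ⟧ ρ) ⟩
  suc g * suc (⟦ e ⟧ ρ) ∎))
  where
  open ≤-Reasoning
  round : ∀ g x → suc (suc g * x + g) ≡ suc g * suc x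
  round = solve-∀

sequent : ∀ {k} → Vars k k (Sequent k) → Sequent k
sequent {k} = applyVars {k} {k} (λ i → i)

converse : ∀ {k} → Sequent k → Sequent k
converse (hs ⊢ (d :≤ e)) = hs ⊢ (e :≤ d)

abstract
  lin : ∀ {k} (ρ : Vec ℕ k) (s : Vars k k (Sequent k)) (g : ℕ) (cs : List ℕ) →
        {Certifies g cs (sequent s)} →
        All (λ h → ⟦ h ⟧≤ ρ) (hyps (sequent s)) → ⟦ goal (sequent s) ⟧≤ ρ
  lin ρ s g cs {t} = farkas ρ (sequent s) g cs t

  lin≡ : ∀ {k} (ρ : Vec ℕ k) (s : Vars k k (Sequent k)) (g : ℕ) (cs : List ℕ) (g′ : ℕ) (cs′ : List ℕ) →
         {Certifies g cs (sequent s)} → {Certifies g′ cs′ (converse (sequent s))} →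
         All (λ h → ⟦ h ⟧≤ ρ) (hyps (sequent s)) → ⟦ lhs (goal (sequent s)) ⟧ ρ ≡ ⟦ rhs (goal (sequent s)) ⟧ ρ
  lin≡ ρ s g cs g′ cs′ {t} {t′} ps =
    ≤-antisym (farkas ρ (sequent s) g cs t ps) (farkas ρ (converse (sequent s)) g′ cs′ t′ ps)

eq≤ : ∀ {x y : ℕ} → x ≡ y → x ≤ y
eq≤ = ≤-reflexive

eq≥ : ∀ {x y : ℕ} → x ≡ y → y ≤ x
eq≥ = ≤-reflexive ∘ sym

1≰0 : ∀ {a} {A : Set a} → 1 ≤ 0 → A
1≰0 ()

-- Counting

count : {A : Set} {P : A → Set} → Decidable P → List A → ℕ
count P? xs = length (filter P? xs)

module _ {A : Set} where

  count-yes : {P : A → Set} (P? : Decidable P) {x : A} {xs : List A} → P x → count P? (x ∷ xs) ≡ suc (count P? xs)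
  count-yes P? px = cong length (filter-accept P? px)

  count-no : {P : A → Set} (P? : Decidable P) {x : A} {xs : List A} → ¬ P x → count P? (x ∷ xs) ≡ count P? xs
  count-no P? ¬px = cong length (filter-reject P? ¬px)

  count-++ : {P : A → Set} (P? : Decidable P) (xs ys : List A) → count P? (xs ++ ys) ≡ count P? xs + count P? ys
  count-++ P? xs ys = trans (cong length (filter-++ P? xs ys)) (length-++ (filter P? xs))

  count-↭ : {P : A → Set} (P? : Decidable P) {xs ys : List A} → xs ↭ ys → count P? xs ≡ count P? ys
  count-↭ P? p = ↭-length (filter-↭ P? p)

  count-∪≤ : {P Q R : A → Set} (P? : Decidable P) (Q? : Decidable Q) (R? : Decidable R) (xs : List A) →
             (∀ {x} → x ∈ xs → P x → Q x ⊎ R x) → count P? xs ≤ count Q? xs + count R? xs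
  count-∪≤ P? Q? R? [] h = z≤n
  count-∪≤ P? Q? R? (x ∷ xs) h with count-∪≤ P? Q? R? xs (h ∘ there) | P? x | Q? x | R? x
  ... | ih | no ¬p | yes q | yes r = ≤-trans ih (+-mono-≤ (n≤1+n _) (n≤1+n _))
  ... | ih | no ¬p | yes q | no ¬r = m≤n⇒m≤1+n ih
  ... | ih | no ¬p | no ¬q | yes r = ≤-trans ih (+-monoʳ-≤ _ (n≤1+n _))
  ... | ih | no ¬p | no ¬q | no ¬r = ih
  ... | ih | yes p | yes q | yes r = s≤s (≤-trans ih (+-monoʳ-≤ _ (n≤1+n _)))
  ... | ih | yes p | yes q | no ¬r = s≤s ih
  ... | ih | yes p | no ¬q | yes r = ≤-trans (s≤s ih) (eq≥ (+-suc _ _))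
  ... | ih | yes p | no ¬q | no ¬r = contradiction (h (here refl) p) [ ¬q , ¬r ]′

  count-⊎≥ : {P Q R : A → Set} (P? : Decidable P) (Q? : Decidable Q) (R? : Decidable R) (xs : List A) →
             (∀ {x} → x ∈ xs → Q x → P x) → (∀ {x} → x ∈ xs → R x → P x) → (∀ {x} → x ∈ xs → Q x → ¬ R x) →
             count Q? xs + count R? xs ≤ count P? xs
  count-⊎≥ P? Q? R? [] f g h = z≤n
  count-⊎≥ P? Q? R? (x ∷ xs) f g h with count-⊎≥ P? Q? R? xs (f ∘ there) (g ∘ there) (h ∘ there) | P? x | Q? x | R?
      x
  ... | ih | _     | yes q | yes r = contradiction r (h (here refl) q)
  ... | ih | no ¬p | yes q | _     = contradiction (f (here refl) q) ¬p
  ... | ih | no ¬p | no ¬q | yes r = contradiction (g (here refl) r) ¬p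
  ... | ih | yes p | yes q | no ¬r = s≤s ih
  ... | ih | yes p | no ¬q | yes r = ≤-trans (≤-reflexive (+-suc _ _)) (s≤s ih)
  ... | ih | yes p | no ¬q | no ¬r = m≤n⇒m≤1+n ih
  ... | ih | no ¬p | no ¬q | no ¬r = ih

  count-mono : {P Q : A → Set} (P? : Decidable P) (Q? : Decidable Q) (xs : List A) →
               (∀ {x} → x ∈ xs → P x → Q x) → count P? xs ≤ count Q? xs
  count-mono P? Q? [] h = z≤n
  count-mono P? Q? (x ∷ xs) h with count-mono P? Q? xs (h ∘ there) | P? x | Q? x
  ... | ih | yes p | yes q = s≤s ih
  ... | ih | yes p | no ¬q = contradiction (h (here refl) p) ¬q
  ... | ih | no ¬p | yes q = m≤n⇒m≤1+n ih
  ... | ih | no ¬p | no ¬q = ih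

  count-∁ : {P : A → Set} (P? : Decidable P) (xs : List A) → count P? xs + count (¬? ∘ P?) xs ≡ length xs
  count-∁ P? [] = refl
  count-∁ P? (x ∷ xs) with P? x
  ... | yes p = cong suc (count-∁ P? xs)
  ... | no ¬p = trans (+-suc _ _) (cong suc (count-∁ P? xs))

  count-none : {P : A → Set} (P? : Decidable P) (xs : List A) → (∀ {x} → x ∈ xs → ¬ P x) → count P? xs ≡ 0
  count-none P? [] h = refl
  count-none P? (x ∷ xs) h = trans (count-no P? (h (here refl))) (count-none P? xs (h ∘ there))

  count>0⇒∃ : {P : A → Set} (P? : Decidable P) (xs : List A) → 0 < count P? xs → ∃ λ x → x ∈ xs × P x
  count>0⇒∃ P? (x ∷ xs) pos with P? x
  ... | yes p = x , here refl , p
  ... | no ¬p with count>0⇒∃ P? xs pos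
  ... | y , y∈ , py = y , there y∈ , py

  count≡0⇒none : {P : A → Set} (P? : Decidable P) (xs : List A) → count P? xs ≡ 0 → ∀ {x} → x ∈ xs → ¬ P x
  count≡0⇒none P? (x ∷ xs) eq x∈ px with P? x
  count≡0⇒none P? (x ∷ xs) () x∈ px | yes p
  count≡0⇒none P? (x ∷ xs) eq (here refl) px | no ¬p = ¬p px
  count≡0⇒none P? (x ∷ xs) eq (there x∈) px | no ¬p = count≡0⇒none P? xs eq x∈ px

  ∈-middle⁻ : ∀ {x z : A} as {bs} → z ∈ as ++ x ∷ bs → z ≡ x ⊎ z ∈ as ++ bs
  ∈-middle⁻ as z∈ with ∈-++⁻ as z∈
  ... | inj₁ z∈as         = inj₂ (∈-++⁺ˡ z∈as)
  ... | inj₂ (here eq)    = inj₁ eq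
  ... | inj₂ (there z∈bs) = inj₂ (∈-++⁺ʳ as z∈bs)

  ∈-drop-middle : ∀ {x : A} {xs} as {bs} → All (x ≢_) xs → (∀ {z} → z ∈ x ∷ xs → z ∈ as ++ x ∷ bs) → ∀ {z} →
      z ∈ xs → z ∈ as ++ bs
  ∈-drop-middle as x∉ h z∈ with ∈-middle⁻ as (h (there z∈))
  ... | inj₁ refl = contradiction refl (All.lookup x∉ z∈)
  ... | inj₂ z∈′  = z∈′

  unique-⊆-length : ∀ {xs ys : List A} → Unique xs → (∀ {x} → x ∈ xs → x ∈ ys) → length xs ≤ length ys
  unique-⊆-length {[]} u h = z≤n
  unique-⊆-length {x ∷ xs} (x∉ ∷ u) h with ∈-∃++ (h (here refl))
  ... | as , bs , refl = ≤-trans (s≤s (unique-⊆-length u (∈-drop-middle as x∉ h))) (eq≥ (↭-length (shift x as bs)))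

  unique-⊆-↭ : ∀ {xs ys : List A} → Unique xs → (∀ {x} → x ∈ xs → x ∈ ys) → length ys ≤ length xs → xs ↭ ys
  unique-⊆-↭ {[]} {[]} u h le = refl
  unique-⊆-↭ {x ∷ xs} (x∉ ∷ u) h le with ∈-∃++ (h (here refl))
  ... | as , bs , refl = ↭-trans
    (prep x (unique-⊆-↭ u (∈-drop-middle as x∉ h) (≤-pred (≤-trans (eq≥ (↭-length (shift x as bs))) le))))
    (↭-sym (shift x as bs))

  unique-↭ : ∀ {xs ys : List A} → xs ↭ ys → Unique xs → Unique ys
  unique-↭ refl u = u
  unique-↭ (prep x p) (x∉ ∷ u) = All-resp-↭ p x∉ ∷ unique-↭ p u
  unique-↭ (swap x y p) ((x≢y ∷ x∉) ∷ (y∉ ∷ u)) = ((x≢y ∘ sym) ∷ All-resp-↭ p y∉) ∷ (All-resp-↭ p x∉ ∷ unique-↭ p u)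
  unique-↭ (↭-step p q) u = unique-↭ q (unique-↭ p u)

  unique-∷ : ∀ {x : A} {xs} → x ∉ xs → Unique xs → Unique (x ∷ xs)
  unique-∷ x∉ u = All.tabulate (λ { z∈ refl → x∉ z∈ }) ∷ u

  unique-++ : ∀ {xs ys : List A} → Unique xs → Unique ys → (∀ {x} → x ∈ xs → x ∉ ys) → Unique (xs ++ ys)
  unique-++ u v d = Uniqueₚ.++⁺ u v λ (x∈ , x∈′) → d x∈ x∈′

  unique-++⁻ : ∀ (xs : List A) {ys} → Unique (xs ++ ys) → Unique xs × Unique ys × (∀ {x} → x ∈ xs → x ∉ ys)
  unique-++⁻ [] u = [] , u , λ ()
  unique-++⁻ (x ∷ xs) (x∉ ∷ u) with unique-++⁻ xs u
  ... | uxs , uys , d = (Allₚ.++⁻ˡ xs x∉ ∷ uxs) , uys ,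
    λ { (here refl) x∈ → All.lookup (Allₚ.++⁻ʳ xs x∉) x∈ refl ; (there x∈) → d x∈ }

length-allFin : ∀ n → length (allFin n) ≡ n
length-allFin n = length-tabulate {n = n} id

infix 4 _∈?_
_∈?_ : ∀ {n} (x : Fin n) (xs : List (Fin n)) → Dec (x ∈ xs)
_∈?_ = mem? _≟ᶠ_

# : ∀ {n} {P : Fin n → Set} → Decidable P → ℕ
# {n} P? = count P? (allFin n)

module _ {n : ℕ} where

  private
    V = Fin n

  #-mono : {P Q : V → Set} (P? : Decidable P) (Q? : Decidable Q) → (∀ {x} → P x → Q x) → # P? ≤ # Q?
  #-mono P? Q? h = count-mono P? Q? (allFin n) λ _ → h

  #-cong : {P Q : V → Set} (P? : Decidable P) (Q? : Decidable Q) → (∀ {x} → P x → Q x) → (∀ {x} → Q x → P x) →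
      # P? ≡ # Q?
  #-cong P? Q? h h′ = ≤-antisym (#-mono P? Q? h) (#-mono Q? P? h′)

  #-∪≤ : {P Q R : V → Set} (P? : Decidable P) (Q? : Decidable Q) (R? : Decidable R) →
         (∀ {x} → P x → Q x ⊎ R x) → # P? ≤ # Q? + # R?
  #-∪≤ P? Q? R? h = count-∪≤ P? Q? R? (allFin n) λ _ → h

  #-⊎≥ : {P Q R : V → Set} (P? : Decidable P) (Q? : Decidable Q) (R? : Decidable R) →
         (∀ {x} → Q x → P x) → (∀ {x} → R x → P x) → (∀ {x} → Q x → ¬ R x) → # Q? + # R? ≤ # P?
  #-⊎≥ P? Q? R? f g h = count-⊎≥ P? Q? R? (allFin n) (λ _ → f) (λ _ → g) (λ _ → h)

  #-∁ : {P : V → Set} (P? : Decidable P) → # P? + # (¬? ∘ P?) ≡ n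
  #-∁ P? = trans (count-∁ P? (allFin n)) (length-allFin n)

  #≤length : {P : V → Set} (P? : Decidable P) (us : List V) → (∀ {x} → P x → x ∈ us) → # P? ≤ length us
  #≤length P? us h = unique-⊆-length (Uniqueₚ.filter⁺ P? (Uniqueₚ.allFin⁺ n))
      (h ∘ proj₂ ∘ ∈-filter⁻ P? {xs = allFin n})

  length≤# : {P : V → Set} (P? : Decidable P) {us : List V} → Unique us → (∀ {x} → x ∈ us → P x) → length us ≤ # P?
  length≤# P? u h = unique-⊆-length u λ x∈ → ∈-filter⁺ P? (∈-allFin _) (h x∈)

  #∈ : ∀ {us : List V} → Unique us → # (_∈? us) ≡ length us
  #∈ {us} u = ≤-antisym (#≤length (_∈? us) us id) (length≤# (_∈? us) u id)

  count≤# : {P : V → Set} (P? : Decidable P) {xs : List V} → Unique xs → count P? xs ≤ # P?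
  count≤# P? {xs} u = length≤# P? (Uniqueₚ.filter⁺ P? u) (proj₂ ∘ ∈-filter⁻ P? {xs = xs})

  #≤count : {P : V → Set} (P? : Decidable P) {xs : List V} → (∀ {x} → P x → x ∈ xs) → # P? ≤ count P? xs
  #≤count P? {xs} h = #≤length P? (filter P? xs) λ px → ∈-filter⁺ P? (h px) px

  unique-length≤n : ∀ {xs : List V} → Unique xs → length xs ≤ n
  unique-length≤n u = ≤-trans (unique-⊆-length u (λ {x} _ → ∈-allFin x)) (≤-reflexive (length-allFin n))

  fresh : {P : V → Set} (P? : Decidable P) (us : List V) → length us < # P? → ∃ λ x → P x × x ∉ us
  fresh P? us lt with any? (λ x → P? x ×-dec ¬? (x ∈? us))
  ... | yes found = found
  ... | no none = contradiction (#≤length P? us λ {x} px →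
      case x ∈? us of λ { (yes x∈) → x∈ ; (no x∉) → contradiction (x , px , x∉) none }) (<⇒≱ lt)

  #>⇒∃ : {P Q : V → Set} (P? : Decidable P) (Q? : Decidable Q) → # Q? < # P? → ∃ λ x → P x × ¬ Q x
  #>⇒∃ P? Q? lt with any? (λ x → P? x ×-dec ¬? (Q? x))
  ... | yes found = found
  ... | no none = contradiction (#-mono P? Q? λ {x} px →
      case Q? x of λ { (yes q) → q ; (no ¬q) → contradiction (x , px , ¬q) none }) (<⇒≱ lt)

  ∃∉ : ∀ (xs : List V) → length xs < n → ∃ λ v → v ∉ xs
  ∃∉ xs lt with any? (λ v → ¬? (v ∈? xs))
  ... | yes found = found
  ... | no none = contradiction (≤-trans (eq≥ (length-allFin n)) (unique-⊆-length (Uniqueₚ.allFin⁺ n) λ {v} _ →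
          case v ∈? xs of λ { (yes v∈) → v∈ ; (no v∉) → contradiction (v , v∉) none })) (<⇒≱ lt)

  ham-↭ : ∀ {xs : List V} → Unique xs → n ≤ length xs → xs ↭ allFin n
  ham-↭ u le = unique-⊆-↭ u (λ {x} _ → ∈-allFin x) (≤-trans (≤-reflexive (length-allFin n)) le)

-- Stands in for the classical step "unless some index yields `A`, all satisfy `B`": there are
-- finitely many indices, so all answers can be inspected.
∀-⊎ : ∀ {n} {A : Set} {B : Fin n → Set} → (∀ i → A ⊎ B i) → A ⊎ (∀ i → B i)
∀-⊎ {zero} f = inj₂ λ ()
∀-⊎ {suc n} {B = B} f with f zero | ∀-⊎ {B = B ∘ suc} (f ∘ suc)
... | inj₁ a | _ = inj₁ a
... | _ | inj₁ a = inj₁ a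
... | inj₂ b | inj₂ bs = inj₂ λ { zero → b ; (suc i) → bs i }

-- Links and paths

module _ {A : Set} where

  links : List A → List (A × A)
  links []           = []
  links (x ∷ [])     = []
  links (x ∷ y ∷ zs) = (x , y) ∷ links (y ∷ zs)

  links-++ : ∀ ys {x y : A} zs → links (ys ++ x ∷ y ∷ zs) ≡ links (ys ++ [ x ]) ++ (x , y) ∷ links (y ∷ zs)
  links-++ [] zs = refl
  links-++ (a ∷ []) zs = refl
  links-++ (a ∷ b ∷ ys) zs = cong ((a , b) ∷_) (links-++ (b ∷ ys) zs)

  links-++ˡ : ∀ {l} xs {ys : List A} → l ∈ links xs → l ∈ links (xs ++ ys)
  links-++ˡ (x ∷ y ∷ xs) (here refl) = here refl
  links-++ˡ (x ∷ y ∷ xs) (there l∈) = there (links-++ˡ (y ∷ xs) l∈)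

  links-∷ : ∀ {l} x {ys : List A} → l ∈ links ys → l ∈ links (x ∷ ys)
  links-∷ x {y ∷ ys} l∈ = there l∈

  links-++ʳ : ∀ {l} xs {ys : List A} → l ∈ links ys → l ∈ links (xs ++ ys)
  links-++ʳ [] l∈ = l∈
  links-++ʳ (x ∷ xs) l∈ = links-∷ x (links-++ʳ xs l∈)

  links-split : ∀ {p q} (xs : List A) → (p , q) ∈ links xs → ∃₂ λ ys zs → xs ≡ ys ++ p ∷ q ∷ zs
  links-split (x ∷ y ∷ xs) (here refl) = [] , xs , refl
  links-split (x ∷ y ∷ xs) (there l∈) with links-split (y ∷ xs) l∈
  ... | ys , zs , eq = x ∷ ys , zs , cong (x ∷_) eq

  reverse-∷∷ : ∀ (x y : A) zs → reverse (x ∷ y ∷ zs) ≡ reverse zs ++ y ∷ x ∷ []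
  reverse-∷∷ x y zs = trans (unfold-reverse x (y ∷ zs))
    (trans (cong (_++ [ x ]) (unfold-reverse y zs)) (++-assoc (reverse zs) [ y ] [ x ]))

  module _ {P : A × A → Set} (P? : Decidable P) where

    count-links-++ : ∀ ys {x y} zs →
      count P? (links (ys ++ x ∷ y ∷ zs)) ≡ count P? (links (ys ++ [ x ])) +
          (count P? [ (x , y) ] + count P? (links (y ∷ zs)))
    count-links-++ ys {x} {y} zs = trans (cong (count P?) (links-++ ys zs))
      (trans (count-++ P? (links (ys ++ [ x ])) _) (cong (count P? (links (ys ++ [ x ])) +_)
          (count-++ P? [ (x , y) ] (links (y ∷ zs)))))

    count-links-reverse : (∀ {x y} → P (x , y) → P (y , x)) → ∀ xs →
        count P? (links (reverse xs)) ≡ count P? (links xs)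
    count-links-reverse s [] = refl
    count-links-reverse s (x ∷ []) = refl
    count-links-reverse s (x ∷ y ∷ zs) = begin
      count P? (links (reverse (x ∷ y ∷ zs)))                            ≡⟨ cong (count P? ∘ links)
          (reverse-∷∷ x y zs) ⟩
      count P? (links (reverse zs ++ y ∷ x ∷ []))                        ≡⟨ count-links-++ (reverse zs) [] ⟩
      count P? (links (reverse zs ++ [ y ])) + (count P? [ (y , x) ] + 0) ≡⟨ cong₂ _+_
          (cong (count P? ∘ links) (sym (unfold-reverse y zs))) (+-identityʳ _) ⟩
      count P? (links (reverse (y ∷ zs))) + count P? [ (y , x) ]         ≡⟨ cong₂ _+_
          (count-links-reverse s (y ∷ zs)) flip₁ ⟩
      count P? (links (y ∷ zs)) + count P? [ (x , y) ]                   ≡⟨ +-comm (count P? (links (y ∷ zs))) _ ⟩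
      count P? [ (x , y) ] + count P? (links (y ∷ zs))                   ≡⟨ sym
          (count-++ P? [ (x , y) ] (links (y ∷ zs))) ⟩
      count P? (links (x ∷ y ∷ zs))                                      ∎
      where
      open ≡-Reasoning
      flip₁ : count P? [ (y , x) ] ≡ count P? [ (x , y) ]
      flip₁ with P? (y , x) | P? (x , y)
      ... | yes _ | yes _ = refl
      ... | yes p | no ¬q = contradiction (s p) ¬q
      ... | no ¬p | yes q = contradiction (s q) ¬p
      ... | no _  | no _  = refl

data Path {A : Set} (R : A → A → Set) : A → A → List A → Set where
  stop : ∀ {x} → Path R x x [ x ]
  _►_  : ∀ {x y z ys} → R x y → Path R y z ys → Path R x z (x ∷ ys)

infixr 5 _►_

module _ {A : Set} {R : A → A → Set} where

  path-++ : ∀ {x y z w xs ys} → Path R x y xs → R y z → Path R z w ys → Path R x w (xs ++ ys)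
  path-++ stop r q = r ► q
  path-++ (s ► p) r q = s ► path-++ p r q

  path-split : ∀ ys {u v x zs} → Path R u v (ys ++ x ∷ zs) → Path R u x (ys ++ [ x ]) × Path R x v (x ∷ zs)
  path-split [] stop = stop , stop
  path-split [] (r ► p) = stop , r ► p
  path-split (y ∷ []) (r ► p) with path-split [] p
  ... | p₁ , p₂ = r ► p₁ , p₂
  path-split (y ∷ y′ ∷ ys) (r ► p) with path-split (y′ ∷ ys) p
  ... | p₁ , p₂ = r ► p₁ , p₂

  path-∷⁻ : ∀ {u v x y zs} → Path R u v (x ∷ y ∷ zs) → R x y × Path R y v (y ∷ zs)
  path-∷⁻ (r ► stop) = r , stop
  path-∷⁻ (r ► (s ► p)) = r , s ► p

  path-cut : ∀ ys {u v x y zs} → Path R u v (ys ++ x ∷ y ∷ zs) →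
      Path R u x (ys ++ [ x ]) × R x y × Path R y v (y ∷ zs)
  path-cut ys p with path-split ys p
  ... | p₁ , p₂ = p₁ , path-∷⁻ p₂

  path-src : ∀ {u v xs} → Path R u v xs → ∃ λ ys → xs ≡ u ∷ ys
  path-src stop = [] , refl
  path-src (r ► p) = _ , refl

  path-break : ∀ y ys {u v x zs} → Path R u v (y ∷ ys ++ x ∷ zs) → ∃ λ z → Path R u z (y ∷ ys) × R z x
  path-break y [] (r ► stop) = y , stop , r
  path-break y [] (r ► (_ ► _)) = y , stop , r
  path-break y (y′ ∷ ys) (r ► p) with path-break y′ ys p
  ... | z , q , s = z , r ► q , s

  -- A cycle is kept as a path with a closing edge; here its starting point moves to `x`, and the
  -- old closing edge becomes an interior link.
  path-rotate : ∀ ys {u v x zs} → Path R u v (ys ++ x ∷ zs) → R v u → ∃ λ z → Path R x z ((x ∷ zs) ++ ys) × R z x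
  path-rotate [] {u} {v} {x} {zs} p r rewrite ++-identityʳ zs with path-src p
  ... | _ , refl = v , p , r
  path-rotate (y ∷ ys) p r with path-break y ys p
  ... | z , q , s with path-src p
  ...   | _ , refl = z , path-++ (proj₂ (path-split (y ∷ ys) p)) r q , s

  path-reverse : Symmetric R → ∀ {u v xs} → Path R u v xs → Path R v u (reverse xs)
  path-reverse s stop = stop
  path-reverse s {xs = x ∷ xs} (r ► p) rewrite unfold-reverse x xs = path-++ (path-reverse s p) (s r) stop

  path-link : ∀ {u v p q xs} → Path R u v xs → (p , q) ∈ links xs → R p q
  path-link (r ► stop) (here refl) = r
  path-link (r ► (r′ ► p)) (here refl) = r
  path-link (r ► (r′ ► p)) (there l∈) = path-link (r′ ► p) l∈

  path-map : ∀ {Q : A → A → Set} {u v xs} → (∀ {p q} → (p , q) ∈ links xs → R p q → Q p q) → Path R u v xs →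
      Path Q u v xs
  path-map f stop = stop
  path-map f (r ► stop) = f (here refl) r ► stop
  path-map f (r ► (r′ ► p)) = f (here refl) r ► path-map (f ∘ there) (r′ ► p)

  path-src∈ : ∀ {u v xs} → Path R u v xs → u ∈ xs
  path-src∈ stop = here refl
  path-src∈ (r ► p) = here refl

  path-dst∈ : ∀ {u v xs} → Path R u v xs → v ∈ xs
  path-dst∈ stop = here refl
  path-dst∈ (r ► p) = there (path-dst∈ p)

count-links-join : ∀ {A : Set} {R : A → A → Set} {P : A × A → Set} (P? : Decidable P) {u v w z xs ys} →
    Path R u v xs → Path R w z ys →
                   count P? (links (xs ++ ys)) ≡ count P? (links xs) + (count P? [ (v , w) ] + count P? (links ys))
count-links-join P? {v = v} {w} {xs = xs} {ys} p q with path-src q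
... | zs , refl = go p
  where
  open ≡-Reasoning
  go : ∀ {u xs} → Path _ u v xs → count P? (links (xs ++ w ∷ zs)) ≡ count P? (links xs) +
      (count P? [ (v , w) ] + count P? (links (w ∷ zs)))
  go stop = count-++ P? [ (v , w) ] (links (w ∷ zs))
  go {u} {x ∷ xs} (r ► p) with path-src p
  ... | ws , refl = begin
    count P? ((u , _) ∷ links (xs ++ w ∷ zs))              ≡⟨ count-++ P? [ (u , _) ] (links (xs ++ w ∷ zs)) ⟩
    count P? [ (u , _) ] + count P? (links (xs ++ w ∷ zs)) ≡⟨ cong (count P? [ (u , _) ] +_) (go p) ⟩
    count P? [ (u , _) ] + (count P? (links xs) + _)       ≡⟨ sym (+-assoc (count P? [ (u , _) ]) _ _) ⟩
    count P? [ (u , _) ] + count P? (links xs) + _         ≡⟨ cong (_+ _) (sym (count-++ P? [ (u , _) ] (links xs)))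
        ⟩
    count P? (links (u ∷ xs)) + _                          ∎

unique-reverse : ∀ {A : Set} {xs : List A} → Unique xs → Unique (reverse xs)
unique-reverse {xs = xs} = unique-↭ (↭-sym (↭-reverse xs))

module _ {A : Set} where

  data Before (x y : A) : List A → Set where
    here  : ∀ {xs} → y ∈ xs → Before x y (x ∷ xs)
    there : ∀ {z xs} → Before x y xs → Before x y (z ∷ xs)

  before-++ˡ⁻ : ∀ {x y : A} xs {ys} → x ∉ xs → Before x y (xs ++ ys) → Before x y ys
  before-++ˡ⁻ [] x∉ b = b
  before-++ˡ⁻ (z ∷ xs) x∉ (here _) = contradiction (here refl) x∉
  before-++ˡ⁻ (z ∷ xs) x∉ (there b) = before-++ˡ⁻ xs (x∉ ∘ there) b

  before-++ʳ : ∀ {x y : A} xs {ys} → Before x y ys → Before x y (xs ++ ys)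
  before-++ʳ [] b = b
  before-++ʳ (z ∷ xs) b = there (before-++ʳ xs b)

  allPairs-before : ∀ {R : A → A → Set} {x y xs} → AllPairs R xs → Before x y xs → R x y
  allPairs-before (r ∷ rs) (here y∈) = All.lookup r y∈
  allPairs-before (r ∷ rs) (there b) = allPairs-before rs b

  before-++ : ∀ {x y : A} {xs ys} → x ∈ xs → y ∈ ys → Before x y (xs ++ ys)
  before-++ {xs = z ∷ xs} (here refl) y∈ = here (∈-++⁺ʳ xs y∈)
  before-++ (there x∈) y∈ = there (before-++ x∈ y∈)

  first : {P : A → Set} (P? : Decidable P) (xs : List A) → 0 < count P? xs →
          ∃ λ f → f ∈ xs × P f × (∀ {w} → w ∈ xs → P w → w ≢ f → Before f w xs)
  first P? (x ∷ xs) pos with P? x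
  ... | yes p = x , here refl , p , λ { (here refl) _ w≢ → contradiction refl w≢ ; (there w∈) _ _ → here w∈ }
  ... | no ¬p with first P? xs pos
  ... | f , f∈ , pf , fst = f , there f∈ , pf , λ { (here refl) pw _ → contradiction pw ¬p ; (there w∈) pw w≢ →
      there (fst w∈ pw w≢) }

  module _ {P Q : A → Set} (P? : Decidable P) (Q? : Decidable Q) where

    -- With `P` for the neighbours of the last vertex of a path and `Q` for those of the first, this
    -- is a pair of crossing chords whose cycle omits exactly `zs`, a stretch without neighbours of
    -- either end.
    record Gap (xs : List A) : Set where
      field
        {x y}    : A
        {ys zs ws} : List A
        split    : xs ≡ (ys ++ [ x ]) ++ zs ++ y ∷ ws
        Px       : P x
        Qy       : Q y
        noP      : All (¬_ ∘ P) zs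
        noQ      : All (¬_ ∘ Q) zs

    scan : ∀ xs → Gap xs ⊎ AllPairs (λ x y → P x → ¬ Q y) xs
    scan [] = inj₂ []
    scan (x ∷ xs) with scan xs
    ... | inj₁ g = inj₁ record { Gap g ; ys = x ∷ Gap.ys g ; split = cong (x ∷_) (Gap.split g) }
    ... | inj₂ sep with P? x
    ...   | no ¬p = inj₂ (All.tabulate (λ _ p → contradiction p ¬p) ∷ sep)
    ...   | yes p with firstQ xs
      where
      firstQ : ∀ xs → (∃ λ zs → ∃ λ y → ∃ λ ws → xs ≡ zs ++ y ∷ ws × Q y × All (¬_ ∘ Q) zs) ⊎ All (¬_ ∘ Q) xs
      firstQ [] = inj₂ []
      firstQ (y ∷ xs) with Q? y
      ... | yes q = inj₁ ([] , y , xs , refl , q , [])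
      ... | no ¬q with firstQ xs
      ... | inj₁ (zs , y′ , ws , eq , q , none) = inj₁ (y ∷ zs , y′ , ws , cong (y ∷_) eq , q , ¬q ∷ none)
      ... | inj₂ none = inj₂ (¬q ∷ none)
    ...     | inj₂ none = inj₂ (All.map (λ ¬q _ → ¬q) none ∷ sep)
    ...     | inj₁ (zs , y , ws , refl , q , none) = inj₁ record
      { ys = [] ; split = refl ; Px = p ; Qy = q ; noQ = none
      -- A `P` inside `zs` would precede `y`, against the separation already known for the tail.
      ; noP = All.tabulate λ z∈ pz → allPairs-before sep (before-++ z∈ (here refl)) pz q }

    -- Charge to each link the `P` of its left end and the `Q` of its right end, together at most
    -- one. The last vertex starts no link, and its possible `P` accounts for the extra 1.
    noLink-count′ : ∀ x xs → (∀ {p q} → (p , q) ∈ links (x ∷ xs) → P p → ¬ Q q) →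
        count P? (x ∷ xs) + count Q? xs ≤ suc (length xs)
    noLink-count′ x [] h with P? x
    ... | yes _ = ≤-refl
    ... | no _  = z≤n
    noLink-count′ x (y ∷ xs) h with noLink-count′ y xs (λ l∈ → h (there l∈))
    ... | ih with P? x | Q? y
    ... | yes p | yes q = contradiction q (h (here refl) p)
    ... | yes p | no ¬q = s≤s ih
    ... | no ¬p | yes q = ≤-trans (≤-reflexive (+-suc _ _)) (s≤s ih)
    ... | no ¬p | no ¬q = m≤n⇒m≤1+n ih

    noLink-count : ∀ xs → (∀ {p q} → (p , q) ∈ links xs → P p → ¬ Q q) → count P? xs + count Q? xs ≤ suc (length xs)
    noLink-count [] h = z≤n
    noLink-count (x ∷ xs) h with noLink-count′ x xs h
    ... | t with Q? x
    ... | yes _ = ≤-trans (≤-reflexive (+-suc _ _)) (s≤s t)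
    ... | no _  = m≤n⇒m≤1+n t

  module _ {Q : A → Set} (Q? : Decidable Q) where

    preds : List A → List A
    preds []       = []
    preds (x ∷ []) = []
    preds (x ∷ y ∷ zs) = if does (Q? y) then x ∷ preds (y ∷ zs) else preds (y ∷ zs)

    preds-length : ∀ x xs → length (preds (x ∷ xs)) ≡ count Q? xs
    preds-length x [] = refl
    preds-length x (y ∷ xs) with Q? y
    ... | yes _ = cong suc (preds-length y xs)
    ... | no _  = preds-length y xs

    preds-link : ∀ {z} xs → z ∈ preds xs → ∃ λ y → (z , y) ∈ links xs × Q y
    preds-link {z} (x ∷ y ∷ xs) z∈ with preds-link {z} (y ∷ xs) | Q? y | z∈
    ... | ih | yes q | here refl = y , here refl , q
    ... | ih | yes q | there z∈′ with ih z∈′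
    ...   | w , l∈ , qw = w , there l∈ , qw
    preds-link {z} (x ∷ y ∷ xs) z∈ | ih | no _ | z∈′ with ih z∈′
    ...   | w , l∈ , qw = w , there l∈ , qw

    preds-⊆ : ∀ {z} xs → z ∈ preds xs → z ∈ xs
    preds-⊆ {z} (x ∷ y ∷ xs) z∈ with preds-⊆ {z} (y ∷ xs) | Q? y | z∈
    ... | ih | yes _ | here refl = here refl
    ... | ih | yes _ | there z∈′ = there (ih z∈′)
    ... | ih | no _  | z∈′ = there (ih z∈′)

    preds-unique : ∀ {xs} → Unique xs → Unique (preds xs)
    preds-unique {[]} u = []
    preds-unique {x ∷ []} u = []
    preds-unique {x ∷ y ∷ xs} (x∉ ∷ u) with Q? y
    ... | yes _ = All.tabulate (λ z∈ → All.lookup x∉ (preds-⊆ (y ∷ xs) z∈)) ∷ preds-unique u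
    ... | no _  = preds-unique u

-- Long cycles and extremal structures

module DecPair {n : ℕ} = Data.List.Membership.DecPropositional (×ₚ.≡-dec (_≟ᶠ_ {n}) (_≟ᶠ_ {n}))

module _ {n : ℕ} (G : Graph n) where

  record UPath : Set where
    field
      {src dst} : Fin n
      {verts}   : List (Fin n)
      path      : Path (Adj G) src dst verts
      unique    : Unique verts

  record Cycle : Set where
    field
      {src dst} : Fin n
      {verts}   : List (Fin n)
      path      : Path (Adj G) src dst verts
      close     : Adj G dst src
      unique    : Unique verts

  record Split (e : ℕ) : Set where
    field
      {A B}    : List (Fin n)
      uniqueA  : Unique A
      uniqueB  : Unique B
      disjoint : ∀ {x} → x ∈ A → x ∉ B
      nonadj   : ∀ {x y} → x ∈ A → y ∈ B → ¬ Adj G x y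
      bigA     : n ≤ 2 * length A + e
      bigB     : n ≤ 2 * length B + e

  record Independent (e : ℕ) : Set where
    field
      {I}    : List (Fin n)
      unique : Unique I
      indep  : ∀ {x y} → x ∈ I → y ∈ I → ¬ Adj G x y
      bigI   : n ≤ 2 * length I + e

module _ {n : ℕ} {G : Graph n} where

  size : UPath G → ℕ
  size P = length (UPath.verts P)

  len : Cycle G → ℕ
  len C = length (Cycle.verts C)

  reversePath : UPath G → UPath G
  reversePath P = record { path = path-reverse (adj-sym G) (UPath.path P) ; unique =
      unique-reverse (UPath.unique P) }

  consPath : (P : UPath G) {w : Fin n} → Adj G w (UPath.src P) → w ∉ UPath.verts P → UPath G
  consPath P r w∉ = record { path = r ► UPath.path P ; unique = unique-∷ w∉ (UPath.unique P) }

  -- Closing a path up along two chords, from its last vertex back to x and from its first vertex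
  -- forward to y, skips the stretch zs between x and y.
  skipCycle : ∀ {u v x y} ys zs ws → Path (Adj G) u v ((ys ++ [ x ]) ++ zs ++ y ∷ ws) →
      Unique ((ys ++ [ x ]) ++ zs ++ y ∷ ws) →
              Adj G v x → Adj G u y → Cycle G
  skipCycle {u} {v} {x} {y} ys zs ws p un vx uy = record
    { verts  = (ys ++ [ x ]) ++ reverse (y ∷ ws)
    ; path   = path-++ front (adj-sym G vx) (path-reverse (adj-sym G) back)
    ; close  = adj-sym G uy
    ; unique = unique-++ (proj₁ parts) (unique-reverse (proj₁ (proj₂ parts′))) λ z∈ z∈′ →
                 proj₂ (proj₂ parts) z∈ (∈-++⁺ʳ zs (∈-resp-↭ (↭-reverse (y ∷ ws)) z∈′))
    }
    where
    front : Path (Adj G) u x (ys ++ [ x ])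
    front = proj₁ (path-split ys (subst (Path (Adj G) u v) (++-assoc ys [ x ] (zs ++ y ∷ ws)) p))
    back : Path (Adj G) y v (y ∷ ws)
    back = proj₂ (path-split ((ys ++ [ x ]) ++ zs) (subst (Path (Adj G) u v)
        (sym (++-assoc (ys ++ [ x ]) zs (y ∷ ws))) p))
    parts = unique-++⁻ (ys ++ [ x ]) un
    parts′ = unique-++⁻ zs (proj₁ (proj₂ parts))

  -- Opened at `x`, the cycle becomes a path on the same vertices that starts at `x` and can be
  -- extended by `y`.
  cutCycle : ∀ (C : Cycle G) {x y} → x ∈ Cycle.verts C → y ∉ Cycle.verts C → Adj G x y →
             Σ (UPath G) λ P → len C < size P
  cutCycle record { path = path ; close = close ; unique = unique } {x} {y} x∈ y∉ xy with ∈-∃++ x∈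
  ... | ys , zs , refl with path-rotate ys path close
  ... | z , p , _ = consPath (record { path = p ; unique = unique-↭ rot unique }) (adj-sym G xy)
      (y∉ ∘ ∈-resp-↭ (↭-sym rot)) ,
    s≤s (≤-reflexive (↭-length rot))
    where
    rot : ys ++ x ∷ zs ↭ (x ∷ zs) ++ ys
    rot = ++-comm ys (x ∷ zs)

  Closed : Fin n → List (Fin n) → Set
  Closed v xs = ∀ w → Adj G v w → w ∈ xs

  degree≤count : ∀ {v xs} → Closed v xs → degree G v ≤ count (adj? G v) xs
  degree≤count {v} h = #≤count (adj? G v) (h _)

  closed? : ∀ v xs → (∃ λ w → Adj G v w × w ∉ xs) ⊎ Closed v xs
  closed? v xs with any? (λ w → adj? G v w ×-dec ¬? (w ∈? xs))
  ... | yes found = inj₁ found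
  ... | no none = inj₂ λ w vw → case w ∈? xs of λ { (yes w∈) → w∈ ; (no w∉) → contradiction (w , vw , w∉) none }

module Dichotomy {n : ℕ} (G : Graph n) (e : ℕ) (dense : ∀ v → n ≤ 2 * degree G v + e) (e<n : e < n) where

  Outcome : Set
  Outcome = (Σ (Cycle G) λ C → n ≤ len C + (e + 2)) ⊎ Split G (e + 2)

  -- The induction hypothesis on the length of a path, passed around as an argument; `explore`
  -- supplies it, with the number of vertices still off the path as fuel.
  Longer : ℕ → Set
  Longer m = ∀ (P : UPath G) → m < size P → Outcome

  outside : List (Fin n) → List (Fin n)
  outside xs = filter (λ w → ¬? (w ∈? xs)) (allFin n)

  ∈-outside : ∀ {w xs} → w ∉ xs → w ∈ outside xs
  ∈-outside {w} {xs} w∉ = ∈-filter⁺ (λ w → ¬? (w ∈? xs)) (∈-allFin w) w∉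

  outside⁻ : ∀ {w xs} → w ∈ outside xs → w ∉ xs
  outside⁻ {xs = xs} w∈ = proj₂ (∈-filter⁻ (λ w → ¬? (w ∈? xs)) {xs = allFin n} w∈)

  -- If no edge leaves `C`, then `C` and its complement contain the full neighbourhoods of their
  -- vertices, so both have at least `(n − e)/2` vertices and form a split.
  fromCycle : (C : Cycle G) → Longer (len C) → Outcome
  fromCycle C longer with any? (λ y → ¬? (y ∈? Cycle.verts C))
  ... | no all = inj₁ (C , ≤-trans (≤-trans (eq≥ (length-allFin n)) (unique-⊆-length (Uniqueₚ.allFin⁺ n) λ {y} _ →
            case y ∈? Cycle.verts C of λ { (yes y∈) → y∈ ; (no y∉) → contradiction (y , y∉) all })) (m≤m+n _ _))
  ... | yes (o , o∉) with any? (λ x → any? λ y → (x ∈? Cycle.verts C) ×-dec ¬? (y ∈? Cycle.verts C) ×-dec adj? G x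
      y)
  ... | yes (x , y , x∈ , y∉ , xy) = case cutCycle C x∈ y∉ xy of λ (P , lt) → longer P lt
  ... | no none = inj₂ record
    { A = Cycle.verts C ; B = outside (Cycle.verts C)
    ; uniqueA = Cycle.unique C
    ; uniqueB = Uniqueₚ.filter⁺ _ (Uniqueₚ.allFin⁺ n)
    ; disjoint = λ x∈ x∈′ → outside⁻ {xs = Cycle.verts C} x∈′ x∈
    ; nonadj = λ x∈ y∈ xy → none (_ , _ , x∈ , outside⁻ {xs = Cycle.verts C} y∈ , xy)
    ; bigA = lin (n ∷ e ∷ degree G (Cycle.src C) ∷ len C ∷ [])
      (λ n e d l → (n :≤ 2 :* d :+ e) ∷ (d :≤ l) ∷ [] ⊢ n :≤ 2 :* l :+ (e :+ con 2)) 0 (1 ∷ 2 ∷ [])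
      (dense (Cycle.src C) ∷ degA ∷ [])
    ; bigB = lin (n ∷ e ∷ degree G o ∷ length (outside (Cycle.verts C)) ∷ [])
      (λ n e d l → (n :≤ 2 :* d :+ e) ∷ (d :≤ l) ∷ [] ⊢ n :≤ 2 :* l :+ (e :+ con 2)) 0 (1 ∷ 2 ∷ [])
      (dense o ∷ degB ∷ [])
    }
    where
    degA : degree G (Cycle.src C) ≤ len C
    degA = #≤length (adj? G (Cycle.src C)) (Cycle.verts C) λ {w} uw → case w ∈? Cycle.verts C of λ
      { (yes w∈) → w∈ ; (no w∉) → contradiction (_ , w , path-src∈ (Cycle.path C) , w∉ , uw) none }
    degB : degree G o ≤ length (outside (Cycle.verts C))
    degB = #≤length (adj? G o) (outside (Cycle.verts C)) λ {w} yw → case w ∈? Cycle.verts C of λ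
      { (no w∉) → ∈-outside w∉ ; (yes w∈) → contradiction (w , o , w∈ , o∉ , adj-sym G yw) none }

  Separated : Fin n → Fin n → List (Fin n) → Set
  Separated u v = AllPairs (λ x y → Adj G v x → ¬ Adj G u y)

  -- Both ends have all their neighbours on the path. A link `(x , y)` with `x` adjacent to `v` and
  -- `y` to `u` closes the path up on the same vertices. Without such a link the degrees of `u` and
  -- `v` sum to at most `|front| + |back| + 2` around a gap, so the cycle skipping it misses at most
  -- `e + 2` vertices. Without a gap the ends are separated.
  fromPath : ∀ {u v xs} → Path (Adj G) u v xs → Unique xs → Closed {G = G} u xs → Closed {G = G} v xs →
             Longer (length xs) → Outcome ⊎ Separated u v xs
  fromPath {u} {v} {xs} p un cu cv longer with any? (λ x → any? λ y →
      mem-link? x y ×-dec adj? G v x ×-dec adj? G u y)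
    where
    mem-link? : ∀ x y → Dec ((x , y) ∈ links xs)
    mem-link? x y = DecPair._∈?_ (x , y) (links xs)
  ... | yes (x , y , l∈ , vx , uy) with links-split xs l∈
  ...   | ys , zs , refl = inj₁ (fromCycle C (λ P lt → longer P (≤-trans (≤-reflexive (cong suc (sym same))) lt)))
    where
    eq = sym (++-assoc ys [ x ] (y ∷ zs))
    C = skipCycle ys [] zs (subst (Path (Adj G) u v) eq p) (subst Unique eq un) vx uy
    same : len C ≡ length (ys ++ x ∷ y ∷ zs)
    same = trans (↭-length (↭-++⁺ˡ (ys ++ [ x ]) (↭-reverse (y ∷ zs)))) (cong length (sym eq))
  fromPath {u} {v} {xs} p un cu cv longer | no nolink with scan (adj? G v) (adj? G u) xs
  ... | inj₂ sep = inj₂ sep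
  ... | inj₁ record { x = x ; y = y ; ys = ys ; zs = zs ; ws = ws ; split = refl ; Px = vx ; Qy = uy ; noP =
      noP ; noQ = noQ } =
    inj₁ (inj₁ (C , le))
    where
    C = skipCycle ys zs ws p un vx uy
    a = count (adj? G v)
    b = count (adj? G u)
    front = ys ++ [ x ]
    back = y ∷ ws
    split-a : a (front ++ zs ++ back) ≡ a front + (a zs + a back)
    split-a = trans (count-++ (adj? G v) front _) (cong (a front +_) (count-++ (adj? G v) zs back))
    split-b : b (front ++ zs ++ back) ≡ b front + (b zs + b back)
    split-b = trans (count-++ (adj? G u) front _) (cong (b front +_) (count-++ (adj? G u) zs back))
    fb : a front + b front ≤ suc (length front)
    fb = noLink-count (adj? G v) (adj? G u) front λ l∈ va ub → nolink (_ , _ , links-++ˡ front l∈ , va , ub)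
    bb : a back + b back ≤ suc (length back)
    bb = noLink-count (adj? G v) (adj? G u) back λ l∈ va ub →
        nolink (_ , _ , links-++ʳ front (links-++ʳ zs l∈) , va , ub)
    lenC : len C ≡ length front + length back
    lenC = trans (length-++ front) (cong (length front +_) (length-reverse back))
    le : n ≤ len C + (e + 2)
    le = lin (n ∷ e ∷ degree G u ∷ degree G v ∷ a (front ++ zs ++ back) ∷ b (front ++ zs ++ back) ∷
        a front ∷ a zs ∷ a back ∷ b front ∷ b zs ∷ b back ∷ length front ∷ length back ∷ len C ∷ [])
      (λ n e du dv A B af az ab bf bz bb lf lb L → (n :≤ 2 :* du :+ e) ∷ (n :≤ 2 :* dv :+ e) ∷ (du :≤ B) ∷
        (dv :≤ A) ∷ (A :≤ af :+ (az :+ ab)) ∷ (B :≤ bf :+ (bz :+ bb)) ∷ (az :≤ con 0) ∷ (bz :≤ con 0) ∷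
        (af :+ bf :≤ con 1 :+ lf) ∷ (ab :+ bb :≤ con 1 :+ lb) ∷ (lf :+ lb :≤ L) ∷ [] ⊢ n :≤ L :+ (e :+ con 2)) 1
            (1 ∷ 1 ∷ 2 ∷ 2 ∷ 2 ∷ 2 ∷ 2 ∷ 2 ∷ 2 ∷ 2 ∷ 2 ∷ [])
      (dense u ∷ dense v ∷ degree≤count {G = G} cu ∷ degree≤count {G = G} cv ∷ eq≤ split-a ∷ eq≤ split-b ∷
        eq≤ (count-none (adj? G v) zs (All.lookup noP)) ∷ eq≤ (count-none (adj? G u) zs (All.lookup noQ)) ∷
        fb ∷ bb ∷ eq≥ lenC ∷ [])

  -- In the separated case no neighbour of `u` comes after `f`, the first neighbour of `v`. Rotating
  -- at a neighbour `y` of `u` makes the predecessor `z` of `y` the first vertex and leaves the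
  -- stretch from `y` on, which contains `f`, as it is. If the rotated path is separated too, then
  -- `z` has no neighbour among the neighbours of `v` behind `f`. So either some rotation makes
  -- progress or `A` and `B` form a split.
  analyse : (P : UPath G) → Longer (size P) → Outcome
  analyse P longer with closed? {G = G} (UPath.src P) (UPath.verts P) | closed? {G = G} (UPath.dst P)
      (UPath.verts P)
  ... | inj₁ (w , uw , w∉) | _ = longer (consPath P (adj-sym G uw) w∉) ≤-refl
  ... | inj₂ _ | inj₁ (w , vw , w∉) =
    longer (consPath (reversePath P) (adj-sym G vw) (w∉ ∘ ∈-resp-↭ (↭-reverse (UPath.verts P))))
        (s≤s (eq≥ (length-reverse (UPath.verts P))))
  ... | inj₂ cu | inj₂ cv with fromPath (UPath.path P) (UPath.unique P) cu cv longer
  ...   | inj₁ out = out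
  analyse record { src = u ; dst = v ; verts = xs ; path = p ; unique = un } longer | inj₂ cu | inj₂ cv | inj₂ sep =
    [ id , (λ bad → inj₂ (split bad)) ]′ (∀-⊎ rotated)
    where
    0<deg : 0 < count (adj? G v) xs
    0<deg = lin (n ∷ e ∷ degree G v ∷ count (adj? G v) xs ∷ [])
      (λ n e d c → (con 1 :+ e :≤ n) ∷ (n :≤ 2 :* d :+ e) ∷ (d :≤ c) ∷ [] ⊢ con 1 :≤ c) 1 (1 ∷ 1 ∷ 2 ∷ [])
      (e<n ∷ dense v ∷ degree≤count {G = G} cv ∷ [])
    fst = first (adj? G v) xs 0<deg
    f = proj₁ fst
    A = preds (adj? G u) xs
    late? = λ w → adj? G v w ×-dec ¬? (w ≟ᶠ f)
    B = filter late? xs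
    rotated : ∀ z → Outcome ⊎ (z ∈ A → ∀ {w} → w ∈ B → ¬ Adj G z w)
    rotated z with z ∈? A
    ... | no z∉ = inj₂ λ z∈ → contradiction z∈ z∉
    ... | yes z∈ with preds-link (adj? G u) xs z∈
    ... | y , l∈ , uy with links-split xs l∈
    ... | ys , ws , refl with closed? {G = G} z xs
    ...   | inj₁ (w , zw , w∉) = inj₁ (longer (consPath (record { path = q ; unique = unique-↭ (↭-sym perm) un })
        (adj-sym G zw) (w∉ ∘ ∈-resp-↭ perm)) (s≤s (eq≥ (↭-length perm))))
      where
      cut = path-cut ys p
      q = path-++ (path-reverse (adj-sym G) (proj₁ cut)) uy (proj₂ (proj₂ cut))
      perm : reverse (ys ++ [ z ]) ++ y ∷ ws ↭ ys ++ z ∷ y ∷ ws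
      perm = ↭-trans (↭-++⁺ʳ (y ∷ ws) (↭-reverse (ys ++ [ z ]))) (↭-reflexive (++-assoc ys [ z ] (y ∷ ws)))
    ...   | inj₂ cz = [ inj₁ , (λ sep′ → inj₂ λ _ {w} w∈ → bad sep′ w∈) ]′
      (fromPath q (unique-↭ (↭-sym perm) un) (λ w zw → ∈-resp-↭ (↭-sym perm) (cz w zw))
          (λ w vw → ∈-resp-↭ (↭-sym perm) (cv w vw))
        (λ P lt → longer P (≤-trans (s≤s (eq≥ (↭-length perm))) lt)))
      where
      cut = path-cut ys p
      q = path-++ (path-reverse (adj-sym G) (proj₁ cut)) uy (proj₂ (proj₂ cut))
      perm : reverse (ys ++ [ z ]) ++ y ∷ ws ↭ ys ++ z ∷ y ∷ ws
      perm = ↭-trans (↭-++⁺ʳ (y ∷ ws) (↭-reverse (ys ++ [ z ]))) (↭-reflexive (++-assoc ys [ z ] (y ∷ ws)))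
      eq : ys ++ z ∷ y ∷ ws ≡ (ys ++ [ z ]) ++ y ∷ ws
      eq = sym (++-assoc ys [ z ] (y ∷ ws))
      f∉ : f ∉ ys ++ [ z ]
      f∉ f∈ = allPairs-before sep (subst (Before f y) (sym eq) (before-++ f∈ (here refl)))
          (proj₁ (proj₂ (proj₂ fst))) uy
      bad : Separated z v (reverse (ys ++ [ z ]) ++ y ∷ ws) → ∀ {w} → w ∈ B → ¬ Adj G z w
      bad sep′ w∈B with ∈-filter⁻ late? {xs = xs} w∈B
      ... | w∈ , vw , w≢f = allPairs-before sep′ (before-++ʳ (reverse (ys ++ [ z ]))
              (before-++ˡ⁻ (ys ++ [ z ]) f∉ (subst (Before f _) eq (proj₂ (proj₂ (proj₂ fst)) w∈ vw w≢f))))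
                  (proj₁ (proj₂ (proj₂ fst)))
    lenA : degree G u ≤ length A
    lenA with path-src p
    ... | xs′ , refl = ≤-trans (degree≤count {G = G} cu)
        (≤-reflexive (trans (count-no (adj? G u) (adj-irrefl G)) (sym (preds-length (adj? G u) u xs′))))
    -- Separation only speaks about vertices behind `f`, so `f` itself has to be left out of `B`.
    lenB : degree G v ≤ length B + 1
    lenB = ≤-trans (degree≤count {G = G} cv) (≤-trans
      (count-∪≤ (adj? G v) late? (_≟ᶠ f) xs λ {w} _ vw →
          case w ≟ᶠ f of λ { (yes eq) → inj₂ eq ; (no ≢) → inj₁ (vw , ≢) })
      (+-monoʳ-≤ (length B) (≤-trans (count≤# (_≟ᶠ f) un) (#≤length (_≟ᶠ f) [ f ] here))))
    split : (∀ z → z ∈ A → ∀ {w} → w ∈ B → ¬ Adj G z w) → Split G (e + 2)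
    split bad = record
      { A = A ; B = B ; uniqueA = preds-unique (adj? G u) un ; uniqueB = Uniqueₚ.filter⁺ late? un
      ; disjoint = λ z∈A z∈B → apart z∈A (proj₁ (proj₂ (∈-filter⁻ late? {xs = xs} z∈B)))
      ; nonadj = λ z∈ → bad _ z∈
      ; bigA = lin (n ∷ e ∷ degree G u ∷ length A ∷ [])
        (λ n e d l → (n :≤ 2 :* d :+ e) ∷ (d :≤ l) ∷ [] ⊢ n :≤ 2 :* l :+ (e :+ con 2)) 0 (1 ∷ 2 ∷ [])
        (dense u ∷ lenA ∷ [])
      ; bigB = (lin (n ∷ e ∷ degree G v ∷ length B ∷ [])
        (λ n e d l → (n :≤ 2 :* d :+ e) ∷ (d :≤ l :+ con 1) ∷ [] ⊢ n :≤ 2 :* l :+ (e :+ con 2)) 0 (1 ∷ 2 ∷ [])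
        (dense v ∷ lenB ∷ [])) }
      where
      apart : ∀ {z} → z ∈ A → ¬ Adj G v z
      apart z∈A vz with preds-link (adj? G u) xs z∈A
      ... | y , l∈ , uy with links-split xs l∈
      ... | ys , ws , refl = allPairs-before sep (before-++ʳ ys (here (here refl))) vz uy

  explore : ∀ d (P : UPath G) → n ≤ d + size P → Outcome
  explore zero P le = analyse P λ P′ lt → contradiction (unique-length≤n (UPath.unique P′))
      (<⇒≱ (≤-trans (s≤s le) lt))
  explore (suc d) P le = analyse P λ P′ lt → explore d P′
      (≤-trans le (≤-trans (eq≥ (+-suc d (size P))) (+-monoʳ-≤ d lt)))

  -- If z and z′ both precede neighbours y and y′ of v on C, the edge z z′ lets v be inserted.
  insert : ∀ (C : Cycle G) {v z z′} → v ∉ Cycle.verts C → z ∈ preds (adj? G v) (Cycle.verts C) →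
      z′ ∈ preds (adj? G v) (Cycle.verts C) →
           Adj G z z′ → Σ (Cycle G) λ C′ → len C < len C′
  insert record { dst = t ; verts = cs ; path = p ; close = c ; unique = un } {v} {z} {z′} v∉ z∈ z′∈ zz′
    with preds-link (adj? G v) cs z∈ | preds-link (adj? G v) cs z′∈
  ... | y , l∈ , vy | y′ , l′∈ , vy′ with links-split cs l∈
  ... | ys , ws , refl with path-cut ys p
  ... | p₁ , _ , p₂ with links-split ((y ∷ ws) ++ (ys ++ [ z ])) link′
    where
    -- Rotated to run from `y` to `z`, the cycle keeps every link except `(z , y)`; the two links
    -- differ since `z` and `z′` are adjacent, hence distinct.
    link′ : (z′ , y′) ∈ links ((y ∷ ws) ++ (ys ++ [ z ]))
    link′ with ∈-++⁻ (links (ys ++ [ z ])) (subst ((z′ , y′) ∈_) (links-++ ys ws) l′∈)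
    ... | inj₁ l∈₁ = links-++ʳ (y ∷ ws) l∈₁
    ... | inj₂ (here refl) = contradiction zz′ (adj-irrefl G)
    ... | inj₂ (there l∈₂) = links-++ˡ (y ∷ ws) l∈₂
  ... | qs , zs , eq with path-cut qs (subst (Path (Adj G) y z) eq (path-++ p₂ c p₁))
  ... | q₁ , _ , q₂ = record
    { path   = vy′ ► path-++ q₂ zz′ (path-reverse (adj-sym G) q₁)
    ; close  = adj-sym G vy
    ; unique = unique-∷ (v∉ ∘ ∈-resp-↭ perm) (unique-↭ (↭-sym perm) un)
    } , s≤s (eq≥ (↭-length perm))
    where
    perm : (y′ ∷ zs) ++ reverse (qs ++ [ z′ ]) ↭ ys ++ z ∷ y ∷ ws
    perm = ↭-trans (↭-++⁺ˡ (y′ ∷ zs) (↭-reverse (qs ++ [ z′ ])))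
          (↭-trans (++-comm (y′ ∷ zs) (qs ++ [ z′ ]))
          (↭-trans (↭-reflexive (trans (++-assoc qs [ z′ ] (y′ ∷ zs)) (sym eq)))
          (↭-trans (++-comm (y ∷ ws) (ys ++ [ z ])) (↭-reflexive (++-assoc ys [ z ] (y ∷ ws))))))

  grow : ∀ d (C : Cycle G) → n ≤ d + len C → n ≤ len C + (e + 2) →
      (Σ (Cycle G) λ C′ → n ≤ len C′) ⊎ Independent G (3 * e + 6)
  grow d C led le with n ≤? len C
  ... | yes le′ = inj₁ (C , le′)
  grow zero C led le | no ≰ = contradiction led ≰
  grow (suc d) C led le | no ≰ with ∃∉ (Cycle.verts C) (≰⇒> ≰)
  ... | v , v∉ with any? (λ z → any? λ z′ → (z ∈? preds (adj? G v) (Cycle.verts C)) ×-dec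
      (z′ ∈? preds (adj? G v) (Cycle.verts C)) ×-dec adj? G z z′)
  ... | yes (z , z′ , z∈ , z′∈ , zz′) with insert C v∉ z∈ z′∈ zz′
  ...   | C′ , lt = grow d C′ (≤-trans led (≤-trans (eq≥ (+-suc d (len C))) (+-monoʳ-≤ d lt)))
      (≤-trans le (+-monoˡ-≤ (e + 2) (<⇒≤ lt)))
  grow (suc d) C led le | no ≰ | v , v∉ | no none = inj₂ record
    { I = I ; unique = preds-unique (adj? G v) (Cycle.unique C) ; indep = λ x∈ y∈ xy → none (_ , _ , x∈ , y∈ , xy)
    -- At most `e + 2` neighbours of `v` lie off the cycle, and one more may head the list, where it
    -- has no predecessor: `|I|` is at least `(n − e)/2 − (e + 2) − 1`.
    ; bigI = (lin (n ∷ e ∷ degree G v ∷ count (adj? G v) cs ∷ # outside? ∷ length I ∷ len C ∷ [])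
      (λ n e d c o i l → (n :≤ 2 :* d :+ e) ∷ (d :≤ c :+ o) ∷ (l :+ o :≤ n) ∷ (n :≤ l :+ (e :+ con 2)) ∷
        (c :≤ i :+ con 1) ∷ [] ⊢ n :≤ 2 :* i :+ (3 :* e :+ con 6)) 0 (1 ∷ 2 ∷ 2 ∷ 2 ∷ 2 ∷ [])
      (dense v ∷ split ∷ eq≤ partition ∷ le ∷ lenI ∷ [])) }
    where
    cs = Cycle.verts C
    I = preds (adj? G v) cs
    outside? = λ w → ¬? (w ∈? cs)
    split : degree G v ≤ count (adj? G v) cs + # outside?
    split = ≤-trans (#-∪≤ (adj? G v) (λ w → adj? G v w ×-dec (w ∈? cs)) outside?
        (λ {w} vw → case w ∈? cs of λ { (yes w∈) → inj₁ (vw , w∈) ; (no w∉) → inj₂ w∉ }))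
                    (+-monoˡ-≤ (# outside?) (≤-trans (#≤count (λ w → adj? G v w ×-dec (w ∈? cs)) proj₂)
                        (count-mono _ (adj? G v) cs (λ _ → proj₁))))
    partition : len C + # outside? ≡ n
    partition = trans (cong (_+ # outside?) (sym (#∈ (Cycle.unique C)))) (#-∁ (_∈? cs))
    lenI : count (adj? G v) cs ≤ length I + 1
    lenI with cs
    ... | [] = z≤n
    ... | x ∷ xs = ≤-trans (≤-reflexive (count-++ (adj? G v) [ x ] xs))
        (≤-trans (+-monoˡ-≤ (count (adj? G v) xs) (length-filter (adj? G v) [ x ]))
                     (≤-reflexive (trans (+-comm 1 _) (cong (_+ 1) (sym (preds-length (adj? G v) x xs))))))

  hamiltonian-or-extremal : (Σ (Cycle G) λ C → n ≤ len C) ⊎ Independent G (3 * e + 6) ⊎ Split G (e + 2)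
  hamiltonian-or-extremal with explore n (record { path = stop {x = fromℕ< e<n} ; unique = [] ∷ [] }) (m≤m+n n 1)
  ... | inj₂ split = inj₂ (inj₂ split)
  ... | inj₁ (C , le) with grow n C (m≤m+n n (len C)) le
  ...   | inj₁ ham = inj₁ ham
  ...   | inj₂ indep = inj₂ (inj₁ indep)

-- Switching

-- Rotation inside a dense difunctional relation K: as long as all non-K links are edges of G, the
-- missing K-links can be exchanged for edges of G one at a time without creating new non-K links.
module Switch {n : ℕ} (G : Graph n) {K : Fin n → Fin n → Set} (K? : ∀ u v → Dec (K u v))
  (K-sym : ∀ {u v} → K u v → K v u) (K-difunctional : ∀ {a b c d} → K a b → K c b → K c d → K a d)
  (β c : ℕ) (K-dense : ∀ {u v} → K u v → β + (2 * c + 2) ≤ # (K? u))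
  (K-missing : ∀ u → # (λ w → K? u w ×-dec ¬? (adj? G u w)) ≤ c) where

  Q : Fin n → Fin n → Set
  Q u v = K u v ⊎ Adj G u v

  Q-sym : ∀ {u v} → Q u v → Q v u
  Q-sym (inj₁ k) = inj₁ (K-sym k)
  Q-sym (inj₂ r) = inj₂ (adj-sym G r)

  NonK NonAdj : Fin n × Fin n → Set
  NonK (u , v)   = ¬ K u v
  NonAdj (u , v) = ¬ Adj G u v

  nonK? : Decidable NonK
  nonK? (u , v) = ¬? (K? u v)

  nonAdj? : Decidable NonAdj
  nonAdj? (u , v) = ¬? (adj? G u v)

  missed? : ∀ u w → Dec (K u w × ¬ Adj G u w)
  missed? u w = K? u w ×-dec ¬? (adj? G u w)

  -- On a path from `u` to `v`, the link `(x , y)` and the closing link give way to the edges `v x`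
  -- and `u y`, which yields the cycle `u … x v … y`. The conditions on `K` ensure that neither new
  -- link lies outside `K`.
  Switchable : Fin n → Fin n → Fin n × Fin n → Set
  Switchable u v (x , y) = K x y × K u y × Adj G u y × Adj G v x

  -- Each `K`-neighbour `y` of `u` is charged to the reason why the link `(x , y)` into it fails:
  -- the link is not in `K`, or `u` misses `y`, or `v` misses `x`. In the last case difunctionality
  -- gives `K v x`, so that `missed? v` counts it.
  unswitchable-count : ∀ {u v} → K u v → ∀ x xs → (∀ {l} → l ∈ links (x ∷ xs) → ¬ Switchable u v l) →
    count (K? u) xs ≤ count nonK? (links (x ∷ xs)) + (count (missed? u) xs + count (missed? v) (x ∷ xs))
  unswitchable-count uv x [] h = z≤n
  unswitchable-count {u} {v} uv x (y ∷ xs) h = lin (count (K? u) (y ∷ xs) ∷ count (K? u) [ y ] ∷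
      count (K? u) xs ∷ count nonK? (links (x ∷ y ∷ xs)) ∷ count nonK? [ (x , y) ] ∷
      count nonK? (links (y ∷ xs)) ∷ count (missed? u) (y ∷ xs) ∷ count (missed? u) [ y ] ∷
      count (missed? u) xs ∷ count (missed? v) (x ∷ y ∷ xs) ∷ count (missed? v) [ x ] ∷
      count (missed? v) (y ∷ xs) ∷ [])
    (λ a a1 a2 b b1 b2 c c1 c2 d d1 d2 → (a :≤ a1 :+ a2) ∷ (b1 :+ b2 :≤ b) ∷ (c1 :+ c2 :≤ c) ∷
      (d1 :+ d2 :≤ d) ∷ (a2 :≤ b2 :+ (c2 :+ d2)) ∷ (a1 :≤ b1 :+ (c1 :+ d1)) ∷ [] ⊢ a :≤ b :+ (c :+ d)) 0
          (1 ∷ 1 ∷ 1 ∷ 1 ∷ 1 ∷ 1 ∷ [])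
    (eq≤ (count-++ (K? u) [ y ] xs) ∷ eq≥ (count-++ nonK? [ (x , y) ] (links (y ∷ xs))) ∷
      eq≥ (count-++ (missed? u) [ y ] xs) ∷ eq≥ (count-++ (missed? v) [ x ] (y ∷ xs)) ∷
      unswitchable-count uv y xs (λ l∈ → h (there l∈)) ∷ head ∷ [])
    where
    head : count (K? u) [ y ] ≤ count nonK? [ (x , y) ] + (count (missed? u) [ y ] + count (missed? v) [ x ])
    head with K? u y | K? x y | adj? G u y | K? v x | adj? G v x
    ... | no _   | _      | _      | _      | _      = z≤n
    ... | yes uy | no _   | _      | _      | _      = s≤s z≤n
    ... | yes uy | yes xy | no _   | _      | _      = s≤s z≤n
    ... | yes uy | yes xy | yes _  | yes vx | no _   = s≤s z≤n
    ... | yes uy | yes xy | yes ay | no ¬vx | _      = contradiction (K-sym (K-difunctional xy uy uv)) ¬vx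
    ... | yes uy | yes xy | yes ay | yes vx | yes ax = contradiction (xy , uy , ay , ax) (h (here refl))

  switch-link : ∀ {u v xs} → Path Q u v xs → K u v → xs ↭ allFin n → count nonK? (links xs) ≤ β →
                ∃₂ λ x y → (x , y) ∈ links xs × Switchable u v (x , y)
  switch-link {u} {v} {xs} p uv ham few with any? (λ x → any? λ y →
      DecPair._∈?_ (x , y) (links xs) ×-dec K? x y ×-dec K? u y ×-dec adj? G u y ×-dec adj? G v x)
  ... | yes found = found
  ... | no none with path-src p
  -- Of the spare 2 in `K-dense`, one pays for the head `u`, into which no link leads, and one makes
  -- the inequality strict.
  ... | zs , refl = (1≰0 (lin (β ∷ c ∷ # (K? u) ∷ count (K? u) (u ∷ zs) ∷ count (K? u) [ u ] ∷ count (K? u) zs ∷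
      count nonK? (links (u ∷ zs)) ∷ count (missed? u) zs ∷ count (missed? v) (u ∷ zs) ∷ # (missed? u) ∷
      # (missed? v) ∷ [])
    (λ β c k k0 k1 k2 b c1 c2 m1 m2 → (β :+ (2 :* c :+ con 2) :≤ k) ∷ (k :≤ k0) ∷ (k0 :≤ k1 :+ k2) ∷
      (k1 :≤ con 1) ∷ (k2 :≤ b :+ (c1 :+ c2)) ∷ (b :≤ β) ∷ (c1 :≤ m1) ∷ (c2 :≤ m2) ∷ (m1 :≤ c) ∷
      (m2 :≤ c) ∷ [] ⊢ con 1 :≤ con 0) 0 (1 ∷ 1 ∷ 1 ∷ 1 ∷ 1 ∷ 1 ∷ 1 ∷ 1 ∷ 1 ∷ 1 ∷ [])
    (K-dense uv ∷ eq≥ (count-↭ (K? u) ham) ∷ eq≤ (count-++ (K? u) [ u ] zs) ∷ length-filter (K? u) [ u ] ∷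
      unswitchable-count uv u zs (λ l∈ sw → none (_ , _ , l∈ , sw)) ∷ few ∷
      count≤# (missed? u) (AllPairs.tail un) ∷ count≤# (missed? v) un ∷ K-missing u ∷ K-missing v ∷ [])))
    where
    un : Unique (u ∷ zs)
    un = unique-↭ (↭-sym ham) (Uniqueₚ.allFin⁺ n)

  -- `φ` bounds the links on the path that are not edges, the closing link apart. A switch closes
  -- the path by genuine edges; if a false link `(a , b)` remains, the cycle is turned so that
  -- `(a , b)` becomes the closing link. The number of false links on the path drops, and that of
  -- links outside `K` does not grow.
  switch : ∀ φ {u v xs} → Path Q u v xs → K u v → xs ↭ allFin n → count nonK? (links xs) ≤ β →
      count nonAdj? (links xs) ≤ φ →
           Σ (Cycle G) λ C → n ≤ len C
  switch φ {u} {v} p uv ham few fakes with switch-link p uv ham few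
  ... | x , y , l∈ , xy , uy′ , uy , vx with links-split _ l∈
  ... | ys , zs , refl with path-cut ys p
  ... | p₁ , _ , p₂ with path-reverse Q-sym p₂
  ... | r with any? (λ a → any? λ b → DecPair._∈?_ (a , b) (links ((ys ++ [ x ]) ++ reverse (y ∷ zs))) ×-dec ¬?
      (adj? G a b))
  ... | no real = record
      { path = path-map (λ {a} {b} ab∈ _ → case adj? G a b of
          λ { (yes ab) → ab ; (no ¬ab) → contradiction (a , b , ab∈ , ¬ab) real }) joined
      ; close = adj-sym G uy
      ; unique = unique-↭ (↭-sym perm) (Uniqueₚ.allFin⁺ n) } , eq≥ (trans (↭-length perm) (length-allFin n))
    where
    joined = path-++ p₁ (inj₂ (adj-sym G vx)) r
    perm = ↭-trans (↭-++⁺ˡ (ys ++ [ x ]) (↭-reverse (y ∷ zs)))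
        (↭-trans (↭-reflexive (++-assoc ys [ x ] (y ∷ zs))) ham)
  ... | yes (a , b , ab∈ , ¬ab) with links-split _ ab∈
  ... | qs , ws , eq with path-cut qs (subst (Path Q u y) eq (path-++ p₁ (inj₂ (adj-sym G vx)) r))
  ... | q₁ , ab , q₂ = next φ fakes
    where
    front = ys ++ [ x ]
    back = y ∷ zs
    old = ys ++ x ∷ y ∷ zs
    new = front ++ reverse back
    turned = (b ∷ ws) ++ (qs ++ [ a ])
    Kba : K b a
    Kba = [ K-sym , (λ r → contradiction r ¬ab) ]′ ab
    perm : turned ↭ allFin n
    perm = ↭-trans (++-comm (b ∷ ws) (qs ++ [ a ])) (↭-trans
        (↭-reflexive (trans (++-assoc qs [ a ] (b ∷ ws)) (sym eq)))
             (↭-trans (↭-++⁺ˡ front (↭-reverse back)) (↭-trans (↭-reflexive (++-assoc ys [ x ] back)) ham)))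
    turnedPath : Path Q b a turned
    turnedPath = path-++ q₂ (inj₂ (adj-sym G uy)) q₁
    module Count {P : Fin n × Fin n → Set} (P? : Decidable P) (P-sym : ∀ {x y} → P (x , y) → P (y , x)) where
      N : List (Fin n) → ℕ
      N xs = count P? (links xs)
      bound : ¬ P (x , v) → ¬ P (y , u) → N turned + count P? [ (a , b) ] ≤ N old
      bound ¬xv ¬yu = lin (N turned ∷ count P? [ (a , b) ] ∷ N old ∷ N front ∷ N back ∷ N (reverse back) ∷
          N new ∷ count P? [ (x , y) ] ∷ count P? [ (x , v) ] ∷ count P? [ (y , u) ] ∷ N (qs ++ [ a ]) ∷
          N (b ∷ ws) ∷ [])
        (λ t ab o f k k′ w e1 e2 e3 g h → (f :+ (e1 :+ k) :≤ o) ∷ (w :≤ f :+ (e2 :+ k′)) ∷ (k′ :≤ k) ∷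
          (e2 :≤ con 0) ∷ (e3 :≤ con 0) ∷ (t :≤ h :+ (e3 :+ g)) ∷ (g :+ (ab :+ h) :≤ w) ∷ [] ⊢ t :+ ab :≤ o) 0
              (1 ∷ 1 ∷ 1 ∷ 1 ∷ 1 ∷ 1 ∷ 1 ∷ [])
        (eq≥ (count-links-++ P? ys zs) ∷ eq≤ (count-links-join P? p₁ r) ∷
          eq≤ (count-links-reverse P? P-sym back) ∷
          eq≤ (count-none P? [ (x , v) ] (λ { (here refl) → ¬xv })) ∷
          eq≤ (count-none P? [ (y , u) ] (λ { (here refl) → ¬yu })) ∷ eq≤ (count-links-join P? q₂ q₁) ∷
          eq≥ (trans (cong N eq) (count-links-++ P? qs ws)) ∷ [])
    few′ : count nonK? (links turned) ≤ β
    few′ = ≤-trans (≤-trans (m≤m+n _ _) (Count.bound nonK? (λ ¬k k → ¬k (K-sym k))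
             (λ ¬xv → ¬xv (K-difunctional xy uy′ uv)) (λ ¬yu → ¬yu (K-sym uy′)))) few
    next : ∀ φ → count nonAdj? (links old) ≤ φ → Σ (Cycle G) λ C → n ≤ len C
    next φ fakes with Count.bound nonAdj? (λ ¬r r → ¬r (adj-sym G r)) (λ ¬xv → ¬xv (adj-sym G vx))
        (λ ¬yu → ¬yu (adj-sym G uy))
                    | count-yes nonAdj? {xs = []} ¬ab
    next zero fakes | bd | one = (1≰0 (lin (count nonAdj? (links turned) ∷ count nonAdj? [ (a , b) ] ∷
        count nonAdj? (links old) ∷ [])
      (λ t c o → (t :+ c :≤ o) ∷ (con 1 :≤ c) ∷ (o :≤ con 0) ∷ [] ⊢ con 1 :≤ con 0) 0 (1 ∷ 1 ∷ 1 ∷ [])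
      (bd ∷ eq≥ one ∷ fakes ∷ [])))
    next (suc φ) fakes | bd | one = switch φ turnedPath Kba perm few′ (lin (φ ∷
        count nonAdj? (links turned) ∷ count nonAdj? [ (a , b) ] ∷ count nonAdj? (links old) ∷ [])
      (λ φ t c o → (t :+ c :≤ o) ∷ (con 1 :≤ c) ∷ (o :≤ con 1 :+ φ) ∷ [] ⊢ t :≤ φ) 0 (1 ∷ 1 ∷ 1 ∷ [])
      (bd ∷ eq≥ one ∷ fakes ∷ []))

-- Cyclic orders with prescribed pieces

links-length : ∀ {A : Set} (xs : List A) → length (links xs) ≤ length xs
links-length [] = z≤n
links-length (x ∷ []) = z≤n
links-length (x ∷ y ∷ xs) = s≤s (links-length (y ∷ xs))

count-all : ∀ {A : Set} {P : A → Set} (P? : Decidable P) {xs} → All P xs → count P? xs ≡ length xs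
count-all P? [] = refl
count-all P? (p ∷ ps) = trans (count-yes P? p) (cong suc (count-all P? ps))

-- A partial 2-colouring of the vertices, colour c being linked by K to colour f c: f is the identity
-- for two cliques and negation in the bipartite case.
module Strands {n : ℕ} (G : Graph n) (Typ : Bool → Fin n → Set) (typ? : ∀ c v → Dec (Typ c v))
  (typ-unique : ∀ {c d v} → Typ c v → Typ d v → c ≡ d) (f : Bool → Bool) (f-involutive : ∀ c → f (f c) ≡ c) where

  private
    V = Fin n

  K : V → V → Set
  K u v = Σ Bool λ c → Typ c u × Typ (f c) v

  K? : ∀ u v → Dec (K u v)
  K? u v = map′ [ (λ k → true , k) , (λ k → false , k) ]′ (λ { (true , k) → inj₁ k ; (false , k) → inj₂ k })
                ((typ? true u ×-dec typ? (f true) v) ⊎-dec (typ? false u ×-dec typ? (f false) v))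

  K-sym : ∀ {u v} → K u v → K v u
  K-sym (c , cu , fcv) = f c , fcv , subst (λ d → Typ d _) (sym (f-involutive c)) cu

  K-difunctional : ∀ {a b c d} → K a b → K c b → K c d → K a d
  K-difunctional (α , αa , fαb) (γ , γc , fγb) (γ′ , γ′c , fγ′d) = α , αa , subst (λ e → Typ e _) eq fγ′d
    where
    eq : f γ′ ≡ f α
    eq = trans (cong f (typ-unique γ′c γc)) (typ-unique fγb fαb)

  Q : V → V → Set
  Q u v = K u v ⊎ Adj G u v

  nonK? : Decidable (λ ((u , v) : V × V) → ¬ K u v)
  nonK? (u , v) = ¬? (K? u v)

  record Strand (c d : Bool) (b : ℕ) (xs : List V) : Set where
    constructor strand
    field
      {src dst} : V
      path : Path Q src dst xs
      cl   : Typ c src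
      cr   : Typ d dst
      few  : count nonK? (links xs) ≤ b

  join : ∀ {c d c′ d′ b b′ xs ys} → Strand c d b xs → f d ≡ c′ → Strand c′ d′ b′ ys →
      Strand c d′ (b + b′) (xs ++ ys)
  join {xs = xs} {ys} (strand p cl cr few) refl (strand p′ cl′ cr′ few′) = strand (path-++ p (inj₁ k) p′) cl cr′
    (≤-trans (≤-reflexive (count-links-join nonK? p p′))
        (+-mono-≤ few (≤-trans (+-monoˡ-≤ _ (≤-reflexive (count-none nonK? [ _ ] λ { (here refl) ¬k → ¬k k })))
        few′)))
    where k = _ , cr , cl′

  single : ∀ {c v} → Typ c v → Strand c c 0 [ v ]
  single cv = strand stop cv cv z≤n

  data Strands (c : Bool) : ℕ → List (List V) → Set where
    []  : Strands c 0 []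
    _∷_ : ∀ {b b′ xs xss} → Strand c c b xs → Strands c b′ xss → Strands c (b + b′) (xs ∷ xss)

  strands-++ : ∀ {c b b′ xss yss} → Strands c b xss → Strands c b′ yss → Strands c (b + b′) (xss ++ yss)
  strands-++ [] ts = ts
  strands-++ {b′ = b′} (_∷_ {b} {b″} s ss) ts rewrite +-assoc b b″ b′ = s ∷ strands-++ ss ts

  singles : ∀ {c vs} → All (Typ c) vs → Strands c 0 (map [_] vs)
  singles [] = []
  singles (cv ∷ cvs) = single cv ∷ singles cvs

  concat-singles : ∀ (vs : List V) → concat (map [_] vs) ≡ vs
  concat-singles [] = refl
  concat-singles (v ∷ vs) = cong (v ∷_) (concat-singles vs)

  chain : ∀ {c b xs xss} → f c ≡ c → Strands c b (xs ∷ xss) → Strand c c b (concat (xs ∷ xss))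
  chain {xs = xs} fc (_∷_ {b} s []) rewrite ++-identityʳ xs | +-identityʳ b = s
  chain fc (s ∷ ss@(_ ∷ _)) = join s fc (chain fc ss)

  -- Colours have to alternate around a bipartite cycle, hence the equal numbers of strands. The
  -- result starts in `c` and ends in `c′`, so it can be closed by a link of `K`.
  interleave : ∀ {c c′ b b′ xs xss ys yss} → f c ≡ c′ → f c′ ≡ c → Strands c b (xs ∷ xss) →
      Strands c′ b′ (ys ∷ yss) → length xss ≡ length yss →
               ∃ λ zs → Strand c c′ (b + b′) zs × zs ↭ concat (xs ∷ xss) ++ concat (ys ∷ yss)
  interleave {c} {c′} {xs = xs} {ys = ys} fc fc′ (_∷_ {b = b} s []) (_∷_ {b = b′} t []) eq =
    xs ++ ys , subst (λ b → Strand c c′ b (xs ++ ys)) (cong₂ _+_ (sym (+-identityʳ b)) (sym (+-identityʳ b′)))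
        (join s fc t) ,
    ↭-reflexive (cong₂ _++_ (sym (++-identityʳ xs)) (sym (++-identityʳ ys)))
  interleave {c} {c′} {xs = xs} {ys = ys} fc fc′ (_∷_ {b₁} {b₂} s ss@(_ ∷ _)) (_∷_ {b₃} {b₄} t ts@(_ ∷ _)) eq with
      interleave fc fc′ ss ts (cong pred eq)
  ... | zs , u , perm = (xs ++ ys) ++ zs , subst (λ b → Strand c c′ b ((xs ++ ys) ++ zs)) (swap₂ b₁ b₃ b₂ b₄)
      (join (join s fc t) fc′ u) , shuffle perm
    where
    swap₂ : ∀ a b c d → a + b + (c + d) ≡ a + c + (b + d)
    swap₂ = solve-∀
    shuffle : ∀ {zs us ws} → zs ↭ us ++ ws → (xs ++ ys) ++ zs ↭ (xs ++ us) ++ (ys ++ ws)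
    shuffle {zs} {us} {ws} perm = ↭-trans (↭-++⁺ˡ (xs ++ ys) perm)
      (↭-trans (↭-reflexive (++-assoc xs ys (us ++ ws)))
      (↭-trans (↭-++⁺ˡ xs (↭-trans (↭-reflexive (sym (++-assoc ys us ws)))
          (↭-trans (↭-++⁺ʳ ws (++-comm ys us)) (↭-reflexive (++-assoc us ys ws)))))
      (↭-reflexive (sym (++-assoc xs us (ys ++ ws))))))

  -- A piece that the cycle has to contain, an exceptional vertex or a special edge; `cl` and `cr`
  -- are the colours of the typical vertices between which it will be placed.
  record Task : Set where
    field
      {src dst} : V
      {core}    : List V
      path      : Path (Adj G) src dst core
      short     : length core ≤ 2
      cl cr     : Bool
  open Task

  roomy? : ∀ c x → Decidable (λ w → Typ c w × Adj G x w)
  roomy? c x w = typ? c w ×-dec adj? G x w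

  data Flank : List Task → List (List V) → Set where
    []    : Flank [] []
    flank : ∀ {t ts xss a b} → Typ (cl t) a → Adj G a (src t) → Typ (cr t) b → Adj G (dst t) b → Flank ts xss →
            Flank (t ∷ ts) ((a ∷ core t ++ [ b ]) ∷ xss)

  -- The 4 bounds the number of vertices, two in the core and two flanks, and thereby the number of
  -- links.
  flank-strand : ∀ {t a b} → Typ (cl t) a → Adj G a (src t) → Typ (cr t) b → Adj G (dst t) b →
      Strand (cl t) (cr t) 4 (a ∷ core t ++ [ b ])
  flank-strand {t} {a} {b} ca ax cb yb = strand (inj₂ ax ► path-++ (path-map (λ _ → inj₂) (path t)) (inj₂ yb) stop)
      ca cb
    (≤-trans (length-filter nonK? (links xs)) (≤-trans (links-length xs)
        (s≤s (≤-trans (≤-reflexive (length-++ (core t))) (+-monoˡ-≤ 1 (short t))))))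
    where xs = a ∷ core t ++ [ b ]

  flank-strands : ∀ {c ts xss} → All (λ t → cl t ≡ c × cr t ≡ c) ts → Flank ts xss → Strands c (length ts * 4) xss
  flank-strands [] [] = []
  flank-strands ((refl , eq) ∷ cs) (flank {t = t} ca ax cb yb fs) =
      subst (λ d → Strand _ d _ _) eq (flank-strand {t} ca ax cb yb) ∷ flank-strands cs fs

  flank-++⁻ : ∀ ts {us xss} → Flank (ts ++ us) xss → ∃₂ λ xss₁ xss₂ →
      xss ≡ xss₁ ++ xss₂ × Flank ts xss₁ × Flank us xss₂
  flank-++⁻ [] fs = [] , _ , refl , [] , fs
  flank-++⁻ (t ∷ ts) (flank ca ax cb yb fs) with flank-++⁻ ts fs
  ... | xss₁ , xss₂ , refl , fs₁ , fs₂ = _ , xss₂ , refl , flank ca ax cb yb fs₁ , fs₂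

  flank-length : ∀ {ts xss} → Flank ts xss → length xss ≡ length ts
  flank-length [] = refl
  flank-length (flank _ _ _ _ fs) = cong suc (flank-length fs)

  cores : List Task → List V
  cores = concatMap core

  record Flanked (ts : List Task) (avoid : List V) : Set where
    field
      {segments} : List (List V)
      {chosen}   : List V
      flanks     : Flank ts segments
      shape      : concat segments ↭ cores ts ++ chosen
      unique     : Unique chosen
      avoids     : ∀ {v} → v ∈ chosen → v ∉ avoid
      lengthC    : length chosen ≡ length ts * 2

  -- Greedy choice: each task adds its two private flanks to `avoid`, so a candidate is left as long
  -- as every roomy set exceeds `|avoid| + 2 |ts|`.
  attach : ∀ D ts avoid → All (λ t → D < # (roomy? (cl t) (src t)) × D < # (roomy? (cr t) (dst t))) ts →
           length avoid + length ts * 2 ≤ D → Flanked ts avoid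
  attach D [] avoid [] le = record { flanks = [] ; shape = refl ; unique = [] ; avoids = λ () ; lengthC = refl }
  attach D (t ∷ ts) avoid ((Da , Db) ∷ room) le with fresh (roomy? (cl t) (src t)) avoid
      (≤-<-trans (≤-trans (m≤m+n _ _) le) Da)
  ... | a , (ca , xa) , a∉ with fresh (roomy? (cr t) (dst t)) (a ∷ avoid)
      (≤-<-trans (≤-trans (≤-trans (≤-reflexive (+-comm 1 (length avoid))) (+-monoʳ-≤ (length avoid) (s≤s z≤n))) le)
      Db)
  ... | b , (cb , yb) , b∉ with attach D ts (b ∷ a ∷ avoid) room
      (≤-trans (≤-reflexive (assoc₂ (length avoid) (length ts * 2))) le)
    where
    assoc₂ : ∀ x y → 2 + x + y ≡ x + (2 + y)
    assoc₂ = solve-∀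
  ... | rest = record
    { flanks  = flank {t = t} ca (adj-sym G xa) cb yb (Flanked.flanks rest)
    ; shape   = shuffle (core t) (Flanked.shape rest)
    ; unique  = unique-∷ (λ { (here refl) → b∉ (here refl) ; (there a∈) →
        Flanked.avoids rest a∈ (there (here refl)) })
                 (unique-∷ (λ b∈ → Flanked.avoids rest b∈ (here refl)) (Flanked.unique rest))
    ; avoids  = λ { (here refl) → a∉ ; (there (here refl)) b∈ → b∉ (there b∈) ; (there (there v∈)) v∈′ →
        Flanked.avoids rest v∈ (there (there v∈′)) }
    ; lengthC = cong (2 +_) (Flanked.lengthC rest)
    }
    where
    shuffle : ∀ cs {zs us ws} → zs ↭ us ++ ws → (a ∷ cs ++ [ b ]) ++ zs ↭ (cs ++ us) ++ a ∷ b ∷ ws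
    shuffle cs {zs} {us} {ws} p = ↭-trans (↭-++⁺ˡ (a ∷ cs ++ [ b ]) p)
      (↭-trans (prep a (↭-trans (↭-reflexive (++-assoc cs [ b ] (us ++ ws)))
          (↭-trans (↭-++⁺ˡ cs (↭-sym (shift b us ws))) (↭-reflexive (sym (++-assoc cs us (b ∷ ws)))))))
               (↭-sym (shift a (cs ++ us) (b ∷ ws))))

  module Leftovers (ts : List Task) {avoid : List V} (F : Flanked ts avoid)
      (cores⊆avoid : ∀ {v} → v ∈ cores ts → v ∈ avoid)
    (cores-unique : Unique (cores ts)) (covered : ∀ v → v ∈ cores ts ⊎ Σ Bool λ c → Typ c v) where
    open Flanked F

    used : List V
    used = concat segments

    used-unique : Unique used
    used-unique = unique-↭ (↭-sym shape) (unique-++ cores-unique unique λ v∈ v∈′ → avoids v∈′ (cores⊆avoid v∈))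

    leftover? : ∀ c → Decidable (λ v → Typ c v × v ∉ used)
    leftover? c v = typ? c v ×-dec ¬? (v ∈? used)

    leftover : Bool → List V
    leftover c = filter (leftover? c) (allFin n)

    leftover-typ : ∀ c → All (Typ c) (leftover c)
    leftover-typ c = All.tabulate λ v∈ → proj₁ (proj₂ (∈-filter⁻ (leftover? c) {xs = allFin n} v∈))

    leftover-∉ : ∀ c {v} → v ∈ leftover c → v ∉ used
    leftover-∉ c v∈ = proj₂ (proj₂ (∈-filter⁻ (leftover? c) {xs = allFin n} v∈))

    leftover-length : ∀ c → # (typ? c) ≤ length used + length (leftover c)
    leftover-length c = ≤-trans (#-∪≤ (typ? c) (_∈? used) (leftover? c) λ {v} cv →
        case v ∈? used of λ { (yes v∈) → inj₁ v∈ ; (no v∉) → inj₂ (cv , v∉) })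
      (+-monoˡ-≤ _ (≤-reflexive (#∈ used-unique)))

    spanning : used ++ leftover true ++ leftover false ↭ allFin n
    spanning = ham-↭ un (≤-trans (eq≥ (length-allFin n)) (unique-⊆-length (Uniqueₚ.allFin⁺ n) λ {v} _ → cover v))
      where
      un : Unique (used ++ leftover true ++ leftover false)
      un = unique-++ used-unique (unique-++ (Uniqueₚ.filter⁺ (leftover? true) (Uniqueₚ.allFin⁺ n))
          (Uniqueₚ.filter⁺ (leftover? false) (Uniqueₚ.allFin⁺ n))
             λ v∈ v∈′ → case typ-unique (All.lookup (leftover-typ true) v∈) (All.lookup (leftover-typ false) v∈′) of
                 λ ())
             λ v∈ v∈′ → [ (λ v∈″ → leftover-∉ true v∈″ v∈) , (λ v∈″ → leftover-∉ false v∈″ v∈) ]′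
                 (∈-++⁻ (leftover true) v∈′)
      cover : ∀ v → v ∈ used ++ leftover true ++ leftover false
      cover v with v ∈? used | covered v
      ... | yes v∈ | _ = ∈-++⁺ˡ v∈
      ... | no v∉ | inj₁ v∈ = contradiction (∈-resp-↭ (↭-sym shape) (∈-++⁺ˡ v∈)) v∉
      ... | no v∉ | inj₂ (true , cv) = ∈-++⁺ʳ used (∈-++⁺ˡ (∈-filter⁺ (leftover? true) (∈-allFin v) (cv , v∉)))
      ... | no v∉ | inj₂ (false , cv) = ∈-++⁺ʳ used (∈-++⁺ʳ (leftover true)
          (∈-filter⁺ (leftover? false) (∈-allFin v) (cv , v∉)))

    used-length : length used ≡ length (cores ts) + length ts * 2
    used-length = trans (↭-length shape) (trans (length-++ (cores ts)) (cong (length (cores ts) +_) lengthC))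

  -- A spanning strand with matching end colours is a cycle in `Q`; its links outside `K` are
  -- already edges, so switching applies with the bound `b` on them.
  close-up : ∀ {c d b xs} → Strand c d b xs → f d ≡ c → xs ↭ allFin n → ∀ m → (∀ c → b + (2 * m + 2) ≤ # (typ? c)) →
             (∀ c u → Typ c u → # (λ w → typ? (f c) w ×-dec ¬? (adj? G u w)) ≤ m) → Σ (Cycle G) λ C → n ≤ len C
  close-up {c} {d} {b} {xs} (strand p cl cr few) refl ham m dense missing =
    Switch.switch G K? K-sym K-difunctional b m K-dense K-missing (length (links xs)) p (K-sym (d , cr , cl)) ham
        few (length-filter _ (links xs))
    where
    K-dense : ∀ {u v} → K u v → b + (2 * m + 2) ≤ # (K? u)
    K-dense {u} (c , cu , _) = ≤-trans (dense (f c)) (#-mono (typ? (f c)) (K? u) λ cw → c , cu , cw)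
    K-missing : ∀ u → # (λ w → K? u w ×-dec ¬? (adj? G u w)) ≤ m
    K-missing u with typ? true u | typ? false u
    ... | yes tu | _ = ≤-trans (#-mono _ (λ w → typ? (f true) w ×-dec ¬? (adj? G u w)) λ ((c , cu , cw) , ¬r) →
        subst (λ c → Typ (f c) _) (typ-unique cu tu) cw , ¬r) (missing true u tu)
    ... | no _ | yes fu = ≤-trans (#-mono _ (λ w → typ? (f false) w ×-dec ¬? (adj? G u w)) λ ((c , cu , cw) , ¬r) →
        subst (λ c → Typ (f c) _) (typ-unique cu fu) cw , ¬r) (missing false u fu)
    ... | no ¬t | no ¬f = ≤-trans (≤-reflexive (count-none _ (allFin n)
        λ { _ ((true , cu , _) , _) → ¬t cu ; _ ((false , cu , _) , _) → ¬f cu })) z≤n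

-- Packings of Hamiltonian cycles

lookup-injective : ∀ {A : Set} {xs : List A} → Unique xs → ∀ i j → lookup xs i ≡ lookup xs j → i ≡ j
lookup-injective (x∉ ∷ u) zero zero eq = refl
lookup-injective {xs = x ∷ xs} (x∉ ∷ u) zero (suc j) eq = contradiction eq (All.lookup x∉ (∈-lookup j))
lookup-injective {xs = x ∷ xs} (x∉ ∷ u) (suc i) zero eq = contradiction (sym eq) (All.lookup x∉ (∈-lookup i))
lookup-injective (x∉ ∷ u) (suc i) (suc j) eq = cong suc (lookup-injective u i j eq)

module _ {A : Set} {R : A → A → Set} where

  path-lookup : ∀ {u v xs} → Path R u v xs → ∀ i j → suc (toℕ i) ≡ toℕ j → R (lookup xs i) (lookup xs j)
  path-lookup stop zero zero ()
  path-lookup (r ► stop) zero (suc zero) eq = r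
  path-lookup (r ► (_ ► p)) zero (suc zero) eq = r
  path-lookup (r ► (_ ► p)) zero (suc (suc j)) ()
  path-lookup (r ► p) (suc i) (suc j) eq = path-lookup p i j (cong pred eq)

  path-first : ∀ {u v xs} → Path R u v xs → ∀ i → toℕ i ≡ 0 → lookup xs i ≡ u
  path-first stop zero eq = refl
  path-first (r ► p) zero eq = refl

  path-last : ∀ {u v xs} → Path R u v xs → ∀ i → suc (toℕ i) ≡ length xs → lookup xs i ≡ v
  path-last stop zero eq = refl
  path-last (r ► stop) zero ()
  path-last (r ► (_ ► _)) zero ()
  path-last (r ► p) (suc i) eq = path-last p i (cong pred eq)

module _ {n : ℕ} {G : Graph n} where

  toHamCycle : 3 ≤ n → (C : Cycle G) → n ≤ len C → HamCycle G
  toHamCycle 3≤n record { verts = xs ; path = p ; close = c ; unique = un } le = record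
    { three≤n = 3≤n
    ; σ       = λ i → lookup xs (cast n≡ i)
    ; σ-inj   = λ {i} {j} eq → toℕ-injective (trans (sym (toℕ-cast n≡ i))
        (trans (cong toℕ (lookup-injective un _ _ eq)) (toℕ-cast n≡ j)))
    ; σ-adj   = λ { i j (inj₁ eq) → path-lookup p _ _
        (trans (cong suc (toℕ-cast n≡ i)) (trans eq (sym (toℕ-cast n≡ j))))
                  ; i j (inj₂ (end , start)) → subst₂ (Adj G)
                      (sym (path-last p _ (trans (cong suc (toℕ-cast n≡ i)) (trans end n≡))))
                      (sym (path-first p _ (trans (toℕ-cast n≡ j) start))) c }
    }
    where
    n≡ : n ≡ length xs
    n≡ = ≤-antisym le (unique-length≤n un)

consec? : ∀ {n} (i j : Fin n) → Dec (Consec i j)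
consec? {n} i j = (suc (toℕ i) ≟ toℕ j) ⊎-dec ((suc (toℕ i) ≟ n) ×-dec (toℕ j ≟ 0))

consec-functional : ∀ {n} {i j j′ : Fin n} → Consec i j → Consec i j′ → j ≡ j′
consec-functional (inj₁ e) (inj₁ e′) = toℕ-injective (trans (sym e) e′)
consec-functional {j = j} (inj₁ e) (inj₂ (e′ , _)) = contradiction (trans (sym e) e′) (<⇒≢ (toℕ<n j))
consec-functional {j′ = j′} (inj₂ (e , _)) (inj₁ e′) = contradiction (trans (sym e′) e) (<⇒≢ (toℕ<n j′))
consec-functional (inj₂ (_ , e)) (inj₂ (_ , e′)) = toℕ-injective (trans e (sym e′))

consec-injective : ∀ {n} {i i′ j : Fin n} → Consec i j → Consec i′ j → i ≡ i′
consec-injective (inj₁ e) (inj₁ e′) = toℕ-injective (cong pred (trans e (sym e′)))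
consec-injective (inj₁ e) (inj₂ (_ , e′)) = case trans e e′ of λ ()
consec-injective (inj₂ (_ , e)) (inj₁ e′) = case trans e′ e of λ ()
consec-injective (inj₂ (e , _)) (inj₂ (e′ , _)) = toℕ-injective (cong pred (trans e (sym e′)))

#≤1 : ∀ {n} {P : Fin n → Set} (P? : Decidable P) → (∀ {x y} → P x → P y → x ≡ y) → # P? ≤ 1
#≤1 {n} P? h with any? P?
... | yes (x , px) = #≤length P? [ x ] λ py → here (h py px)
... | no none = ≤-trans (≤-reflexive (count-none P? (allFin n) λ {x} _ px → none (x , px))) z≤n

module _ {n : ℕ} {G : Graph n} where

  hamEdge? : (H : HamCycle G) → ∀ u v → Dec (HamEdge H u v)
  hamEdge? H u v = any? λ i → any? λ j → consec? i j ×-dec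
    (((σ H i ≟ᶠ u) ×-dec (σ H j ≟ᶠ v)) ⊎-dec ((σ H i ≟ᶠ v) ×-dec (σ H j ≟ᶠ u)))

  hamEdge-sym : (H : HamCycle G) → ∀ {u v} → HamEdge H u v → HamEdge H v u
  hamEdge-sym H (i , j , ij , inj₁ e) = i , j , ij , inj₂ e
  hamEdge-sym H (i , j , ij , inj₂ e) = i , j , ij , inj₁ e

  hamEdge-adj : (H : HamCycle G) → ∀ {u v} → HamEdge H u v → Adj G u v
  hamEdge-adj H (i , j , ij , inj₁ (refl , refl)) = σ-adj H i j ij
  hamEdge-adj H (i , j , ij , inj₂ (refl , refl)) = adj-sym G (σ-adj H i j ij)

  hamEdge-degree : (H : HamCycle G) → ∀ u → # (hamEdge? H u) ≤ 2
  hamEdge-degree H u = ≤-trans (#-∪≤ (hamEdge? H u) next? prev?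
      λ { (i , j , ij , inj₁ e) → inj₁ (i , j , ij , e) ; (i , j , ij , inj₂ e) → inj₂ (i , j , ij , e) })
    (+-mono-≤ (#≤1 next? next-unique) (#≤1 prev? prev-unique))
    where
    Next Prev : Fin n → Set
    Next v = ∃ λ i → ∃ λ j → Consec i j × (σ H i ≡ u × σ H j ≡ v)
    Prev v = ∃ λ i → ∃ λ j → Consec i j × (σ H i ≡ v × σ H j ≡ u)
    next? : Decidable Next
    next? v = any? λ i → any? λ j → consec? i j ×-dec ((σ H i ≟ᶠ u) ×-dec (σ H j ≟ᶠ v))
    prev? : Decidable Prev
    prev? v = any? λ i → any? λ j → consec? i j ×-dec ((σ H i ≟ᶠ v) ×-dec (σ H j ≟ᶠ u))
    next-unique : ∀ {x y} → Next x → Next y → x ≡ y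
    next-unique (i , j , ij , iu , jx) (i′ , j′ , ij′ , iu′ , jy) with σ-inj H (trans iu (sym iu′))
    ... | refl = trans (sym jx) (trans (cong (σ H) (consec-functional ij ij′)) jy)
    prev-unique : ∀ {x y} → Prev x → Prev y → x ≡ y
    prev-unique (i , j , ij , ix , ju) (i′ , j′ , ij′ , iy , ju′) with σ-inj H (trans ju (sym ju′))
    ... | refl = trans (sym ix) (trans (cong (σ H) (consec-injective ij ij′)) iy)

  Used : ∀ {i} → (Fin i → HamCycle G) → Fin n → Fin n → Set
  Used H u v = ∃ λ a → HamEdge (H a) u v

  used? : ∀ {i} (H : Fin i → HamCycle G) u v → Dec (Used H u v)
  used? H u v = any? λ a → hamEdge? (H a) u v

  used-degree : ∀ {i} (H : Fin i → HamCycle G) u → # (used? H u) ≤ i * 2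
  used-degree {zero} H u = ≤-reflexive (count-none (used? H u) (allFin n) λ { _ (() , _) })
  used-degree {suc i} H u = ≤-trans (#-∪≤ (used? H u) (hamEdge? (H zero) u) (used? (H ∘ suc) u)
      λ { (zero , h) → inj₁ h ; (suc a , h) → inj₂ (a , h) })
    (+-mono-≤ (hamEdge-degree (H zero) u) (used-degree (H ∘ suc) u))

  used-degree≤ : ∀ {i ℓ s} → i ≤ ℓ → ℓ ≤ s → (H : Fin i → HamCycle G) → ∀ u → # (used? H u) ≤ 2 * s
  used-degree≤ {i} i≤ℓ ℓ≤s H u =
    ≤-trans (used-degree H u) (≤-trans (≤-reflexive (*-comm i 2)) (*-monoʳ-≤ 2 (≤-trans i≤ℓ ℓ≤s)))

module _ {n : ℕ} (G : Graph n) where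

  remaining : ∀ {i} → (Fin i → HamCycle G) → Graph n
  remaining H = record
    { Adj = RemoveCycles G H
    ; adj? = λ u v → adj? G u v ×-dec ¬? (used? H u v)
    ; sym = λ (r , unused) → adj-sym G r , λ (a , h) → unused (a , hamEdge-sym (H a) h)
    ; irrefl = λ (r , _) → adj-irrefl G r }

  remaining-degree : ∀ {i} (H : Fin i → HamCycle G) u → degree G u ≤ degree (remaining H) u + i * 2
  remaining-degree H u = ≤-trans (#-∪≤ (adj? G u) (adj? (remaining H) u) (used? H u) λ {v} r →
      case used? H u v of λ { (yes h) → inj₂ h ; (no ¬h) → inj₁ (r , ¬h) })
    (+-monoʳ-≤ _ (used-degree H u))

pairs : ∀ n → List (Fin n × Fin n)
pairs n = cartesianProduct (allFin n) (allFin n)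

module _ {n : ℕ} {G : Graph n} where

  widen : ∀ {G′ : Graph n} → (∀ {u v} → Adj G′ u v → Adj G u v) → HamCycle G′ → HamCycle G
  widen inc H = record { three≤n = three≤n H ; σ = σ H ; σ-inj = σ-inj H ; σ-adj = λ i j ij → inc (σ-adj H i j ij) }

  module _ {Sp : Fin n × Fin n → Set} (sp? : Decidable Sp) where

    -- Ordered pairs are counted: an edge counts once for the oriented property `Cross` and twice
    -- for the symmetric `Inner`. Hence the rations `2` and `2 * m`.
    usage : ∀ {i} → (Fin i → HamCycle G) → ℕ
    usage H = count (λ l → sp? l ×-dec used? H (proj₁ l) (proj₂ l)) (pairs n)

    record Packing (i μ : ℕ) : Set where
      field
        cycles   : Fin i → HamCycle G
        disjoint : EdgeDisjoint cycles
        sparing  : usage cycles ≤ i * μ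

    -- `X` allows a step to settle matters by other means instead of supplying a cycle. The greedy
    -- phase uses this to switch to an extremal case; the extremal cases take `⊥`.
    packing : ∀ {X : Set} i μ →
      (∀ j → j < i → (P : Packing j μ) → X ⊎ Σ (HamCycle (remaining G (Packing.cycles P))) λ C →
        count (λ l → sp? l ×-dec hamEdge? C (proj₁ l) (proj₂ l)) (pairs n) ≤ μ) → X ⊎ Packing i μ
    packing zero μ extend = inj₂ record { cycles = λ () ; disjoint = λ () ; sparing =
        ≤-reflexive (count-none _ (pairs n) λ { _ (_ , () , _) }) }
    packing (suc i) μ extend with packing i μ (λ j lt → extend j (m<n⇒m<1+n lt))
    ... | inj₁ x = inj₁ x
    ... | inj₂ P with extend i ≤-refl P
    ...   | inj₁ x = inj₁ x
    ...   | inj₂ (C , few) = inj₂ record { cycles = H′ ; disjoint = disj ; sparing = ≤-trans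
        (count-∪≤ _ (λ l → sp? l ×-dec hamEdge? C (proj₁ l) (proj₂ l))
            (λ l → sp? l ×-dec used? (Packing.cycles P) (proj₁ l) (proj₂ l)) (pairs n)
          λ { _ (s , zero , h) → inj₁ (s , h) ; _ (s , suc a , h) → inj₂ (s , a , h) })
        (+-mono-≤ few (Packing.sparing P)) }
      where
      H = Packing.cycles P
      C′ = widen proj₁ C
      H′ : Fin (suc i) → HamCycle G
      H′ zero = C′
      H′ (suc a) = H a
      disj : EdgeDisjoint H′
      disj zero zero ne u v h h′ = ne refl
      disj zero (suc b) ne u v h h′ = proj₂ (hamEdge-adj C h) (b , h′)
      disj (suc a) zero ne u v h h′ = proj₂ (hamEdge-adj C h′) (a , h)
      disj (suc a) (suc b) ne u v h h′ = Packing.disjoint P a b (ne ∘ cong suc) u v h h′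

-- Connectivity after deleting few vertices

∀-Subset : ∀ {n} {A : Set} {B : Subset.Subset n → Set} → (∀ S → A ⊎ B S) → A ⊎ (∀ S → B S)
∀-Subset {zero} f = [ inj₁ , (λ b → inj₂ λ { [] → b }) ]′ (f [])
∀-Subset {suc n} {B = B} f with ∀-Subset {B = λ S → B (false ∷ S)} (λ S → f (false ∷ S)) | ∀-Subset
    {B = λ S → B (true ∷ S)} (λ S → f (true ∷ S))
... | inj₁ a | _ = inj₁ a
... | inj₂ _ | inj₁ a = inj₁ a
... | inj₂ b₀ | inj₂ b₁ = inj₂ λ { (false ∷ S) → b₀ S ; (true ∷ S) → b₁ S }

elements : ∀ {n} → Subset.Subset n → List (Fin n)
elements [] = []
elements (false ∷ S) = map suc (elements S)
elements (true ∷ S) = zero ∷ map suc (elements S)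

elements-length : ∀ {n} (S : Subset.Subset n) → length (elements S) ≡ Subset.∣ S ∣
elements-length [] = refl
elements-length (false ∷ S) = trans (length-map suc (elements S)) (elements-length S)
elements-length (true ∷ S) = cong suc (trans (length-map suc (elements S)) (elements-length S))

∈-elements : ∀ {n} {S : Subset.Subset n} {v} → v Subset.∈ S → v ∈ elements S
∈-elements {S = true ∷ S} {zero} Vec.here = here refl
∈-elements {S = true ∷ S} {suc v} (Vec.there v∈) = there (∈-map⁺ suc (∈-elements v∈))
∈-elements {S = false ∷ S} {suc v} (Vec.there v∈) = ∈-map⁺ suc (∈-elements v∈)

_∈ˢ?_ : ∀ {n} (v : Fin n) (S : Subset.Subset n) → Dec (v Subset.∈ S)
_∈ˢ?_ = Subsetₚ._∈?_

#∈ˢ : ∀ {n} (S : Subset.Subset n) → # (_∈ˢ? S) ≤ Subset.∣ S ∣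
#∈ˢ S = ≤-trans (#≤length (_∈ˢ? S) (elements S) ∈-elements) (≤-reflexive (elements-length S))

-- Deleting fewer than `k` vertices leaves `u` and `v` at least `(n − e)/2 − k` neighbours each. If
-- the two remaining neighbourhoods meet or are joined by an edge, there is a walk of length 2 or 3;
-- otherwise they are a split.
connected-or-split : ∀ {n} (R : Graph n) e k → (∀ v → n ≤ 2 * degree R v + e) → k < n →
                     Split R (e + 2 * k) ⊎ KConnected k (Adj R)
connected-or-split {n} R e k dense k<n = [ inj₁ , (λ walks → inj₂ (k<n , λ S small u v → walks S u v small)) ]′
  (∀-Subset λ S → ∀-⊎ λ u → ∀-⊎ λ v → link S u v)
  where
  link : ∀ S u v → Split R (e + 2 * k) ⊎ (Subset.∣ S ∣ < k → u Subset.∉ S → v Subset.∉ S →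
      WalkAvoiding (Adj R) S u v)
  link S u v with Subset.∣ S ∣ <? k
  ... | no big = inj₂ λ small → contradiction small big
  ... | yes small with any? (λ x → adj? R u x ×-dec ¬? (x ∈ˢ? S) ×-dec adj? R x v)
  ...   | yes (x , ux , x∉ , xv) = inj₂ λ _ u∉ v∉ → step u∉ ux (step x∉ xv (here v∉))
  ...   | no no₂ with any? (λ x → any? λ y → adj? R u x ×-dec ¬? (x ∈ˢ? S) ×-dec adj? R x y ×-dec ¬? (y ∈ˢ? S) ×-dec
      adj? R y v)
  ...     | yes (x , y , ux , x∉ , xy , y∉ , yv) = inj₂ λ _ u∉ v∉ → step u∉ ux (step x∉ xy (step y∉ yv (here v∉)))
  ...     | no no₃ = inj₁ record
    { A = N u ; B = N v ; uniqueA = Uniqueₚ.filter⁺ _ (Uniqueₚ.allFin⁺ n) ; uniqueB =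
        Uniqueₚ.filter⁺ _ (Uniqueₚ.allFin⁺ n)
    ; disjoint = λ x∈ x∈′ → no₂ (_ , proj₁ (N⁻ x∈) , proj₂ (N⁻ x∈) , adj-sym R (proj₁ (N⁻ x∈′)))
    ; nonadj = λ x∈ y∈ xy → no₃ (_ , _ , proj₁ (N⁻ x∈) , proj₂ (N⁻ x∈) , xy , proj₂ (N⁻ y∈) , adj-sym R
        (proj₁ (N⁻ y∈)))
    ; bigA = big u ; bigB = big v }
    where
    near? : ∀ w → Decidable (λ x → Adj R w x × x Subset.∉ S)
    near? w x = adj? R w x ×-dec ¬? (x ∈ˢ? S)
    N : Fin n → List (Fin n)
    N w = filter (near? w) (allFin n)
    N⁻ : ∀ {w x} → x ∈ N w → Adj R w x × x Subset.∉ S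
    N⁻ {w} x∈ = proj₂ (∈-filter⁻ (near? w) {xs = allFin n} x∈)
    big : ∀ w → n ≤ 2 * length (N w) + (e + 2 * k)
    big w = lin (n ∷ e ∷ k ∷ degree R w ∷ length (N w) ∷ # (_∈ˢ? S) ∷ Subset.∣ S ∣ ∷ [])
      (λ n e k d l s c → (n :≤ 2 :* d :+ e) ∷ (d :≤ l :+ s) ∷ (s :≤ c) ∷ (con 1 :+ c :≤ k) ∷
        [] ⊢ n :≤ 2 :* l :+ (e :+ 2 :* k)) 0 (1 ∷ 2 ∷ 2 ∷ 2 ∷ [])
      (dense w ∷
        #-∪≤ (adj? R w) (near? w) (_∈ˢ? S) (λ {x} wx →
            case x ∈ˢ? S of λ { (yes x∈) → inj₂ x∈ ; (no x∉) → inj₁ (wx , x∉) }) ∷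
        #∈ˢ S ∷ small ∷ [])

-- Matchings

count-map : ∀ {A B : Set} {P : B → Set} (P? : Decidable P) (g : A → B) xs → count P? (map g xs) ≡ count (P? ∘ g) xs
count-map P? g [] = refl
count-map P? g (x ∷ xs) with P? (g x)
... | yes _ = cong suc (count-map P? g xs)
... | no _  = count-map P? g xs

module _ {n : ℕ} where

  private
    V = Fin n

  pairs-unique : Unique (pairs n)
  pairs-unique = Uniqueₚ.cartesianProduct⁺ (Uniqueₚ.allFin⁺ n) (Uniqueₚ.allFin⁺ n)

  ∈-pairs : ∀ (l : V × V) → l ∈ pairs n
  ∈-pairs (u , v) = ∈-cartesianProduct⁺ (∈-allFin u) (∈-allFin v)

  pairs-count≤length : {P : V × V → Set} (P? : Decidable P) (ls : List (V × V)) → (∀ {l} → P l → l ∈ ls) →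
      count P? (pairs n) ≤ length ls
  pairs-count≤length P? ls h = unique-⊆-length (Uniqueₚ.filter⁺ P? pairs-unique) λ l∈ →
      h (proj₂ (∈-filter⁻ P? {xs = pairs n} l∈))

  count-row : {R : V × V → Set} (R? : Decidable R) → ∀ u us →
              count R? (cartesianProduct (u ∷ us) (allFin n)) ≡ # (λ v → R? (u , v)) + count R?
                  (cartesianProduct us (allFin n))
  count-row R? u us = trans (count-++ R? (map (u ,_) (allFin n)) (cartesianProduct us (allFin n)))
    (cong (_+ _) (count-map R? (u ,_) (allFin n)))

  -- The factor `c` clears denominators: a row bound `d/2` is stated with `c = 2`.
  pairs-count≥ : {P : V → Set} {Q : V × V → Set} (P? : Decidable P) (Q? : Decidable Q) (c d : ℕ) →
                 (∀ u → P u → d ≤ c * # (λ v → Q? (u , v))) →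
                     # P? * d ≤ c * count (λ l → P? (proj₁ l) ×-dec Q? l) (pairs n)
  pairs-count≥ {P} P? Q? c d h = go (allFin n)
    where
    R? = λ l → P? (proj₁ l) ×-dec Q? l
    go : ∀ us → count P? us * d ≤ c * count R? (cartesianProduct us (allFin n))
    go [] = z≤n
    go (u ∷ us) = ≤-trans (step′ (P? u)) (eq≥ (trans (cong (c *_) row)
        (*-distribˡ-+ c (# (λ v → R? (u , v))) (count R? (cartesianProduct us (allFin n))))))
      where
      row = count-row R? u us
      step′ : Dec (P u) → count P? (u ∷ us) * d ≤ c * # (λ v → R? (u , v)) + c * count R?
          (cartesianProduct us (allFin n))
      step′ (no ¬p) rewrite count-no P? {xs = us} ¬p = ≤-trans (go us) (m≤n+m _ _)
      step′ (yes p) rewrite count-yes P? {xs = us} p =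
          +-mono-≤ (≤-trans (h u p) (*-monoʳ-≤ c (#-mono (λ v → Q? (u , v)) (λ v → R? (u , v)) λ q → p , q)))
          (go us)

  ends : List (V × V) → List V
  ends [] = []
  ends ((u , v) ∷ ls) = u ∷ v ∷ ends ls

  ends-length : ∀ ls → length (ends ls) ≡ length ls * 2
  ends-length [] = refl
  ends-length (l ∷ ls) = cong (2 +_) (ends-length ls)

  module _ {Q : V × V → Set} (Q? : Decidable Q) where

    record Matching (j : ℕ) : Set where
      field
        {edges} : List (V × V)
        valid   : All Q edges
        size≡   : length edges ≡ j
        unique  : Unique (ends edges)

    -- Greedy: the `2i` ends of `i` chosen edges touch at most `4Δi` valid pairs. Since the
    -- inequality is asked for every `i < j`, the case `j = 1` merely asks for one valid pair,
    -- however large `Δ` is.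
    matching : (∀ {u} → ¬ Q (u , u)) → ∀ Δ → (∀ u → # (λ v → Q? (u , v)) ≤ Δ) → (∀ v → # (λ u → Q? (u , v)) ≤ Δ) →
               ∀ j → (∀ i → i < j → i * (4 * Δ) < count Q? (pairs n)) → Matching j
    matching loopless Δ out in′ zero h = record { valid = [] ; size≡ = refl ; unique = [] }
    matching loopless Δ out in′ (suc j) h with matching loopless Δ out in′ j (λ i lt → h i (m<n⇒m<1+n lt))
    ... | record { edges = ms ; valid = valid ; size≡ = size≡ ; unique = unique } =
        extend (count>0⇒∃ free? (pairs n) pos)
      where
      Touches : List V → V × V → Set
      Touches us l = proj₁ l ∈ us ⊎ proj₂ l ∈ us
      touches? : ∀ us → Decidable (Touches us)
      touches? us l = (proj₁ l ∈? us) ⊎-dec (proj₂ l ∈? us)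
      touched? : ∀ us → Decidable (λ l → Q l × Touches us l)
      touched? us l = Q? l ×-dec touches? us l
      free? : Decidable (λ l → Q l × ¬ Touches (ends ms) l)
      free? l = Q? l ×-dec ¬? (touches? (ends ms) l)
      touching : ∀ us → count (touched? us) (pairs n) ≤ length us * (2 * Δ)
      touching [] = ≤-reflexive (count-none (touched? []) (pairs n) λ { _ (_ , inj₁ ()) ; _ (_ , inj₂ ()) })
      touching (x ∷ us) = ≤-trans (count-∪≤ (touched? (x ∷ us)) at? (touched? us) (pairs n)
            λ { _ (q , inj₁ (here eq)) → inj₁ (q , inj₁ eq) ; _ (q , inj₁ (there i)) → inj₂ (q , inj₁ i)
              ; _ (q , inj₂ (here eq)) → inj₁ (q , inj₂ eq) ; _ (q , inj₂ (there i)) → inj₂ (q , inj₂ i) })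
          (+-mono-≤ (≤-trans (pairs-count≤length at? star
              λ { (q , inj₁ refl) → ∈-++⁺ˡ (∈-map⁺ (x ,_) (∈-filter⁺ (λ v → Q? (x , v)) (∈-allFin _) q))
                                                            ; (q , inj₂ refl) → ∈-++⁺ʳ (map (x ,_) outs)
                                                                (∈-map⁺ (_, x) (∈-filter⁺ (λ u → Q? (u , x))
                                                                (∈-allFin _) q)) })
                             (≤-trans (≤-reflexive (trans (length-++ (map (x ,_) outs))
                                 (cong₂ _+_ (length-map (x ,_) outs) (length-map (_, x) ins))))
                                      (≤-trans (+-mono-≤ (out x) (in′ x))
                                          (≤-reflexive (cong (Δ +_) (sym (+-identityʳ Δ)))))))
                    (touching us))
        where
        at? = λ l → Q? l ×-dec ((proj₁ l ≟ᶠ x) ⊎-dec (proj₂ l ≟ᶠ x))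
        outs = filter (λ v → Q? (x , v)) (allFin n)
        ins = filter (λ u → Q? (u , x)) (allFin n)
        star = map (x ,_) outs ++ map (_, x) ins
      pos : 0 < count free? (pairs n)
      pos = lin (count (touched? (ends ms)) (pairs n) ∷ count free? (pairs n) ∷ count Q? (pairs n) ∷
          length (ends ms) * (2 * Δ) ∷ j * (4 * Δ) ∷ [])
        (λ t f q e r → (r :< q) ∷ (t :≤ e) ∷ (e :≤ r) ∷ (q :≤ t :+ f) ∷ [] ⊢ con 1 :≤ f) 0 (1 ∷ 1 ∷ 1 ∷ 1 ∷ [])
        (h j ≤-refl ∷ touching (ends ms) ∷
          eq≤ (trans (cong (_* (2 * Δ)) (trans (ends-length ms) (cong (_* 2) size≡))) (reassoc j Δ)) ∷
          count-∪≤ Q? (touched? (ends ms)) free? (pairs n)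
              (λ {l} _ q → case touches? (ends ms) l of λ { (yes t) → inj₁ (q , t) ; (no ¬t) → inj₂ (q , ¬t) }) ∷
          [])
        where
        reassoc : ∀ j Δ → j * 2 * (2 * Δ) ≡ j * (4 * Δ)
        reassoc = solve-∀
      extend : (∃ λ l → l ∈ pairs n × Q l × ¬ Touches (ends ms) l) → Matching (suc j)
      extend ((u , v) , _ , q , untouched) = record { edges = (u , v) ∷ ms ; valid = q ∷ valid ; size≡ =
          cong suc size≡
        ; unique = unique-∷ (λ { (here refl) → loopless q ; (there u∈) → untouched (inj₁ u∈) })
            (unique-∷ (untouched ∘ inj₂) unique) }

  pairs-count≤ : {P : V → Set} {Q : V × V → Set} (P? : Decidable P) (Q? : Decidable Q) (d : ℕ) →
                 (∀ u → P u → # (λ v → Q? (u , v)) ≤ d) → count (λ l → P? (proj₁ l) ×-dec Q? l) (pairs n) ≤ # P? * d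
  pairs-count≤ {P} P? Q? d h = go (allFin n)
    where
    R? = λ l → P? (proj₁ l) ×-dec Q? l
    go : ∀ us → count R? (cartesianProduct us (allFin n)) ≤ count P? us * d
    go [] = z≤n
    go (u ∷ us) = ≤-trans (≤-reflexive row) (step′ (P? u))
      where
      row = count-row R? u us
      step′ : Dec (P u) → # (λ v → R? (u , v)) + count R? (cartesianProduct us (allFin n)) ≤ count P? (u ∷ us) * d
      step′ (no ¬p) rewrite count-no P? {xs = us} ¬p | count-none (λ v → R? (u , v)) (allFin n) (λ _ (p , _) → ¬p p)
          = go us
      step′ (yes p) rewrite count-yes P? {xs = us} p =
          +-mono-≤ (≤-trans (#-mono (λ v → R? (u , v)) (λ v → Q? (u , v)) proj₂) (h u p)) (go us)

  pairs-swap : {P Q : V × V → Set} (P? : Decidable P) (Q? : Decidable Q) → (∀ {u v} → P (u , v) → Q (v , u)) →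
      count P? (pairs n) ≤ count Q? (pairs n)
  pairs-swap P? Q? h = ≤-trans (pairs-count≤length P? (map (λ (u , v) → v , u) (filter Q? (pairs n))) λ {l} p →
      ∈-map⁺ _ (∈-filter⁺ Q? (∈-pairs _) (h p)))
    (≤-reflexive (length-map _ (filter Q? (pairs n))))

-- Two cliques

module _ {n : ℕ} {R : Fin n → Fin n → Set} {S : Subset.Subset n} where

  walk-trans : ∀ {u v w} → WalkAvoiding R S u v → WalkAvoiding R S v w → WalkAvoiding R S u w
  walk-trans (here _) q = q
  walk-trans (step u∉ r p) q = step u∉ r (walk-trans p q)

  walk-start : ∀ {u v} → WalkAvoiding R S u v → u Subset.∉ S
  walk-start (here u∉) = u∉
  walk-start (step u∉ _ _) = u∉

  walk-sym : Symmetric R → ∀ {u v} → WalkAvoiding R S u v → WalkAvoiding R S v u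
  walk-sym s (here u∉) = here u∉
  walk-sym s (step u∉ r p) = walk-trans (walk-sym s p) (step (walk-start p) (s r) (here u∉))

-- The strictness of `m < j` is turned into an additional `900s`, which absorbs the crossing edges
-- that earlier cycles have spent.
scaled : ∀ s m p j → 900 * s ≤ p → m < j → 900 * (s * m) + 900 * s ≤ p * j
scaled s m p j s≤p m<j = ≤-trans (≤-reflexive (expand s m)) (*-mono-≤ s≤p m<j)
  where
  expand : ∀ s m → 900 * (s * m) + 900 * s ≡ 900 * s * suc m
  expand = solve-∀

module _ {n : ℕ} (Typ : Bool → Fin n → Set) (typ? : ∀ c v → Dec (Typ c v)) where

  Hub : Fin n → Set
  Hub v = ¬ Typ true v × ¬ Typ false v

  hub? : Decidable Hub
  hub? v = ¬? (typ? true v) ×-dec ¬? (typ? false v)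

  hub-or-typ : ∀ v → Hub v ⊎ Σ Bool λ c → Typ c v
  hub-or-typ v with typ? true v | typ? false v
  ... | yes t | _ = inj₂ (true , t)
  ... | no _ | yes f = inj₂ (false , f)
  ... | no ¬t | no ¬f = inj₁ (¬t , ¬f)

-- A passage between the two cliques. Connectors will be vertex-disjoint, so fewer than `k` deleted
-- vertices cannot hit `k` of them.
data Connector (n : ℕ) : Set where
  hub    : Fin n → Connector n
  bridge : Fin n → Fin n → Connector n

module _ {n : ℕ} where

  verts : Connector n → List (Fin n)
  verts (hub w)      = [ w ]
  verts (bridge a b) = a ∷ b ∷ []

  crossings : Connector n → List (Fin n × Fin n)
  crossings (hub w)      = []
  crossings (bridge a b) = [ (a , b) ]

  concat-hubs : ∀ ws → concatMap verts (map hub ws) ≡ ws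
  concat-hubs [] = refl
  concat-hubs (w ∷ ws) = cong (w ∷_) (concat-hubs ws)

  bridges : List (Fin n × Fin n) → List (Connector n)
  bridges = map (λ (a , b) → bridge a b)

  concat-bridges : ∀ ls → concatMap verts (bridges ls) ≡ ends ls
  concat-bridges [] = refl
  concat-bridges ((a , b) ∷ ls) = cong (λ vs → a ∷ b ∷ vs) (concat-bridges ls)

  concatMap-++ : ∀ (cs ds : List (Connector n)) → concatMap verts (cs ++ ds) ≡ concatMap verts cs ++ concatMap verts
      ds
  concatMap-++ [] ds = refl
  concatMap-++ (c ∷ cs) ds = trans (cong (verts c ++_) (concatMap-++ cs ds)) (sym (++-assoc (verts c) _ _))

  avoiding : ∀ {P : Fin n → Set} (P? : Decidable P) cs → count P? (concatMap verts cs) < length cs →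
             ∃ λ c → c ∈ cs × (∀ {v} → v ∈ verts c → ¬ P v)
  avoiding P? (c ∷ cs) lt with count P? (verts c) in eq
  ... | zero = c , here refl , count≡0⇒none P? (verts c) eq
  ... | suc m with avoiding P? cs (lin (count P? (concatMap verts (c ∷ cs)) ∷
      count P? (concatMap verts cs) ∷ count P? (verts c) ∷ m ∷ length cs ∷ [])
    (λ a b d m l → (a :< con 1 :+ l) ∷ (d :+ b :≤ a) ∷ (con 1 :+ m :≤ d) ∷ [] ⊢ b :< l) 0 (1 ∷ 1 ∷ 1 ∷ [])
    (lt ∷ eq≥ (count-++ P? (verts c) (concatMap verts cs)) ∷ eq≥ eq ∷ []))
  ... | c′ , c′∈ , free = c′ , there c′∈ , free

module Clique {n : ℕ} (G : Graph n) (k ℓ s : ℕ) (2≤k : 2 ≤ k) (4≤s : 4 ≤ s) (k≤s : k ≤ s) (ℓ≤s : ℓ ≤ s)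
  (deg : MinDegreeCond G k) (big : 2000 * s ≤ n)
  (Typ : Bool → Fin n → Set) (typ? : ∀ c v → Dec (Typ c v)) (typ-unique : ∀ {c d v} → Typ c v → Typ d v → c ≡ d)
  (sizes : ∀ c → n ≤ 2 * # (typ? c) + 8 * s)
  (missing : ∀ c {u} → Typ c u → # (λ w → typ? c w ×-dec ¬? (adj? G u w)) ≤ 42 * s)
  (crossing : ∀ c {u} → Typ c u → # (λ w → typ? (not c) w ×-dec adj? G u w) ≤ 38 * s)
  (hub-degree : ∀ c {v} → Hub Typ typ? v → 30 * s ≤ # (λ w → typ? c w ×-dec adj? G v w))
  (hub-count : # (hub? Typ typ?) ≤ 8 * s)
  (balance : # (typ? true) ≤ # (typ? false)) where

  private
    V = Fin n

  IsHub : V → Set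
  IsHub = Hub Typ typ?

  isHub? : Decidable IsHub
  isHub? = hub? Typ typ?

  hubs : List V
  hubs = filter isHub? (allFin n)

  hubs-unique : Unique hubs
  hubs-unique = Uniqueₚ.filter⁺ isHub? (Uniqueₚ.allFin⁺ n)

  hubs⁻ : ∀ {v} → v ∈ hubs → IsHub v
  hubs⁻ v∈ = proj₂ (∈-filter⁻ isHub? {xs = allFin n} v∈)

  Cross : V × V → Set
  Cross (u , v) = Typ true u × Typ false v

  cross? : Decidable Cross
  cross? (u , v) = typ? true u ×-dec typ? false v

  Valid : Graph n → Connector n → Set
  Valid R (hub w)      = IsHub w
  Valid R (bridge a b) = Typ true a × Typ false b × Adj R a b

  true≢false : ∀ {v} → Typ true v → ¬ Typ false v
  true≢false t f = case typ-unique t f of λ ()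

  -- Let `p ≤ q` be the sizes of the sides and `w` the number of hubs, so `n = p + q + w`, and let
  -- `u` have `x` crossing neighbours. Then `deg u` is at most `(p − 1) + x + w`, and the degree
  -- condition becomes `k ≤ 2x + w`. The `− 1` for `u` itself is exactly what offsets the `− 2` in
  -- the condition.
  cross-degree : ∀ {j} → # isHub? + j ≡ k → ∀ u → Typ true u → j ≤ 2 * # (λ v → typ? false v ×-dec adj? G u v)
  cross-degree {j} w+j u tu = lin (n ∷ k ∷ j ∷ degree G u ∷ # inside? ∷ # outside? ∷ # isHub? ∷
      # (¬? ∘ isHub?) ∷ # (typ? true) ∷ # (typ? false) ∷ # (_≟ᶠ u) ∷ # (λ v → outside? v ⊎-dec isHub? v) ∷ [])
    (λ n k j d t f w m p q o r → (n :+ k :≤ 2 :* d :+ con 2) ∷ (d :≤ t :+ r) ∷ (r :≤ f :+ w) ∷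
      (t :+ o :≤ p) ∷ (con 1 :≤ o) ∷ (p :≤ q) ∷ (w :+ m :≤ n) ∷ (p :+ q :≤ m) ∷ (w :+ j :≤ k) ∷
      [] ⊢ j :≤ 2 :* f) 0 (1 ∷ 2 ∷ 2 ∷ 2 ∷ 2 ∷ 1 ∷ 1 ∷ 1 ∷ 1 ∷ [])
    (deg u ∷ #-∪≤ (adj? G u) inside? (λ v → outside? v ⊎-dec isHub? v) kinds ∷
      #-∪≤ (λ v → outside? v ⊎-dec isHub? v) outside? isHub? id ∷
      #-⊎≥ (typ? true) inside? (_≟ᶠ u) proj₁ (λ { refl → tu }) (λ { (_ , r) refl → adj-irrefl G r }) ∷
      length≤# (_≟ᶠ u) {[ u ]} ([] ∷ []) (λ { (here eq) → eq }) ∷ balance ∷ eq≤ (#-∁ isHub?) ∷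
      #-⊎≥ (¬? ∘ isHub?) (typ? true) (typ? false) (λ t h → proj₁ h t) (λ f h → proj₂ h f) true≢false ∷
      eq≤ w+j ∷ [])
    where
    inside? = λ v → typ? true v ×-dec adj? G u v
    outside? = λ v → typ? false v ×-dec adj? G u v
    kinds : ∀ {v} → Adj G u v → (Typ true v × Adj G u v) ⊎ (Typ false v × Adj G u v) ⊎ IsHub v
    kinds {v} r with hub-or-typ Typ typ? v
    ... | inj₁ h = inj₂ (inj₂ h)
    ... | inj₂ (true , t) = inj₁ (t , r)
    ... | inj₂ (false , f) = inj₂ (inj₁ (f , r))

  module _ {i : ℕ} (i≤ℓ : i ≤ ℓ) (P : Packing {G = G} cross? i 2) where
    open Packing P

    R : Graph n
    R = remaining G cycles

    Connectors : Set
    Connectors = ∃ λ cs → All (Valid R) cs × k ≤ length cs × Unique (concatMap verts cs)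

    link? : Decidable (λ l → Cross l × Adj R (proj₁ l) (proj₂ l))
    link? l = cross? l ×-dec adj? R (proj₁ l) (proj₂ l)

    cross-matching : ∀ {j} → # isHub? + j ≡ k → Matching link? j
    cross-matching {j} w+j = matching link? (λ ((t , f) , _) → true≢false t f) (38 * s) out in′ j enough
      where
      out : ∀ u → # (λ v → link? (u , v)) ≤ 38 * s
      out u = case typ? true u of λ
        { (yes t) → ≤-trans (#-mono (λ v → link? (u , v)) (λ v → typ? false v ×-dec adj? G u v) λ ((_ , f) , r , _)
            → f , r) (crossing true t)
        ; (no ¬t) → ≤-trans (≤-reflexive (count-none (λ v → link? (u , v)) (allFin n) λ _ ((t , _) , _) → ¬t t)) z≤n
            }
      in′ : ∀ v → # (λ u → link? (u , v)) ≤ 38 * s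
      in′ v = case typ? false v of λ
        { (yes f) → ≤-trans (#-mono (λ u → link? (u , v)) (λ u → typ? true u ×-dec adj? G v u) λ ((t , _) , r , _) →
            t , adj-sym G r) (crossing false f)
        ; (no ¬f) → ≤-trans (≤-reflexive (count-none (λ u → link? (u , v)) (allFin n) λ _ ((_ , f) , _) → ¬f f)) z≤n
            }
      linkG? = λ l → typ? true (proj₁ l) ×-dec (typ? false (proj₂ l) ×-dec adj? G (proj₁ l) (proj₂ l))
      usedCross? = λ l → cross? l ×-dec used? cycles (proj₁ l) (proj₂ l)
      split : ∀ {l} → l ∈ pairs n → Typ true (proj₁ l) × (Typ false (proj₂ l) × Adj G (proj₁ l) (proj₂ l)) →
              (Cross l × Adj R (proj₁ l) (proj₂ l)) ⊎ (Cross l × Used cycles (proj₁ l) (proj₂ l))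
      split {l} _ (t , f , r) = case used? cycles (proj₁ l) (proj₂ l) of
          λ { (yes h) → inj₂ ((t , f) , h) ; (no ¬h) → inj₁ ((t , f) , r , ¬h) }
      p≥ : 900 * s ≤ # (typ? true)
      p≥ = lin (n ∷ s ∷ # (typ? true) ∷ [])
        (λ n s p → (n :≤ 2 :* p :+ 8 :* s) ∷ (2000 :* s :≤ n) ∷ [] ⊢ 900 :* s :≤ p) 1 (1 ∷ 1 ∷ [])
        (sizes true ∷ big ∷ [])
      -- At least `450s(m + 1)` crossing edges of `G`, less the at most `2s` already spent, against
      -- `152sm` pairs blocked by `m` matched edges.
      enough : ∀ m → m < j → m * (4 * (38 * s)) < count link? (pairs n)
      enough m m<j = lin (s ∷ ℓ ∷ i ∷ # (typ? true) * j ∷ count link? (pairs n) ∷ count linkG? (pairs n) ∷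
          usage cross? cycles ∷ s * m ∷ m * (4 * (38 * s)) ∷ [])
        (λ s ℓ i pj x xG us sm b → (900 :* sm :+ 900 :* s :≤ pj) ∷ (b :≤ 152 :* sm) ∷ (pj :≤ 2 :* xG) ∷
          (xG :≤ x :+ us) ∷ (us :≤ 2 :* i) ∷ (i :≤ ℓ) ∷ (ℓ :≤ s) ∷ (con 4 :≤ s) ∷ [] ⊢ b :< x) 4
              (1 ∷ 5 ∷ 1 ∷ 2 ∷ 2 ∷ 4 ∷ 4 ∷ 2 ∷ [])
        (scaled s m (# (typ? true)) j p≥ m<j ∷ eq≤ (expand s m) ∷
          pairs-count≥ (typ? true) (λ (u , v) → typ? false v ×-dec adj? G u v) 2 j (cross-degree w+j) ∷
          count-∪≤ linkG? link? usedCross? (pairs n) split ∷ ≤-trans sparing (≤-reflexive (*-comm i 2)) ∷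
          i≤ℓ ∷ ℓ≤s ∷ 4≤s ∷ [])
        where
        expand : ∀ s m → m * (4 * (38 * s)) ≡ 152 * (s * m)
        expand = solve-∀

    connectors : Connectors
    connectors with k ≤? length hubs
    ... | yes enough = map hub hubs , Allₚ.map⁺ (All.tabulate hubs⁻) , ≤-trans enough (eq≥ (length-map hub hubs)) ,
      subst Unique (sym (concat-hubs hubs)) hubs-unique
    ... | no few = let (j , w+j) = m≤n⇒∃[o]m+o≡n (<⇒≤ (≰⇒> few)) in extend w+j (cross-matching w+j)
      where
      typed : ∀ {ls v} → All (λ l → Cross l × Adj R (proj₁ l) (proj₂ l)) ls → v ∈ ends ls → ¬ IsHub v
      typed (((t , f) , _) ∷ vs) (here refl) h = proj₁ h t
      typed (((t , f) , _) ∷ vs) (there (here refl)) h = proj₂ h f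
      typed (_ ∷ vs) (there (there v∈)) h = typed vs v∈ h
      extend : ∀ {j} → # isHub? + j ≡ k → Matching link? j → Connectors
      extend w+j record { edges = ms ; valid = valid ; size≡ = size≡ ; unique = un } =
        map hub hubs ++ bridges ms ,
        Allₚ.++⁺ (Allₚ.map⁺ (All.tabulate hubs⁻)) (Allₚ.map⁺ (All.map (λ ((t , f) , r) → t , f , r) valid)) ,
        eq≥ (trans (length-++ (map hub hubs)) (trans (cong₂ _+_ (length-map hub hubs)
            (trans (length-map _ ms) size≡)) w+j)) ,
        subst Unique (sym (trans (concatMap-++ (map hub hubs) (bridges ms))
            (cong₂ _++_ (concat-hubs hubs) (concat-bridges ms))))
          (unique-++ hubs-unique un λ v∈ v∈′ → typed valid v∈′ (hubs⁻ v∈))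

    usedAt : ∀ u → # (used? cycles u) ≤ 2 * s
    usedAt = used-degree≤ i≤ℓ ℓ≤s cycles

    missingR : ∀ c {u} → Typ c u → # (λ w → typ? c w ×-dec ¬? (adj? R u w)) ≤ 44 * s
    missingR c {u} cu = lin (# (λ w → typ? c w ×-dec ¬? (adj? R u w)) ∷
        # (λ w → typ? c w ×-dec ¬? (adj? G u w)) ∷ # (used? cycles u) ∷ s ∷ [])
      (λ a b d s → (a :≤ b :+ d) ∷ (b :≤ 42 :* s) ∷ (d :≤ 2 :* s) ∷ [] ⊢ a :≤ 44 :* s) 0 (1 ∷ 1 ∷ 1 ∷ [])
      (
        #-∪≤ (λ w → typ? c w ×-dec ¬? (adj? R u w)) (λ w → typ? c w ×-dec ¬? (adj? G u w)) (used? cycles u) split ∷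
        missing c cu ∷ usedAt u ∷ [])
      where
      split : ∀ {w} → Typ c w × ¬ Adj R u w → (Typ c w × ¬ Adj G u w) ⊎ Used cycles u w
      split {w} (cw , ¬r) with adj? G u w | used? cycles u w
      ... | no ¬g | _ = inj₁ (cw , ¬g)
      ... | yes g | yes h = inj₂ h
      ... | yes g | no ¬h = contradiction (g , ¬h) ¬r

    hub-degreeR : ∀ c {v} → IsHub v → 28 * s ≤ # (λ w → typ? c w ×-dec adj? R v w)
    hub-degreeR c {v} hv = lin (# (λ w → typ? c w ×-dec adj? R v w) ∷
        # (λ w → typ? c w ×-dec adj? G v w) ∷ # (used? cycles v) ∷ s ∷ [])
      (λ a b d s → (b :≤ a :+ d) ∷ (30 :* s :≤ b) ∷ (d :≤ 2 :* s) ∷ [] ⊢ 28 :* s :≤ a) 0 (1 ∷ 1 ∷ 1 ∷ [])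
      (
        #-∪≤ (λ w → typ? c w ×-dec adj? G v w) (λ w → typ? c w ×-dec adj? R v w) (used? cycles v)
            (λ {w} (cw , g) → case used? cycles v w of λ { (yes h) → inj₂ h ; (no ¬h) → inj₁ (cw , g , ¬h) }) ∷
        hub-degree c hv ∷ usedAt v ∷ [])

    module Avoid (S : Subset.Subset n) (small : Subset.∣ S ∣ < k) where

      W : V → V → Set
      W = WalkAvoiding (Adj R) S

      -- Each of the two vertices misses at most `44s` of its side and `S` takes away fewer than
      -- `s`, whereas the side has at least `996s` vertices: a common neighbour survives.
      common : ∀ c {a a′} → Typ c a → a Subset.∉ S → Typ c a′ → a′ Subset.∉ S → W a a′
      common c {a} {a′} ca a∉ ca′ a′∉ with any? (λ w → ¬? (w ∈ˢ? S) ×-dec adj? R a w ×-dec adj? R a′ w)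
      ... | yes (w , w∉ , aw , a′w) = step a∉ aw (step w∉ (adj-sym R a′w) (here a′∉))
      ... | no none = (1≰0 (lin (n ∷ s ∷ k ∷ # (typ? c) ∷ # miss? ∷ # miss′? ∷ # (_∈ˢ? S) ∷
          # (λ w → miss′? w ⊎-dec (w ∈ˢ? S)) ∷ Subset.∣ S ∣ ∷ [])
        (λ n s k p m m′ e r z → (p :≤ m :+ r) ∷ (r :≤ m′ :+ e) ∷ (m :≤ 44 :* s) ∷ (m′ :≤ 44 :* s) ∷
          (e :≤ z) ∷ (z :< k) ∷ (k :≤ s) ∷ (n :≤ 2 :* p :+ 8 :* s) ∷ (2000 :* s :≤ n) ∷ (con 4 :≤ s) ∷
          [] ⊢ con 1 :≤ con 0) 7257 (2 ∷ 2 ∷ 2 ∷ 2 ∷ 2 ∷ 2 ∷ 2 ∷ 1 ∷ 1 ∷ 1814 ∷ [])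
        (#-∪≤ (typ? c) miss? (λ w → miss′? w ⊎-dec (w ∈ˢ? S)) split ∷
          #-∪≤ (λ w → miss′? w ⊎-dec (w ∈ˢ? S)) miss′? (_∈ˢ? S) id ∷ missingR c ca ∷ missingR c ca′ ∷
          #∈ˢ S ∷ small ∷ k≤s ∷ sizes c ∷ big ∷ 4≤s ∷ [])))
        where
        miss? = λ w → typ? c w ×-dec ¬? (adj? R a w)
        miss′? = λ w → typ? c w ×-dec ¬? (adj? R a′ w)
        split : ∀ {w} → Typ c w → (Typ c w × ¬ Adj R a w) ⊎ (Typ c w × ¬ Adj R a′ w) ⊎ w Subset.∈ S
        split {w} cw with adj? R a w | adj? R a′ w | w ∈ˢ? S
        ... | no ¬r | _ | _ = inj₁ (cw , ¬r)
        ... | yes _ | no ¬r | _ = inj₂ (inj₁ (cw , ¬r))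
        ... | yes _ | yes _ | yes w∈ = inj₂ (inj₂ w∈)
        ... | yes r | yes r′ | no w∉ = contradiction (w , w∉ , r , r′) none

      from-hub : ∀ c {v} → IsHub v → ∃ λ a → Typ c a × a Subset.∉ S × Adj R v a
      from-hub c {v} hv with #>⇒∃ (λ w → typ? c w ×-dec adj? R v w) (_∈ˢ? S)
        (lin (s ∷ k ∷ # (λ w → typ? c w ×-dec adj? R v w) ∷ # (_∈ˢ? S) ∷ Subset.∣ S ∣ ∷ [])
          (λ s k a e z → (e :≤ z) ∷ (z :< k) ∷ (k :≤ s) ∷ (28 :* s :≤ a) ∷ [] ⊢ e :< a) 0 (1 ∷ 1 ∷ 1 ∷ 1 ∷ [])
          (#∈ˢ S ∷ small ∷ k≤s ∷ hub-degreeR c hv ∷ []))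
      ... | a , (ca , va) , a∉ = a , ca , a∉ , va

      anchor : ∀ {u} → u Subset.∉ S → ∃₂ λ c a → Typ c a × a Subset.∉ S × W u a
      anchor {u} u∉ with hub-or-typ Typ typ? u
      ... | inj₂ (c , cu) = c , u , cu , u∉ , here u∉
      ... | inj₁ hu with from-hub true hu
      ...   | a , ta , a∉ , ua = true , a , ta , a∉ , step u∉ ua (here a∉)

      across : ∃₂ λ a b → (Typ true a × a Subset.∉ S) × (Typ false b × b Subset.∉ S) × W a b
      across with connectors
      ... | cs , valid , enough , un with avoiding (_∈ˢ? S) cs
          (≤-<-trans (≤-trans (count≤# (_∈ˢ? S) un) (#∈ˢ S)) (<-≤-trans small enough))
      ... | hub w , c∈ , free with from-hub true (All.lookup valid c∈) | from-hub false (All.lookup valid c∈)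
      ...   | a , ta , a∉ , wa | b , fb , b∉ , wb = a , b , (ta , a∉) , (fb , b∉) , step a∉ (adj-sym R wa)
          (step (free (here refl)) wb (here b∉))
      across | cs , valid , enough , un | bridge a b , c∈ , free with All.lookup valid c∈
      ... | ta , fb , ab = a , b , (ta , free (here refl)) , (fb , free (there (here refl))) , step
          (free (here refl)) ab (here (free (there (here refl))))

      connect : ∀ u v → u Subset.∉ S → v Subset.∉ S → W u v
      connect u v u∉ v∉ with anchor u∉ | anchor v∉ | across
      ... | c , a , ca , a∉ , ua | d , b , db , b∉ , vb | t , f , (tt′ , t∉) , (ff , f∉) , tf =
          walk-trans ua (walk-trans (between c d ca db) (walk-sym (adj-sym R) vb))
        where
        between : ∀ c d → Typ c a → Typ d b → W a b
        between true true ta tb = common true ta a∉ tb b∉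
        between false false fa fb = common false fa a∉ fb b∉
        between true false ta fb = walk-trans (common true ta a∉ tt′ t∉) (walk-trans tf (common false ff f∉ fb b∉))
        between false true fa tb = walk-trans (common false fa a∉ ff f∉)
            (walk-trans (walk-sym (adj-sym R) tf) (common true tt′ t∉ tb b∉))

    k-connected : KConnected k (Adj R)
    k-connected = (lin (n ∷ k ∷ s ∷ [])
      (λ n k s → (k :≤ s) ∷ (2000 :* s :≤ n) ∷ (con 4 :≤ s) ∷ [] ⊢ k :< n) 0 (1 ∷ 1 ∷ 1 ∷ [])
      (k≤s ∷ big ∷ 4≤s ∷ [])) , λ S small u v → Avoid.connect S small u v

    module Build (c₁ c₂ : Connector n) (v₁ : Valid R c₁) (v₂ : Valid R c₂) (un : Unique (verts c₁ ++ verts c₂))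
        where

      chosen : List (V × V)
      chosen = crossings c₁ ++ crossings c₂

      Chosen : V → V → Set
      Chosen u v = (u , v) ∈ chosen ⊎ (v , u) ∈ chosen

      chosen? : ∀ u v → Dec (Chosen u v)
      chosen? u v = DecPair._∈?_ (u , v) chosen ⊎-dec DecPair._∈?_ (v , u) chosen

      -- A Hamiltonian cycle of R′ spends at most the two chosen crossing edges.
      R′ : Graph n
      R′ = record
        { Adj = λ u v → Adj R u v × (Chosen u v ⊎ ¬ (Cross (u , v) ⊎ Cross (v , u)))
        ; adj? = λ u v → adj? R u v ×-dec (chosen? u v ⊎-dec ¬? (cross? (u , v) ⊎-dec cross? (v , u)))
        ; sym = λ { (r , inj₁ (inj₁ l∈)) → adj-sym R r , inj₁ (inj₂ l∈)
                  ; (r , inj₁ (inj₂ l∈)) → adj-sym R r , inj₁ (inj₁ l∈)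
                  ; (r , inj₂ ¬c) → adj-sym R r , inj₂ λ { (inj₁ c) → ¬c (inj₂ c) ; (inj₂ c) → ¬c (inj₁ c) } }
        ; irrefl = λ (r , _) → adj-irrefl R r }

      open Strands R′ Typ typ? typ-unique id (λ _ → refl)
      open Task

      -- The cycle crosses over by one connector and returns by the other; the colours of the flanks
      -- fix the direction of travel.
      forward backward : ∀ c → Valid R c → (∀ l → l ∈ crossings c → l ∈ chosen) → Task
      forward (hub w) _ _ = record { path = stop {x = w} ; short = s≤s z≤n ; cl = true ; cr = false }
      forward (bridge a b) (_ , _ , r) inc = record { path = (r , inj₁ (inj₁ (inc _ (here refl)))) ► stop ; short =
          ≤-refl ; cl = true ; cr = false }
      backward (hub w) _ _ = record { path = stop {x = w} ; short = s≤s z≤n ; cl = false ; cr = true }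
      backward (bridge a b) (_ , _ , r) inc = record { path =
          (adj-sym R r , inj₁ (inj₂ (inc _ (here refl)))) ► stop ; short = ≤-refl ; cl = false ; cr = true }

      -- The hubs that do not serve as connectors have room on both sides; all are visited from the
      -- `true` side.
      hubTask : V → Task
      hubTask w = record { path = stop {x = w} ; short = s≤s z≤n ; cl = true ; cr = true }

      rest? : Decidable (λ w → IsHub w × w ∉ verts c₁ ++ verts c₂)
      rest? w = isHub? w ×-dec ¬? (w ∈? verts c₁ ++ verts c₂)

      rest : List V
      rest = filter rest? (allFin n)

      t₁ t₂ : Task
      t₁ = forward c₁ v₁ (λ _ → ∈-++⁺ˡ)
      t₂ = backward c₂ v₂ (λ _ → ∈-++⁺ʳ (crossings c₁))

      tasks : List Task
      tasks = t₁ ∷ t₂ ∷ map hubTask rest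

      cores-shape : cores tasks ↭ (verts c₁ ++ verts c₂) ++ rest
      cores-shape = ↭-trans (↭-++⁺ (forward-core c₁ v₁ _) (↭-++⁺ (backward-core c₂ v₂ _) (hub-cores rest)))
          (↭-reflexive (sym (++-assoc (verts c₁) (verts c₂) rest)))
        where
        forward-core : ∀ c v inc → core (forward c v inc) ↭ verts c
        forward-core (hub w) v inc = refl
        forward-core (bridge a b) v inc = refl
        backward-core : ∀ c v inc → core (backward c v inc) ↭ verts c
        backward-core (hub w) v inc = refl
        backward-core (bridge a b) v inc = swap b a refl
        hub-cores : ∀ ws → cores (map hubTask ws) ↭ ws
        hub-cores [] = refl
        hub-cores (w ∷ ws) = prep w (hub-cores ws)

      cores-unique : Unique (cores tasks)
      cores-unique = unique-↭ (↭-sym cores-shape) (unique-++ un (Uniqueₚ.filter⁺ rest? (Uniqueₚ.allFin⁺ n))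
        λ v∈ v∈′ → proj₂ (proj₂ (∈-filter⁻ rest? {xs = allFin n} v∈′)) v∈)

      covered : ∀ v → v ∈ cores tasks ⊎ Σ Bool λ c → Typ c v
      covered v with hub-or-typ Typ typ? v | v ∈? verts c₁ ++ verts c₂
      ... | inj₂ ct | _ = inj₂ ct
      ... | inj₁ h | yes v∈ = inj₁ (∈-resp-↭ (↭-sym cores-shape) (∈-++⁺ˡ v∈))
      ... | inj₁ h | no v∉ = inj₁ (∈-resp-↭ (↭-sym cores-shape)
          (∈-++⁺ʳ (verts c₁ ++ verts c₂) (∈-filter⁺ rest? (∈-allFin v) (h , v∉))))

      same-side : ∀ {c u w} → Typ c u → Typ c w → ¬ (Cross (u , w) ⊎ Cross (w , u))
      same-side cu cw (inj₁ (tu , fw)) = case trans (typ-unique tu cu) (typ-unique cw fw) of λ ()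
      same-side cu cw (inj₂ (tw , fu)) = case trans (typ-unique tw cw) (typ-unique cu fu) of λ ()

      missing′ : ∀ c u → Typ c u → # (λ w → typ? c w ×-dec ¬? (adj? R′ u w)) ≤ 44 * s
      missing′ c u cu = ≤-trans (#-mono (λ w → typ? c w ×-dec ¬? (adj? R′ u w))
          (λ w → typ? c w ×-dec ¬? (adj? R u w))
        λ (cw , ¬r) → cw , λ r → ¬r (r , inj₂ (same-side cu cw))) (missingR c cu)

      room-typ : ∀ c {u} → Typ c u → 27 * s < # (roomy? c u)
      room-typ c {u} cu = lin (n ∷ s ∷ # (typ? c) ∷ # (roomy? c u) ∷
          # (λ w → typ? c w ×-dec ¬? (adj? R′ u w)) ∷ [])
        (λ n s p r m → (p :≤ r :+ m) ∷ (m :≤ 44 :* s) ∷ (n :≤ 2 :* p :+ 8 :* s) ∷ (2000 :* s :≤ n) ∷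
          (con 4 :≤ s) ∷ [] ⊢ 27 :* s :< r) 34 (2 ∷ 2 ∷ 1 ∷ 1 ∷ 9 ∷ [])
        (
          #-∪≤ (typ? c) (roomy? c u) (λ w → typ? c w ×-dec ¬? (adj? R′ u w))
              (λ {w} cw → case adj? R′ u w of λ { (yes r) → inj₁ (cw , r) ; (no ¬r) → inj₂ (cw , ¬r) }) ∷
          missing′ c u cu ∷ sizes c ∷ big ∷ 4≤s ∷ [])

      room-hub : ∀ c {w} → IsHub w → 27 * s < # (roomy? c w)
      room-hub c {w} h = lin (s ∷ # (roomy? c w) ∷ # (λ v → typ? c v ×-dec adj? R w v) ∷ [])
        (λ s r a → (28 :* s :≤ a) ∷ (a :≤ r) ∷ (con 4 :≤ s) ∷ [] ⊢ 27 :* s :< r) 0 (1 ∷ 1 ∷ 1 ∷ [])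
        (hub-degreeR c h ∷
          #-mono (λ v → typ? c v ×-dec adj? R w v) (roomy? c w)
              (λ (cv , r) → cv , r , inj₂ λ { (inj₁ (tw , _)) → proj₁ h tw ; (inj₂ (_ , fw)) → proj₂ h fw }) ∷
          4≤s ∷ [])

      rooms : All (λ t → 27 * s < # (roomy? (cl t) (src t)) × 27 * s < # (roomy? (cr t) (dst t))) tasks
      rooms = forward-room c₁ v₁ _ ∷ backward-room c₂ v₂ _ ∷ Allₚ.map⁺
          (All.tabulate λ w∈ → let h = proj₁ (proj₂ (∈-filter⁻ rest? {xs = allFin n} w∈)) in room-hub true h ,
          room-hub true h)
        where
        forward-room : ∀ c v inc → let t = forward c v inc in 27 * s < # (roomy? (cl t) (src t)) × 27 * s < #
            (roomy? (cr t) (dst t))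
        forward-room (hub w) h inc = room-hub true h , room-hub false h
        forward-room (bridge a b) (ta , fb , _) inc = room-typ true ta , room-typ false fb
        backward-room : ∀ c v inc → let t = backward c v inc in 27 * s < # (roomy? (cl t) (src t)) × 27 * s < #
            (roomy? (cr t) (dst t))
        backward-room (hub w) h inc = room-hub false h , room-hub true h
        backward-room (bridge a b) (ta , fb , _) inc = room-typ false fb , room-typ true ta

      rest-length : length rest ≤ 8 * s
      rest-length = ≤-trans (#-mono rest? isHub? proj₁) hub-count

      tasks-length : length tasks ≡ 2 + length rest
      tasks-length = cong (2 +_) (length-map hubTask rest)

      cores-length : length (cores tasks) ≤ 4 + length rest
      cores-length = ≤-trans (≤-reflexive (trans (↭-length cores-shape) (length-++ (verts c₁ ++ verts c₂))))
        (+-monoˡ-≤ (length rest) (≤-trans (≤-reflexive (length-++ (verts c₁))) (+-mono-≤ (short₂ c₁) (short₂ c₂))))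
        where
        short₂ : (c : Connector n) → length (verts c) ≤ 2
        short₂ (hub _) = s≤s z≤n
        short₂ (bridge _ _) = ≤-refl

      -- At most `8s + 4` core vertices and `2(8s + 2)` flanks make `24s + 8`, and `s` is at least
      -- 4. The `30s` demanded of hubs on each side leave `28s` after the spent edges, which is
      -- still enough for the flanks.
      total : length (cores tasks) + length tasks * 2 ≤ 27 * s
      total = lin (s ∷ length (cores tasks) ∷ length tasks ∷ length tasks * 2 ∷ length rest ∷ [])
        (λ s a t t2 r → (a :≤ con 4 :+ r) ∷ (t2 :≤ 2 :* t) ∷ (t :≤ con 2 :+ r) ∷ (r :≤ 8 :* s) ∷
          (con 4 :≤ s) ∷ [] ⊢ a :+ t2 :≤ 27 :* s) 0 (1 ∷ 1 ∷ 2 ∷ 3 ∷ 2 ∷ [])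
        (cores-length ∷ eq≤ (*-comm (length tasks) 2) ∷ eq≤ tasks-length ∷ rest-length ∷ 4≤s ∷ [])

      F : Flanked tasks (cores tasks)
      F = attach (27 * s) tasks (cores tasks) rooms total

      open Leftovers tasks F id cores-unique covered

      leftover-pos : ∀ c → 0 < length (leftover c)
      leftover-pos c = lin (n ∷ s ∷ # (typ? c) ∷ length (used) ∷ length (leftover c) ∷
          length (cores tasks) ∷ length tasks * 2 ∷ [])
        (λ n s p u l a t2 → (p :≤ u :+ l) ∷ (u :≤ a :+ t2) ∷ (a :+ t2 :≤ 27 :* s) ∷
          (n :≤ 2 :* p :+ 8 :* s) ∷ (2000 :* s :≤ n) ∷ (con 4 :≤ s) ∷ [] ⊢ con 0 :< l) 7751
              (2 ∷ 2 ∷ 2 ∷ 1 ∷ 1 ∷ 1938 ∷ [])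
        (leftover-length c ∷ eq≤ used-length ∷ total ∷ sizes c ∷ big ∷ 4≤s ∷ [])

      -- The cyclic order: the `true` side together with the spare hubs, then `c₁`, then the `false`
      -- side, then back over `c₂`.
      assemble : ∀ {segs A B} → Flank tasks segs → All (Typ true) A → All (Typ false) B → 0 < length A →
          0 < length B →
                 concat segs ++ A ++ B ↭ allFin n → Σ (Cycle R′) λ C → n ≤ len C
      assemble {A = A} {B} (flank {xss = _} {a = a₁} {b = b₁} p q r t
          (flank {xss = xss} {a = a₂} {b = b₂} p′ q′ r′ t′ fs)) ta@(_ ∷ _) fb@(_ ∷ _) _ _ perm =
        close-up (join (join (join sideA refl s₁) refl sideB) refl s₂) refl
            (↭-trans (↭-reflexive (cong₂ (λ α β → ((α ++ x₁) ++ β) ++ x₂) listA listB)) (↭-trans shuffle perm))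
            (44 * s) dense missing′
        where
        x₁ = a₁ ∷ core t₁ ++ [ b₁ ]
        x₂ = a₂ ∷ core t₂ ++ [ b₂ ]
        s₁ : Strand true false 4 x₁
        s₁ = subst₂ (λ c d → Strand c d 4 x₁) (cl₁ c₁ v₁ _) (cr₁ c₁ v₁ _) (flank-strand {t₁} p q r t)
          where
          cl₁ : ∀ c v inc → cl (forward c v inc) ≡ true
          cl₁ (hub _) _ _ = refl
          cl₁ (bridge _ _) _ _ = refl
          cr₁ : ∀ c v inc → cr (forward c v inc) ≡ false
          cr₁ (hub _) _ _ = refl
          cr₁ (bridge _ _) _ _ = refl
        s₂ : Strand false true 4 x₂
        s₂ = subst₂ (λ c d → Strand c d 4 x₂) (cl₂ c₂ v₂ _) (cr₂ c₂ v₂ _) (flank-strand {t₂} p′ q′ r′ t′)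
          where
          cl₂ : ∀ c v inc → cl (backward c v inc) ≡ false
          cl₂ (hub _) _ _ = refl
          cl₂ (bridge _ _) _ _ = refl
          cr₂ : ∀ c v inc → cr (backward c v inc) ≡ true
          cr₂ (hub _) _ _ = refl
          cr₂ (bridge _ _) _ _ = refl
        hubStrands : Strands true (length (map hubTask rest) * 4) xss
        hubStrands = flank-strands (Allₚ.map⁺ (All.tabulate λ _ → refl , refl)) fs
        sideA = chain refl (strands-++ (singles ta) hubStrands)
        sideB = chain refl (singles fb)
        listA : concat (map [_] A ++ xss) ≡ A ++ concat xss
        listA = trans (sym (concat-++ (map [_] A) xss)) (cong (_++ concat xss) (concat-singles A))
        listB : concat (map [_] B) ≡ B
        listB = concat-singles B
        shuffle : (((A ++ concat xss) ++ x₁) ++ B) ++ x₂ ↭ (x₁ ++ (x₂ ++ concat xss)) ++ (A ++ B)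
        shuffle = solve 5 (λ a x p b q → (((a ⊕ x) ⊕ p) ⊕ b) ⊕ q ⊜ (p ⊕ (q ⊕ x)) ⊕ (a ⊕ b)) ↭-refl A (concat xss) x₁
            B x₂
          where open CMSolver (++-commutativeMonoid {A = V})
        dense : ∀ c → length (map hubTask rest) * 4 + 4 + 0 + 4 + (2 * (44 * s) + 2) ≤ # (typ? c)
        dense c = lin (n ∷ s ∷ # (typ? c) ∷ length (map hubTask rest) ∷ length (map hubTask rest) * 4 ∷
            length rest ∷ [])
          (λ n s p h h4 r → (h4 :≤ 4 :* h) ∷ (h :≤ r) ∷ (r :≤ 8 :* s) ∷ (n :≤ 2 :* p :+ 8 :* s) ∷
            (2000 :* s :≤ n) ∷ (con 4 :≤ s) ∷
            [] ⊢ h4 :+ con 4 :+ con 0 :+ con 4 :+ (2 :* (44 :* s) :+ con 2) :≤ p) 1 (2 ∷ 8 ∷ 8 ∷ 1 ∷ 1 ∷ 5 ∷ [])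
          (eq≤ (*-comm (length (map hubTask rest)) 4) ∷ eq≤ (length-map hubTask rest) ∷ rest-length ∷
            sizes c ∷ big ∷ 4≤s ∷ [])

      cycle : Σ (Cycle R′) λ C → n ≤ len C
      cycle = assemble (Flanked.flanks F) (leftover-typ true) (leftover-typ false)
        (leftover-pos true) (leftover-pos false) (spanning)

      3≤n : 3 ≤ n
      3≤n = lin (n ∷ s ∷ [])
        (λ n s → (2000 :* s :≤ n) ∷ (con 4 :≤ s) ∷ [] ⊢ con 3 :≤ n) 0 (1 ∷ 1 ∷ [])
        (big ∷ 4≤s ∷ [])

      restrain : HamCycle R′ → Σ (HamCycle R) λ C → count (λ l → cross? l ×-dec hamEdge? C (proj₁ l) (proj₂ l))
          (pairs n) ≤ 2
      restrain H = widen proj₁ H , ≤-trans (pairs-count≤length _ chosen λ (c , h) → in-chosen c (hamEdge-adj H h))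
          few
        where
        few : length chosen ≤ 2
        few = ≤-trans (≤-reflexive (length-++ (crossings c₁))) (+-mono-≤ (short₁ c₁) (short₁ c₂))
          where
          short₁ : (c : Connector n) → length (crossings c) ≤ 1
          short₁ (hub _) = z≤n
          short₁ (bridge _ _) = ≤-refl
        crossing-cross : ∀ {c l} → Valid R c → l ∈ crossings c → Cross l
        crossing-cross {bridge a b} (ta , fb , _) (here refl) = ta , fb
        chosen-cross : ∀ {l} → l ∈ chosen → Cross l
        chosen-cross l∈ = [ crossing-cross v₁ , crossing-cross v₂ ]′ (∈-++⁻ (crossings c₁) l∈)
        in-chosen : ∀ {l} → Cross l → Adj R′ (proj₁ l) (proj₂ l) → l ∈ chosen
        in-chosen c (_ , inj₁ (inj₁ l∈)) = l∈
        -- A reversed chosen pair would put a vertex on both sides, so each chosen edge is counted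
        -- in one direction.
        in-chosen (t , _) (_ , inj₁ (inj₂ l∈)) = contradiction (proj₂ (chosen-cross l∈)) (true≢false t)
        in-chosen c (_ , inj₂ ¬c) = contradiction (inj₁ c) ¬c

      sparing-cycle : Σ (HamCycle R) λ C → count (λ l → cross? l ×-dec hamEdge? C (proj₁ l) (proj₂ l)) (pairs n) ≤ 2
      sparing-cycle = restrain (toHamCycle 3≤n (proj₁ cycle) (proj₂ cycle))

    next-cycle : Σ (HamCycle R) λ C → count (λ l → cross? l ×-dec hamEdge? C (proj₁ l) (proj₂ l)) (pairs n) ≤ 2
    next-cycle = from connectors
      where
      from : Connectors → Σ (HamCycle R) λ C → count (λ l → cross? l ×-dec hamEdge? C (proj₁ l) (proj₂ l)) (pairs n)
          ≤ 2
      from (c₁ ∷ c₂ ∷ cs , v₁ ∷ v₂ ∷ _ , _ , un) = Build.sparing-cycle c₁ c₂ v₁ v₂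
        (proj₁ (unique-++⁻ (verts c₁ ++ verts c₂) (subst Unique
            (sym (++-assoc (verts c₁) (verts c₂) (concatMap verts cs))) un)))
      from ([] , _ , k≤ , _) = contradiction (≤-trans 2≤k k≤) λ ()
      from (_ ∷ [] , _ , k≤ , _) = contradiction (≤-trans 2≤k k≤) λ { (s≤s ()) }

  clique-case : Σ (Fin ℓ → HamCycle G) λ H → EdgeDisjoint H × KConnected k (RemoveCycles G H)
  clique-case with packing {G = G} cross? {X = ⊥} ℓ 2 (λ j j<ℓ P → inj₂ (next-cycle (<⇒≤ j<ℓ) P))
  ... | inj₂ P = Packing.cycles P , Packing.disjoint P , k-connected ≤-refl P

-- Completing a split to two near-cliques

Conclusion : ∀ {n} → Graph n → ℕ → ℕ → Set
Conclusion G k ℓ = Σ (Fin ℓ → HamCycle G) λ H → EdgeDisjoint H × KConnected k (RemoveCycles G H)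

module TwoCliques {n : ℕ} (G : Graph n) (k ℓ s : ℕ) (2≤k : 2 ≤ k) (4≤s : 4 ≤ s) (k≤s : k ≤ s) (ℓ≤s : ℓ ≤ s)
  (deg : MinDegreeCond G k) (big : 2000 * s ≤ n)
  (L : Bool → List (Fin n)) (L-unique : ∀ c → Unique (L c)) (L-disjoint : ∀ {c d v} → v ∈ L c → v ∈ L d → c ≡ d)
  (few : ∀ c {x} → x ∈ L c → # (λ y → (y ∈? L (not c)) ×-dec adj? G x y) ≤ 2 * s)
  (L-big : ∀ c → n ≤ 2 * length (L c) + 8 * s) where

  private
    V = Fin n

  N? : ∀ c v → Decidable (λ y → y ∈ L c × Adj G v y)
  N? c v y = (y ∈? L c) ×-dec adj? G v y

  Outer : V → Set
  Outer v = v ∉ L true × v ∉ L false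

  outer? : Decidable Outer
  outer? v = ¬? (v ∈? L true) ×-dec ¬? (v ∈? L false)

  -- Vertices outside both lists join a side on whose opposite they have few neighbours; the
  -- remaining ones have many neighbours on both sides and become hubs.
  Typ : Bool → V → Set
  Typ true  v = v ∈ L true ⊎ (Outer v × # (N? false v) < 30 * s)
  Typ false v = v ∈ L false ⊎ (Outer v × (30 * s ≤ # (N? false v) × # (N? true v) < 30 * s))

  typ? : ∀ c v → Dec (Typ c v)
  typ? true  v = (v ∈? L true) ⊎-dec (outer? v ×-dec (# (N? false v) <? 30 * s))
  typ? false v = (v ∈? L false) ⊎-dec (outer? v ×-dec ((30 * s ≤? # (N? false v)) ×-dec (# (N? true v) <? 30 * s)))

  true≢false : ∀ {v} → Typ true v → ¬ Typ false v
  true≢false (inj₁ a) (inj₁ b) = case L-disjoint a b of λ ()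
  true≢false (inj₁ a) (inj₂ ((a∉ , _) , _)) = a∉ a
  true≢false (inj₂ ((_ , b∉) , _)) (inj₁ b) = b∉ b
  true≢false (inj₂ (_ , lt)) (inj₂ (_ , le , _)) = <⇒≱ lt le

  typ-unique : ∀ {c d v} → Typ c v → Typ d v → c ≡ d
  typ-unique {true}  {true}  t t′ = refl
  typ-unique {true}  {false} t f  = contradiction f (true≢false t)
  typ-unique {false} {true}  f t  = contradiction f (true≢false t)
  typ-unique {false} {false} f f′ = refl

  L⊆Typ : ∀ c {v} → v ∈ L c → Typ c v
  L⊆Typ true  = inj₁
  L⊆Typ false = inj₁

  Typ⊆ : ∀ c {v} → Typ c v → v ∈ L c ⊎ Outer v
  Typ⊆ true  = [ inj₁ , inj₂ ∘ proj₁ ]′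
  Typ⊆ false = [ inj₁ , inj₂ ∘ proj₁ ]′

  outer-∉ : ∀ c {v} → Outer v → v ∉ L c
  outer-∉ true  = proj₁
  outer-∉ false = proj₂

  somewhere : ∀ c v → v ∈ L c ⊎ v ∈ L (not c) ⊎ Outer v
  somewhere c v with v ∈? L true | v ∈? L false
  somewhere true  v | yes a | _     = inj₁ a
  somewhere true  v | no _  | yes b = inj₂ (inj₁ b)
  somewhere false v | yes a | _     = inj₂ (inj₁ a)
  somewhere false v | no _  | yes b = inj₁ b
  somewhere c     v | no a∉ | no b∉ = inj₂ (inj₂ (a∉ , b∉))

  opposite-few : ∀ c {u} → Typ c u → # (N? (not c) u) ≤ 30 * s
  opposite-few c {u} t = go c t
    where
    weaken : ∀ c → u ∈ L c → # (N? (not c) u) ≤ 30 * s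
    weaken c u∈ = lin (s ∷ # (N? (not c) u) ∷ [])
      (λ s a → (a :≤ 2 :* s) ∷ [] ⊢ a :≤ 30 :* s) 0 (1 ∷ [])
      (few c u∈ ∷ [])
    go : ∀ c → Typ c u → # (N? (not c) u) ≤ 30 * s
    go true  (inj₁ u∈) = weaken true u∈
    go true  (inj₂ (_ , lt)) = <⇒≤ lt
    go false (inj₁ u∈) = weaken false u∈
    go false (inj₂ (_ , _ , lt)) = <⇒≤ lt

  outer-count : # outer? ≤ 8 * s
  outer-count = lin (n ∷ s ∷ length (L true) ∷ length (L false) ∷ # (_∈? L true) ∷ # (_∈? L false) ∷
      # outer? ∷ # (λ v → ¬? (v ∈? L true)) ∷ [])
    (λ n s a b a′ b′ o m → (a :≤ a′) ∷ (b :≤ b′) ∷ (a′ :+ m :≤ n) ∷ (b′ :+ o :≤ m) ∷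
      (n :≤ 2 :* a :+ 8 :* s) ∷ (n :≤ 2 :* b :+ 8 :* s) ∷ [] ⊢ o :≤ 8 :* s) 1 (2 ∷ 2 ∷ 2 ∷ 2 ∷ 1 ∷ 1 ∷ [])
    (eq≥ (#∈ (L-unique true)) ∷ eq≥ (#∈ (L-unique false)) ∷ eq≤ (#-∁ (_∈? L true)) ∷
      #-⊎≥ (λ v → ¬? (v ∈? L true)) (_∈? L false) outer? (λ b a → case L-disjoint a b of λ ()) proj₁
          (λ b o → proj₂ o b) ∷
      L-big true ∷ L-big false ∷ [])

  sizes : ∀ c → n ≤ 2 * # (typ? c) + 8 * s
  sizes c = lin (n ∷ s ∷ length (L c) ∷ # (typ? c) ∷ [])
    (λ n s a p → (a :≤ p) ∷ (n :≤ 2 :* a :+ 8 :* s) ∷ [] ⊢ n :≤ 2 :* p :+ 8 :* s) 0 (2 ∷ 1 ∷ [])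
    (length≤# (typ? c) (L-unique c) (L⊆Typ c) ∷ L-big c ∷ [])

  crossing : ∀ c {u} → Typ c u → # (λ w → typ? (not c) w ×-dec adj? G u w) ≤ 38 * s
  crossing c {u} cu = lin (s ∷ # (λ w → typ? (not c) w ×-dec adj? G u w) ∷ # (N? (not c) u) ∷ # outer? ∷ [])
    (λ s a b o → (a :≤ b :+ o) ∷ (b :≤ 30 :* s) ∷ (o :≤ 8 :* s) ∷ [] ⊢ a :≤ 38 :* s) 0 (1 ∷ 1 ∷ 1 ∷ [])
    (
      #-∪≤ (λ w → typ? (not c) w ×-dec adj? G u w) (N? (not c) u) outer?
          (λ (t , r) → [ (λ w∈ → inj₁ (w∈ , r)) , inj₂ ]′ (Typ⊆ (not c) t)) ∷
      opposite-few c cu ∷ outer-count ∷ [])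

  not-≢ : ∀ c → not c ≢ c
  not-≢ true ()
  not-≢ false ()

  -- At least `n/2` neighbours of `u` exist, of which at most `30s` are in the opposite list and
  -- `8s` in neither list. The class avoids the opposite list and hence has at most `n/2 + 4s`
  -- vertices.
  missing-few : ∀ c {u} → Typ c u → # (λ w → typ? c w ×-dec ¬? (adj? G u w)) ≤ 42 * s
  missing-few c {u} cu = lin (n ∷ s ∷ k ∷ degree G u ∷ # (typ? c) ∷ # (λ w → typ? c w ×-dec adj? G u w) ∷
      # (λ w → typ? c w ×-dec ¬? (adj? G u w)) ∷ # (N? (not c) u) ∷ # outer? ∷
      # (λ w → N? (not c) u w ⊎-dec outer? w) ∷ length (L (not c)) ∷ # (_∈? L (not c)) ∷
      # (λ w → ¬? (w ∈? L (not c))) ∷ [])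
    (λ n s k d p x m b o r l l′ e → (x :+ m :≤ p) ∷ (d :≤ x :+ r) ∷ (r :≤ b :+ o) ∷ (b :≤ 30 :* s) ∷
      (o :≤ 8 :* s) ∷ (n :+ k :≤ 2 :* d :+ con 2) ∷ (con 2 :≤ k) ∷ (p :≤ e) ∷ (l′ :+ e :≤ n) ∷ (l :≤ l′) ∷
      (n :≤ 2 :* l :+ 8 :* s) ∷ [] ⊢ m :≤ 42 :* s) 1 (2 ∷ 2 ∷ 2 ∷ 2 ∷ 2 ∷ 1 ∷ 1 ∷ 2 ∷ 2 ∷ 2 ∷ 1 ∷ [])
    (
      #-⊎≥ (typ? c) (λ w → typ? c w ×-dec adj? G u w) (λ w → typ? c w ×-dec ¬? (adj? G u w)) proj₁ proj₁
          (λ (_ , r) (_ , ¬r) → ¬r r) ∷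
      #-∪≤ (adj? G u) (λ w → typ? c w ×-dec adj? G u w) (λ w → N? (not c) u w ⊎-dec outer? w) kinds ∷
      #-∪≤ (λ w → N? (not c) u w ⊎-dec outer? w) (N? (not c) u) outer? id ∷ opposite-few c cu ∷
      outer-count ∷ deg u ∷ 2≤k ∷
      #-mono (typ? c) (λ w → ¬? (w ∈? L (not c))) (λ t w∈ →
          [ (λ w∈′ → not-≢ c (L-disjoint w∈ w∈′)) , (λ o → outer-∉ (not c) o w∈) ]′ (Typ⊆ c t)) ∷
      eq≤ (#-∁ (_∈? L (not c))) ∷ eq≥ (#∈ (L-unique (not c))) ∷ L-big (not c) ∷ [])
    where
    kinds : ∀ {w} → Adj G u w → (Typ c w × Adj G u w) ⊎ (w ∈ L (not c) × Adj G u w) ⊎ Outer w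
    kinds {w} r with somewhere c w
    ... | inj₁ w∈ = inj₁ (L⊆Typ c w∈ , r)
    ... | inj₂ (inj₁ w∈) = inj₂ (inj₁ (w∈ , r))
    ... | inj₂ (inj₂ o) = inj₂ (inj₂ o)

  hub-outer : ∀ {v} → ¬ Typ true v → ¬ Typ false v → Outer v
  hub-outer ¬t ¬f = ¬t ∘ inj₁ , ¬f ∘ inj₁

  hub-degree : ∀ c {v} → ¬ Typ true v → ¬ Typ false v → 30 * s ≤ # (λ w → typ? c w ×-dec adj? G v w)
  hub-degree c {v} ¬t ¬f = ≤-trans (many c) (#-mono (N? c v) (λ w → typ? c w ×-dec adj? G v w) λ (w∈ , r) →
      L⊆Typ c w∈ , r)
    where
    falses : 30 * s ≤ # (N? false v)
    falses = ≮⇒≥ λ lt → ¬t (inj₂ (hub-outer ¬t ¬f , lt))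
    many : ∀ c → 30 * s ≤ # (N? c v)
    many true  = ≮⇒≥ λ lt → ¬f (inj₂ (hub-outer ¬t ¬f , falses , lt))
    many false = falses

  two-cliques : Conclusion G k ℓ
  two-cliques with # (typ? true) ≤? # (typ? false)
  ... | yes le = Clique.clique-case G k ℓ s 2≤k 4≤s k≤s ℓ≤s deg big Typ typ? typ-unique sizes missing-few crossing
        (λ c (¬t , ¬f) → hub-degree c ¬t ¬f) (≤-trans (#-mono _ outer? λ (¬t , ¬f) → hub-outer ¬t ¬f) outer-count)
            le
  ... | no ≰ = Clique.clique-case G k ℓ s 2≤k 4≤s k≤s ℓ≤s deg big (λ c → Typ (not c)) (λ c → typ? (not c))
      (λ t t′ → not-injective (typ-unique t t′))
        (λ c → sizes (not c)) (λ c → missing-few (not c)) (λ c → crossing (not c))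
        (λ c (¬f , ¬t) → hub-degree (not c) ¬t ¬f) (≤-trans (#-mono _ outer? λ (¬f , ¬t) → hub-outer ¬t ¬f)
            outer-count) (≰⇒≥ ≰)

-- The bipartite case

scale-≤ : ∀ c s p m → c * s ≤ p → c * (s * m) ≤ p * m
scale-≤ c s p m le = ≤-trans (eq≥ (*-assoc c s m)) (*-monoˡ-≤ m le)

-- `side` colours every vertex, hubs included, because the excess `m` is a count over all of them;
-- `Typ` marks the vertices that miss few of the other side. The alternative `low` is what lets the
-- greedy matching of inner edges succeed.
module Bipartite {n : ℕ} (G : Graph n) (ℓ s t m q : ℕ) (4≤s : 4 ≤ s) (ℓ≤s : ℓ ≤ s) (t≡ : 100 * s ≡ t)
    (big : 1000 * t ≤ n)
  (side : Fin n → Bool) (Typ : Bool → Fin n → Set) (typ? : ∀ c v → Dec (Typ c v))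
      (typ-side : ∀ {c v} → Typ c v → side v ≡ c)
  (excess : # (λ v → side v ≟ᵇ true) ≡ # (λ v → side v ≟ᵇ false) + m) (m≤ : m ≤ 5 * t)
  (sizes : ∀ c → n ≤ 2 * # (typ? c) + 12 * t)
  (missing : ∀ c {u} → Typ c u → # (λ w → typ? (not c) w ×-dec ¬? (adj? G u w)) ≤ q) (q≤ : 16 * q ≤ n)
  (room : ∀ u → 40 * t ≤ # (λ w → typ? (not (side u)) w ×-dec adj? G u w))
  (hub-count : # (hub? Typ typ?) ≤ 6 * t)
  (inner : ∀ u → side u ≡ true → m ≤ 2 * # (λ v → (side v ≟ᵇ true) ×-dec adj? G u v))
  (low : m ≤ 1 ⊎ (∀ u → side u ≡ true → # (λ v → (side v ≟ᵇ true) ×-dec adj? G u v) ≤ 46 * t)) where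

  private
    V = Fin n

  side? : ∀ c → Decidable (λ v → side v ≡ c)
  side? c v = side v ≟ᵇ c

  IsHub : V → Set
  IsHub = Hub Typ typ?

  isHub? : Decidable IsHub
  isHub? = hub? Typ typ?

  typ-unique : ∀ {c d v} → Typ c v → Typ d v → c ≡ d
  typ-unique cv dv = trans (sym (typ-side cv)) (typ-side dv)

  Inner : V × V → Set
  Inner (u , v) = side u ≡ true × side v ≡ true

  inner? : Decidable Inner
  inner? (u , v) = side? true u ×-dec side? true v

  module _ {i : ℕ} (i≤ℓ : i ≤ ℓ) (P : Packing {G = G} inner? i (2 * m)) where
    open Packing P

    R : Graph n
    R = remaining G cycles

    link? : Decidable (λ l → Inner l × Adj R (proj₁ l) (proj₂ l))
    link? l = inner? l ×-dec adj? R (proj₁ l) (proj₂ l)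

    linkG? = λ l → side? true (proj₁ l) ×-dec (side? true (proj₂ l) ×-dec adj? G (proj₁ l) (proj₂ l))

    link-split : ∀ {l} → l ∈ pairs n → side (proj₁ l) ≡ true × (side (proj₂ l) ≡ true × Adj G (proj₁ l) (proj₂ l)) →
            (Inner l × Adj R (proj₁ l) (proj₂ l)) ⊎ (Inner l × Used cycles (proj₁ l) (proj₂ l))
    link-split {l} _ (t , f , r) = case used? cycles (proj₁ l) (proj₂ l) of
        λ { (yes h) → inj₂ ((t , f) , h) ; (no ¬h) → inj₁ ((t , f) , r , ¬h) }

    -- At least `400t` vertices on the `true` side with `m/2` inner neighbours each give `200tm`
    -- ordered pairs, of which earlier cycles have spent at most `2mℓ ≤ tm`.
    plenty : 398 * (t * m) ≤ 2 * count link? (pairs n)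
    plenty = lin (# (side? true) * m ∷ count link? (pairs n) ∷ count linkG? (pairs n) ∷
        usage inner? cycles ∷ t * m ∷ [])
      (λ Lm x xG us tm → (400 :* tm :≤ Lm) ∷ (Lm :≤ 2 :* xG) ∷ (xG :≤ x :+ us) ∷ (us :≤ tm) ∷
        [] ⊢ 398 :* tm :≤ 2 :* x) 0 (1 ∷ 1 ∷ 2 ∷ 2 ∷ [])
      (scale-≤ 400 t (# (side? true)) m p≥ ∷
        pairs-count≥ (side? true) (λ (u , v) → side? true v ×-dec adj? G u v) 2 m inner ∷
        count-∪≤ linkG? link? (λ l → inner? l ×-dec used? cycles (proj₁ l) (proj₂ l)) (pairs n) link-split ∷
        us≤ ∷ [])
      where
      p≥ : 400 * t ≤ # (side? true)
      p≥ = lin (n ∷ t ∷ # (side? true) ∷ # (typ? true) ∷ [])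
        (λ n t p a → (a :≤ p) ∷ (n :≤ 2 :* a :+ 12 :* t) ∷ (1000 :* t :≤ n) ∷ [] ⊢ 400 :* t :≤ p) 1 (2 ∷ 1 ∷ 1 ∷ [])
        (#-mono (typ? true) (side? true) typ-side ∷ sizes true ∷ big ∷ [])
      us≤ : usage inner? cycles ≤ t * m
      us≤ = ≤-trans sparing (≤-trans (eq≥ (*-assoc i 2 m)) (*-monoˡ-≤ m
        (lin (i ∷ i * 2 ∷ ℓ ∷ s ∷ t ∷ [])
          (λ i i2 ℓ s t → (i2 :≤ 2 :* i) ∷ (i :≤ ℓ) ∷ (ℓ :≤ s) ∷ (100 :* s :≤ t) ∷ [] ⊢ i2 :≤ t) 0
              (1 ∷ 2 ∷ 2 ∷ 1 ∷ [])
          (eq≤ (*-comm i 2) ∷ i≤ℓ ∷ ℓ≤s ∷ eq≤ t≡ ∷ []))))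

    bounded : ∀ Δ → (∀ u → side u ≡ true → # (λ v → (side v ≟ᵇ true) ×-dec adj? G u v) ≤ Δ) →
        (∀ j → j < m → j * (4 * Δ) < count link? (pairs n)) →
              Matching link? m
    bounded Δ deg≤ enough = matching link? (λ (_ , r) → adj-irrefl R r) Δ out in′ m enough
      where
      out : ∀ u → # (λ v → link? (u , v)) ≤ Δ
      out u = case side? true u of λ
        { (yes t) → ≤-trans (#-mono (λ v → link? (u , v)) (λ v → (side v ≟ᵇ true) ×-dec adj? G u v)
            λ ((_ , f) , r , _) → f , r) (deg≤ u t)
        ; (no ¬t) → ≤-trans (≤-reflexive (count-none (λ v → link? (u , v)) (allFin n) λ _ ((t , _) , _) → ¬t t)) z≤n
            }
      in′ : ∀ v → # (λ u → link? (u , v)) ≤ Δ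
      in′ v = case side? true v of λ
        { (yes f) → ≤-trans (#-mono (λ u → link? (u , v)) (λ u → (side u ≟ᵇ true) ×-dec adj? G v u)
            λ ((t , _) , r , _) → t , adj-sym G r) (deg≤ v f)
        ; (no ¬f) → ≤-trans (≤-reflexive (count-none (λ u → link? (u , v)) (allFin n) λ _ ((_ , f) , _) → ¬f f)) z≤n
            }

    inner-matching : Matching link? m
    inner-matching = [ single-edge , (λ deg≤ → bounded (46 * t) deg≤ enough) ]′ low
      where
      -- Inner degrees may be of order `n` here, but at most one edge is wanted.
      single-edge : m ≤ 1 → Matching link? m
      single-edge m≤1 = bounded n (λ u _ → ≤-trans (length-filter _ (allFin n)) (≤-reflexive (length-allFin n))) λ
        { zero 0<m → (lin (t ∷ s ∷ t * m ∷ count link? (pairs n) ∷ [])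
          (λ t s tm x → (398 :* tm :≤ 2 :* x) ∷ (t :≤ tm) ∷ (100 :* s :≤ t) ∷ (con 4 :≤ s) ∷ [] ⊢ con 0 :< x) 1
              (1 ∷ 1 ∷ 1 ∷ 1 ∷ [])
          (plenty ∷ ≤-trans (eq≥ (*-identityʳ t)) (*-monoʳ-≤ t 0<m) ∷ eq≤ t≡ ∷ 4≤s ∷ []))
        ; (suc j) lt → contradiction (≤-trans lt m≤1) λ { (s≤s ()) } }
      -- The threshold `46t` for inner degrees fits because each matched edge blocks
      -- `4 · 46t = 184t` pairs, against the `199tm` available.
      enough : ∀ j → j < m → j * (4 * (46 * t)) < count link? (pairs n)
      enough j j<m = lin (t ∷ s ∷ j * (4 * (46 * t)) ∷ t * j ∷ t * m ∷ count link? (pairs n) ∷ [])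
        (λ t s b tj tm x → (398 :* tm :≤ 2 :* x) ∷ (b :≤ 184 :* tj) ∷ (t :+ tj :≤ tm) ∷ (100 :* s :≤ t) ∷
          (con 4 :≤ s) ∷ [] ⊢ b :< x) 1 (1 ∷ 2 ∷ 368 ∷ 1 ∷ 1 ∷ [])
        (plenty ∷ eq≤ (expand t j) ∷ ≤-trans (eq≥ (*-suc t j)) (*-monoʳ-≤ t j<m) ∷ eq≤ t≡ ∷ 4≤s ∷ [])
        where
        expand : ∀ t j → j * (4 * (46 * t)) ≡ 184 * (t * j)
        expand = solve-∀

    usedAt : ∀ u → # (used? cycles u) ≤ 2 * s
    usedAt = used-degree≤ i≤ℓ ℓ≤s cycles

    module Build (M : Matching link? m) where
      open Matching M using (edges; valid; size≡) renaming (unique to ends-unique)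

      Chosen : V → V → Set
      Chosen u v = (u , v) ∈ edges ⊎ (v , u) ∈ edges

      chosen? : ∀ u v → Dec (Chosen u v)
      chosen? u v = DecPair._∈?_ (u , v) edges ⊎-dec DecPair._∈?_ (v , u) edges

      -- The only inner edges of R′ are those of the matching M.
      R′ : Graph n
      R′ = record
        { Adj = λ u v → Adj R u v × (Chosen u v ⊎ ¬ Inner (u , v))
        ; adj? = λ u v → adj? R u v ×-dec (chosen? u v ⊎-dec ¬? (inner? (u , v)))
        ; sym = λ { (r , inj₁ (inj₁ l∈)) → adj-sym R r , inj₁ (inj₂ l∈)
                  ; (r , inj₁ (inj₂ l∈)) → adj-sym R r , inj₁ (inj₁ l∈)
                  ; (r , inj₂ ¬i) → adj-sym R r , inj₂ λ (i , j) → ¬i (j , i) }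
        ; irrefl = λ (r , _) → adj-irrefl R r }

      open Strands R′ Typ typ? typ-unique not not-involutive
      open Task

      -- A hub is placed between two vertices of the other side, so `c` is the opposite of its own
      -- side.
      hubTask : Bool → V → Task
      hubTask c v = record { path = stop {x = v} ; short = s≤s z≤n ; cl = c ; cr = c }

      -- The segment false-true-true-false takes the place of one `false` vertex in the alternation,
      -- so each inner edge uses up one unit of the excess.
      edgeTasks : ∀ es → All (_∈ edges) es → All (λ l → Inner l × Adj R (proj₁ l) (proj₂ l)) es → List Task
      edgeTasks [] [] [] = []
      edgeTasks ((x , y) ∷ es) (l∈ ∷ ls) ((_ , r) ∷ vs) =
          record { path = (r , inj₁ (inj₁ l∈)) ► stop ; short = ≤-refl ; cl = false ; cr = false } ∷ edgeTasks es ls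
          vs

      rightHub? : Decidable (λ v → IsHub v × side v ≡ false)
      rightHub? v = isHub? v ×-dec side? false v

      leftHub? : Decidable (λ v → (IsHub v × side v ≡ true) × v ∉ ends edges)
      leftHub? v = (isHub? v ×-dec side? true v) ×-dec ¬? (v ∈? ends edges)

      rightHubs leftHubs : List V
      rightHubs = filter rightHub? (allFin n)
      leftHubs = filter leftHub? (allFin n)

      rightHubs⁻ : ∀ {v} → v ∈ rightHubs → IsHub v × side v ≡ false
      rightHubs⁻ v∈ = proj₂ (∈-filter⁻ rightHub? {xs = allFin n} v∈)

      leftHubs⁻ : ∀ {v} → v ∈ leftHubs → (IsHub v × side v ≡ true) × v ∉ ends edges
      leftHubs⁻ v∈ = proj₂ (∈-filter⁻ leftHub? {xs = allFin n} v∈)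

      tasksL tasksM tasksS tasks : List Task
      tasksL = map (hubTask true) rightHubs
      tasksM = edgeTasks edges (All.tabulate id) valid
      tasksS = map (hubTask false) leftHubs
      tasks = tasksL ++ (tasksM ++ tasksS)

      cores-++ : ∀ ts us → cores (ts ++ us) ≡ cores ts ++ cores us
      cores-++ [] us = refl
      cores-++ (t ∷ ts) us = trans (cong (core t ++_) (cores-++ ts us))
          (sym (++-assoc (core t) (cores ts) (cores us)))

      cores-hubs : ∀ c vs → cores (map (hubTask c) vs) ≡ vs
      cores-hubs c [] = refl
      cores-hubs c (v ∷ vs) = cong (v ∷_) (cores-hubs c vs)

      cores-edges : ∀ es ls vs → cores (edgeTasks es ls vs) ≡ ends es
      cores-edges [] [] [] = refl
      cores-edges ((x , y) ∷ es) (l∈ ∷ ls) (v ∷ vs) = cong (λ us → x ∷ y ∷ us) (cores-edges es ls vs)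

      edges-length : ∀ es ls vs → length (edgeTasks es ls vs) ≡ length es
      edges-length [] [] [] = refl
      edges-length (_ ∷ es) (_ ∷ ls) (_ ∷ vs) = cong suc (edges-length es ls vs)

      cores-shape : cores tasks ≡ rightHubs ++ (ends edges ++ leftHubs)
      cores-shape = trans (cores-++ tasksL _) (cong₂ _++_ (cores-hubs true rightHubs)
          (trans (cores-++ tasksM tasksS) (cong₂ _++_ (cores-edges edges _ _) (cores-hubs false leftHubs))))

      ends-inner : ∀ {es v} → All (λ l → Inner l × Adj R (proj₁ l) (proj₂ l)) es → v ∈ ends es → side v ≡ true
      ends-inner (((x , y) , _) ∷ vs) (here refl) = x
      ends-inner (((x , y) , _) ∷ vs) (there (here refl)) = y
      ends-inner (_ ∷ vs) (there (there v∈)) = ends-inner vs v∈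

      cores-unique : Unique (cores tasks)
      cores-unique = subst Unique (sym cores-shape) (unique-++ (Uniqueₚ.filter⁺ rightHub? (Uniqueₚ.allFin⁺ n))
        (unique-++ ends-unique (Uniqueₚ.filter⁺ leftHub? (Uniqueₚ.allFin⁺ n)) λ v∈ v∈′ → proj₂ (leftHubs⁻ v∈′) v∈)
        λ v∈ v∈′ → case trans (sym (proj₂ (rightHubs⁻ v∈)))
            ([ ends-inner valid , (λ v∈″ → proj₂ (proj₁ (leftHubs⁻ v∈″))) ]′ (∈-++⁻ (ends edges) v∈′)) of λ ())

      covered : ∀ v → v ∈ cores tasks ⊎ Σ Bool λ c → Typ c v
      covered v = [ (λ h → inj₁ (subst (v ∈_) (sym cores-shape) (place h (side v) refl (v ∈? ends edges)))) , inj₂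
          ]′ (hub-or-typ Typ typ? v)
        where
        place : IsHub v → ∀ c → side v ≡ c → Dec (v ∈ ends edges) → v ∈ rightHubs ++ (ends edges ++ leftHubs)
        place h false eq _ = ∈-++⁺ˡ (∈-filter⁺ rightHub? (∈-allFin v) (h , eq))
        place h true eq (yes v∈) = ∈-++⁺ʳ rightHubs (∈-++⁺ˡ v∈)
        place h true eq (no v∉) = ∈-++⁺ʳ rightHubs (∈-++⁺ʳ (ends edges)
            (∈-filter⁺ leftHub? (∈-allFin v) ((h , eq) , v∉)))

      not-inner : ∀ {u w} → side w ≡ not (side u) → ¬ Inner (u , w)
      not-inner eq (u≡ , w≡) = case trans (sym w≡) (trans eq (cong not u≡)) of λ ()

      missing′ : ∀ c u → Typ c u → # (λ w → typ? (not c) w ×-dec ¬? (adj? R′ u w)) ≤ q + 2 * s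
      missing′ c u cu = ≤-trans (#-∪≤ (λ w → typ? (not c) w ×-dec ¬? (adj? R′ u w))
          (λ w → typ? (not c) w ×-dec ¬? (adj? G u w)) (used? cycles u) split)
        (+-mono-≤ (missing c cu) (usedAt u))
        where
        split : ∀ {w} → Typ (not c) w × ¬ Adj R′ u w → (Typ (not c) w × ¬ Adj G u w) ⊎ Used cycles u w
        split {w} (cw , ¬r) with adj? G u w | used? cycles u w
        ... | no ¬g | _ = inj₁ (cw , ¬g)
        ... | yes g | yes h = inj₂ h
        ... | yes g | no ¬h = contradiction ((g , ¬h) , inj₂
            (not-inner (trans (typ-side cw) (cong not (sym (typ-side cu)))))) ¬r

      room′ : ∀ {c} u → side u ≡ not c → 38 * t < # (roomy? c u)
      room′ {c} u eq = lin (s ∷ t ∷ # (roomy? c u) ∷ # (λ w → typ? (not (side u)) w ×-dec adj? G u w) ∷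
          # (used? cycles u) ∷ [])
        (λ s t r a h → (40 :* t :≤ a) ∷ (a :≤ r :+ h) ∷ (h :≤ 2 :* s) ∷ (100 :* s :≤ t) ∷ (con 4 :≤ s) ∷
          [] ⊢ 38 :* t :< r) 0 (1 ∷ 1 ∷ 1 ∷ 1 ∷ 1 ∷ [])
        (room u ∷ #-∪≤ (λ w → typ? (not (side u)) w ×-dec adj? G u w) (roomy? c u) (used? cycles u) split ∷
          usedAt u ∷ eq≤ t≡ ∷ 4≤s ∷ [])
        where
        split : ∀ {w} → Typ (not (side u)) w × Adj G u w → (Typ c w × Adj R′ u w) ⊎ Used cycles u w
        split {w} (cw , g) with used? cycles u w
        ... | yes h = inj₂ h
        ... | no ¬h = inj₁ (subst (λ d → Typ d w) (trans (cong not eq) (not-involutive c)) cw , (g , ¬h) , inj₂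
            (not-inner (typ-side cw)))

      Roomy : Task → Set
      Roomy t′ = 38 * t < # (roomy? (cl t′) (src t′)) × 38 * t < # (roomy? (cr t′) (dst t′))

      rooms : All Roomy tasks
      rooms = Allₚ.++⁺ (Allₚ.map⁺ (All.tabulate λ v∈ → both (room′ {true} _ (proj₂ (rightHubs⁻ v∈)))))
             (Allₚ.++⁺ (edge-rooms edges _ valid) (Allₚ.map⁺
                 (All.tabulate λ v∈ → both (room′ {false} _ (proj₂ (proj₁ (leftHubs⁻ v∈)))))))
        where
        both : ∀ {A : Set} → A → A × A
        both a = a , a
        edge-rooms : ∀ es ls vs → All Roomy (edgeTasks es ls vs)
        edge-rooms [] [] [] = []
        edge-rooms (_ ∷ es) (_ ∷ ls) (((x≡ , y≡) , _) ∷ vs) =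
            (room′ {false} _ x≡ , room′ {false} _ y≡) ∷ edge-rooms es ls vs

      lengthL : length tasksL ≡ length rightHubs
      lengthL = length-map (hubTask true) rightHubs

      lengthM : length tasksM ≡ m
      lengthM = trans (edges-length edges _ _) size≡

      lengthS : length tasksS ≡ length leftHubs
      lengthS = length-map (hubTask false) leftHubs

      hubs≤ : length rightHubs + length leftHubs ≤ 6 * t
      hubs≤ = ≤-trans (#-⊎≥ isHub? rightHub? leftHub? proj₁ (proj₁ ∘ proj₁)
          (λ (_ , f) ((_ , t) , _) → case trans (sym f) t of λ ())) hub-count

      ends≡ : length (ends edges) ≡ 2 * m
      ends≡ = trans (ends-length edges) (trans (*-comm (length edges) 2) (cong (2 *_) size≡))

      -- At most `6t` hubs and `2m` ends, and two flanks for each of at most `6t + m` tasks: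
      -- `18t + 4m`, where `m` is at most `5t`. This is why `40t` is demanded as room.
      total : length (cores tasks) + length tasks * 2 ≤ 38 * t
      total = lin (t ∷ m ∷ length (cores tasks) ∷ length tasks ∷ length tasks * 2 ∷ length rightHubs ∷
          length leftHubs ∷ length (ends edges) ∷ length (ends edges ++ leftHubs) ∷ length tasksL ∷
          length tasksM ∷ length tasksS ∷ length (tasksM ++ tasksS) ∷ [])
        (λ t m c k k2 a b e el tL tM tS tMS → (c :≤ a :+ el) ∷ (el :≤ e :+ b) ∷ (e :≤ 2 :* m) ∷
          (k2 :≤ 2 :* k) ∷ (k :≤ tL :+ tMS) ∷ (tMS :≤ tM :+ tS) ∷ (tL :≤ a) ∷ (tM :≤ m) ∷ (tS :≤ b) ∷
          (a :+ b :≤ 6 :* t) ∷ (m :≤ 5 :* t) ∷ [] ⊢ c :+ k2 :≤ 38 :* t) 0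
              (1 ∷ 1 ∷ 1 ∷ 1 ∷ 2 ∷ 2 ∷ 2 ∷ 2 ∷ 2 ∷ 3 ∷ 4 ∷ [])
        (eq≤ (trans (cong length cores-shape) (length-++ rightHubs)) ∷ eq≤ (length-++ (ends edges)) ∷
          eq≤ ends≡ ∷ eq≤ (*-comm (length tasks) 2) ∷ eq≤ (length-++ tasksL) ∷ eq≤ (length-++ tasksM) ∷
          eq≤ lengthL ∷ eq≤ lengthM ∷ eq≤ lengthS ∷ hubs≤ ∷ m≤ ∷ [])

      F : Flanked tasks (cores tasks)
      F = attach (38 * t) tasks (cores tasks) rooms total

      open Leftovers tasks F id cores-unique covered

      leftover-pos : ∀ c → 0 < length (leftover c)
      leftover-pos c = lin (n ∷ s ∷ t ∷ # (typ? c) ∷ length (used) ∷ length (leftover c) ∷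
          length (cores tasks) ∷ length tasks * 2 ∷ [])
        (λ n s t p u l a t2 → (p :≤ u :+ l) ∷ (u :≤ a :+ t2) ∷ (a :+ t2 :≤ 38 :* t) ∷
          (n :≤ 2 :* p :+ 12 :* t) ∷ (1000 :* t :≤ n) ∷ (100 :* s :≤ t) ∷ (con 4 :≤ s) ∷ [] ⊢ con 0 :< l) 364799
              (2 ∷ 2 ∷ 2 ∷ 1 ∷ 1 ∷ 912 ∷ 91200 ∷ [])
        (leftover-length c ∷ eq≤ used-length ∷ total ∷ sizes c ∷ big ∷ eq≤ t≡ ∷ 4≤s ∷ [])

      count-flank : ∀ {c ts xss} d → All (λ t → cl t ≡ c × cr t ≡ c) ts → Flank ts xss →
                    count (side? d) (concat xss) ≡ count (side? d) (cores ts) + length ts *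
                        (2 * (if does (c ≟ᵇ d) then 1 else 0))
      count-flank d [] [] = refl
      count-flank {c} {_ ∷ ts} d ((refl , refl) ∷ cs) (flank {t = t} {xss = xss} {a = a} {b = b} ca _ cb _ fs) =
        arrange (length ts) (trans (count-++ (side? d) (a ∷ core t ++ [ b ]) (concat xss))
            (cong₂ _+_ whole (count-flank d cs fs))) (count-++ (side? d) (core t) _)
        where
        δ = if does (c ≟ᵇ d) then 1 else 0
        one : ∀ {v} → Typ c v → count (side? d) [ v ] ≡ δ
        one {v} cv rewrite typ-side cv with c ≟ᵇ d
        ... | yes _ = refl
        ... | no _ = refl
        whole : count (side? d) (a ∷ core t ++ [ b ]) ≡ δ + (count (side? d) (core t) + δ)
        whole = trans (count-++ (side? d) [ a ] (core t ++ [ b ]))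
            (cong₂ _+_ (one ca) (trans (count-++ (side? d) (core t) [ b ])
            (cong (count (side? d) (core t) +_) (one cb))))
        arrange : ∀ {x y z w} k → x ≡ δ + (y + δ) + (z + k * (2 * δ)) → w ≡ y + z → x ≡ w + suc k * (2 * δ)
        arrange {y = y} {z} k p q = trans p (trans (ring δ y z k) (cong (_+ suc k * (2 * δ)) (sym q)))
          where
          ring : ∀ δ y z k → δ + (y + δ) + (z + k * (2 * δ)) ≡ y + z + suc k * (2 * δ)
          ring = solve-∀

      colouredL : All (λ t → cl t ≡ true × cr t ≡ true) tasksL
      colouredL = Allₚ.map⁺ (All.tabulate λ _ → refl , refl)

      colouredR : All (λ t → cl t ≡ false × cr t ≡ false) (tasksM ++ tasksS)
      colouredR = Allₚ.++⁺ (coloured edges _ valid) (Allₚ.map⁺ (All.tabulate λ _ → refl , refl))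
        where
        coloured : ∀ es ls vs → All (λ t → cl t ≡ false × cr t ≡ false) (edgeTasks es ls vs)
        coloured [] [] [] = []
        coloured (_ ∷ es) (_ ∷ ls) (_ ∷ vs) = (refl , refl) ∷ coloured es ls vs

      cores-false : All (λ v → side v ≡ false) (cores tasksL)
      cores-false rewrite cores-hubs true rightHubs = All.tabulate (proj₂ ∘ rightHubs⁻)

      coresR : cores (tasksM ++ tasksS) ≡ ends edges ++ leftHubs
      coresR = trans (cores-++ tasksM tasksS) (cong₂ _++_ (cores-edges edges _ _) (cores-hubs false leftHubs))

      cores-true : All (λ v → side v ≡ true) (cores (tasksM ++ tasksS))
      cores-true rewrite coresR = Allₚ.++⁺ (All.tabulate (ends-inner valid))
          (All.tabulate (proj₂ ∘ proj₁ ∘ leftHubs⁻))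

      count-other : ∀ {c d vs} → c ≢ d → All (λ v → side v ≡ c) vs → count (side? d) vs ≡ 0
      count-other {vs = vs} c≢d cs = count-none _ vs λ v∈ eq → c≢d (trans (sym (All.lookup cs v∈)) eq)

      -- Let `L`, `m` and `S` be the numbers of right hubs, inner edges and remaining left hubs. The
      -- `true` side has `|A| + 2L + S + 2m` vertices and the `false` side `|B| + L + 2S + 2m`; that
      -- these differ by `m` says precisely that there are equally many strands of either end
      -- colour.
      balanced : ∀ {xssL xssR A B} → Flank tasksL xssL → Flank (tasksM ++ tasksS) xssR → All (Typ true) A →
          All (Typ false) B →
                 concat (xssL ++ xssR) ++ A ++ B ↭ allFin n →
                     length A + length tasksL ≡ length B + length (tasksM ++ tasksS)
      balanced {xssL} {xssR} {A} {B} fsL fsR tA fB perm =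
        (lin≡ (length A ∷ length B ∷ length tasksL ∷ length (tasksM ++ tasksS) ∷ # (side? true) ∷
            # (side? false) ∷ m ∷ count (side? true) (concat xssL) ∷ count (side? false) (concat xssL) ∷
            count (side? true) (concat xssR) ∷ count (side? false) (concat xssR) ∷ count (side? true) A ∷
            count (side? false) A ∷ count (side? true) B ∷ count (side? false) B ∷
            count (side? true) (cores tasksL) ∷ count (side? false) (cores tasksL) ∷
            count (side? true) (cores (tasksM ++ tasksS)) ∷
            count (side? false) (cores (tasksM ++ tasksS)) ∷ length tasksL * 2 ∷
            length (tasksM ++ tasksS) * 2 ∷ length tasksL * 0 ∷ length (tasksM ++ tasksS) * 0 ∷
            length (cores tasksL) ∷ length (cores (tasksM ++ tasksS)) ∷ length rightHubs ∷
            length leftHubs ∷ length (ends edges) ∷ length (ends edges ++ leftHubs) ∷ length tasksM ∷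
            length tasksS ∷ [])
          (λ a b L K N1 N0 m l1 l0 r1 r0 a1 a0 b1 b0 c1 c0 d1 d0 L2 K2 L00 K00 cl0 cr1 rh lh en ll tM tS →
            (N1 :≤ N0 :+ m) ∷ (N0 :+ m :≤ N1) ∷ (N1 :≤ l1 :+ r1 :+ (a1 :+ b1)) ∷
            (l1 :+ r1 :+ (a1 :+ b1) :≤ N1) ∷ (N0 :≤ l0 :+ r0 :+ (a0 :+ b0)) ∷
            (l0 :+ r0 :+ (a0 :+ b0) :≤ N0) ∷ (a1 :≤ a) ∷ (a :≤ a1) ∷ (b0 :≤ b) ∷ (b :≤ b0) ∷
            (a0 :≤ con 0) ∷ (b1 :≤ con 0) ∷ (l1 :≤ c1 :+ L2) ∷ (c1 :+ L2 :≤ l1) ∷ (l0 :≤ c0 :+ L00) ∷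
            (c0 :+ L00 :≤ l0) ∷ (r1 :≤ d1 :+ K00) ∷ (d1 :+ K00 :≤ r1) ∷ (r0 :≤ d0 :+ K2) ∷
            (d0 :+ K2 :≤ r0) ∷ (c1 :≤ con 0) ∷ (c0 :≤ cl0) ∷ (cl0 :≤ c0) ∷ (d1 :≤ cr1) ∷ (cr1 :≤ d1) ∷
            (d0 :≤ con 0) ∷ (L2 :≤ 2 :* L) ∷ (2 :* L :≤ L2) ∷ (K2 :≤ 2 :* K) ∷ (2 :* K :≤ K2) ∷
            (L00 :≤ con 0) ∷ (K00 :≤ con 0) ∷ (cl0 :≤ rh) ∷ (rh :≤ cl0) ∷ (cr1 :≤ ll) ∷ (ll :≤ cr1) ∷
            (ll :≤ en :+ lh) ∷ (en :+ lh :≤ ll) ∷ (en :≤ 2 :* m) ∷ (2 :* m :≤ en) ∷ (K :≤ tM :+ tS) ∷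
            (tM :+ tS :≤ K) ∷ (L :≤ rh) ∷ (rh :≤ L) ∷ (tM :≤ m) ∷ (m :≤ tM) ∷ (tS :≤ lh) ∷ (lh :≤ tS) ∷
            [] ⊢ a :+ L :≤ b :+ K) 0 (1 ∷ 0 ∷ 0 ∷ 1 ∷ 1 ∷ 0 ∷ 0 ∷ 1 ∷ 1 ∷ 0 ∷ 1 ∷ 0 ∷ 0 ∷ 1 ∷ 1 ∷ 0 ∷ 0 ∷ 1 ∷ 1 ∷ 0
                ∷ 0 ∷ 1 ∷ 0 ∷ 0 ∷ 1 ∷ 1 ∷ 0 ∷ 1 ∷ 1 ∷ 0 ∷ 1 ∷ 0 ∷ 1 ∷ 0 ∷ 0 ∷ 1 ∷ 0 ∷ 1 ∷ 0 ∷ 1 ∷ 1 ∷ 0 ∷ 0 ∷ 1 ∷ 1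
                ∷ 0 ∷ 1 ∷ 0 ∷ []) 0 (0 ∷ 1 ∷ 1 ∷ 0 ∷ 0 ∷ 1 ∷ 1 ∷ 0 ∷ 0 ∷ 1 ∷ 0 ∷ 1 ∷ 1 ∷ 0 ∷ 0 ∷ 1 ∷ 1 ∷ 0 ∷ 0 ∷ 1 ∷
                1 ∷ 0 ∷ 1 ∷ 1 ∷ 0 ∷ 0 ∷ 1 ∷ 0 ∷ 0 ∷ 1 ∷ 0 ∷ 1 ∷ 0 ∷ 1 ∷ 1 ∷ 0 ∷ 1 ∷ 0 ∷ 1 ∷ 0 ∷ 0 ∷ 1 ∷ 1 ∷ 0 ∷ 0 ∷
                1 ∷ 0 ∷ 1 ∷ [])
          (eq≤ excess ∷ eq≥ excess ∷ eq≤ (split true) ∷ eq≥ (split true) ∷ eq≤ (split false) ∷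
            eq≥ (split false) ∷ eq≤ (count-all (side? true) sA) ∷ eq≥ (count-all (side? true) sA) ∷
            eq≤ (count-all (side? false) sB) ∷ eq≥ (count-all (side? false) sB) ∷
            eq≤ (count-other (λ ()) sA) ∷ eq≤ (count-other (λ ()) sB) ∷
            eq≤ (count-flank true colouredL fsL) ∷ eq≥ (count-flank true colouredL fsL) ∷
            eq≤ (count-flank false colouredL fsL) ∷ eq≥ (count-flank false colouredL fsL) ∷
            eq≤ (count-flank true colouredR fsR) ∷ eq≥ (count-flank true colouredR fsR) ∷
            eq≤ (count-flank false colouredR fsR) ∷ eq≥ (count-flank false colouredR fsR) ∷
            eq≤ (count-other (λ ()) cores-false) ∷ eq≤ (count-all (side? false) cores-false) ∷
            eq≥ (count-all (side? false) cores-false) ∷ eq≤ (count-all (side? true) cores-true) ∷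
            eq≥ (count-all (side? true) cores-true) ∷ eq≤ (count-other (λ ()) cores-true) ∷
            eq≤ (*-comm (length tasksL) 2) ∷ eq≥ (*-comm (length tasksL) 2) ∷
            eq≤ (*-comm (length (tasksM ++ tasksS)) 2) ∷ eq≥ (*-comm (length (tasksM ++ tasksS)) 2) ∷
            eq≤ (*-zeroʳ (length tasksL)) ∷ eq≤ (*-zeroʳ (length (tasksM ++ tasksS))) ∷
            eq≤ (cong length (cores-hubs true rightHubs)) ∷ eq≥ (cong length (cores-hubs true rightHubs)) ∷
            eq≤ (cong length coresR) ∷ eq≥ (cong length coresR) ∷ eq≤ (length-++ (ends edges)) ∷
            eq≥ (length-++ (ends edges)) ∷ eq≤ ends≡ ∷ eq≥ ends≡ ∷ eq≤ (length-++ tasksM) ∷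
            eq≥ (length-++ tasksM) ∷ eq≤ lengthL ∷ eq≥ lengthL ∷ eq≤ lengthM ∷ eq≥ lengthM ∷ eq≤ lengthS ∷
            eq≥ lengthS ∷ []))
        where
        split : ∀ d → # (side? d) ≡ count (side? d) (concat xssL) + count (side? d) (concat xssR) +
            (count (side? d) A + count (side? d) B)
        split d = trans (sym (count-↭ (side? d) perm)) (trans (count-++ (side? d) (concat (xssL ++ xssR)) (A ++ B))
          (cong₂ _+_ (trans (cong (count (side? d)) (sym (concat-++ xssL xssR)))
              (count-++ (side? d) (concat xssL) (concat xssR))) (count-++ (side? d) A B)))
        sA = All.map typ-side tA
        sB = All.map typ-side fB

      assemble : ∀ {segs A B} → Flank tasks segs → All (Typ true) A → All (Typ false) B → 0 < length A →
          0 < length B →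
                 concat segs ++ A ++ B ↭ allFin n → Σ (Cycle R′) λ C → n ≤ len C
      assemble {A = A} {B} fs ta@(_ ∷ tas) fb@(_ ∷ fbs) _ _ perm = from (flank-++⁻ tasksL fs) perm
        where
        from : ∀ {segs} → (∃₂ λ xssL xssR → segs ≡ xssL ++ xssR × Flank tasksL xssL × Flank (tasksM ++ tasksS) xssR)
            →
               concat segs ++ A ++ B ↭ allFin n → Σ (Cycle R′) λ C → n ≤ len C
        from (xssL , xssR , refl , fsL , fsR) perm = finish
            (interleave refl refl strandsT strandsF (cong pred lengths))
          where
          strandsT = strands-++ (singles ta) (flank-strands colouredL fsL)
          strandsF = strands-++ (singles fb) (flank-strands colouredR fsR)
          lengths : length (map [_] A ++ xssL) ≡ length (map [_] B ++ xssR)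
          lengths = trans (length-++ (map [_] A)) (trans (cong₂ _+_ (length-map [_] A) (flank-length fsL))
            (trans (balanced fsL fsR ta fb perm) (sym
                (trans (length-++ (map [_] B)) (cong₂ _+_ (length-map [_] B) (flank-length fsR))))))
          flatten : ∀ vs xss → concat (map [_] vs ++ xss) ≡ vs ++ concat xss
          flatten vs xss = trans (sym (concat-++ (map [_] vs) xss)) (cong (_++ concat xss) (concat-singles vs))
          shuffle : (A ++ concat xssL) ++ (B ++ concat xssR) ↭ (concat xssL ++ concat xssR) ++ (A ++ B)
          shuffle = solve 4 (λ a x b y → (a ⊕ x) ⊕ (b ⊕ y) ⊜ (x ⊕ y) ⊕ (a ⊕ b)) ↭-refl A (concat xssL) B
              (concat xssR)
            where open CMSolver (++-commutativeMonoid {A = V})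
          dense : ∀ c → length tasksL * 4 + length (tasksM ++ tasksS) * 4 + (2 * (q + 2 * s) + 2) ≤ # (typ? c)
          dense c = lin (n ∷ s ∷ t ∷ q ∷ m ∷ # (typ? c) ∷ length rightHubs ∷ length leftHubs ∷
              length tasksL ∷ length tasksM ∷ length tasksS ∷ length (tasksM ++ tasksS) ∷
              length tasksL * 4 ∷ length (tasksM ++ tasksS) * 4 ∷ [])
            (λ n s t q m p a b tL tM tS tMS L4 K4 → (L4 :≤ 4 :* tL) ∷ (K4 :≤ 4 :* tMS) ∷
              (tMS :≤ tM :+ tS) ∷ (tL :≤ a) ∷ (tM :≤ m) ∷ (tS :≤ b) ∷ (a :+ b :≤ 6 :* t) ∷ (m :≤ 5 :* t) ∷
              (16 :* q :≤ n) ∷ (n :≤ 2 :* p :+ 12 :* t) ∷ (1000 :* t :≤ n) ∷ (100 :* s :≤ t) ∷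
              (con 4 :≤ s) ∷ [] ⊢ L4 :+ K4 :+ (2 :* (q :+ 2 :* s) :+ con 2) :≤ p) 5
                  (6 ∷ 6 ∷ 24 ∷ 24 ∷ 24 ∷ 24 ∷ 24 ∷ 24 ∷ 1 ∷ 2 ∷ 1 ∷ 1 ∷ 3 ∷ [])
            (eq≤ (*-comm (length tasksL) 4) ∷ eq≤ (*-comm (length (tasksM ++ tasksS)) 4) ∷
              eq≤ (length-++ tasksM) ∷ eq≤ lengthL ∷ eq≤ lengthM ∷ eq≤ lengthS ∷ hubs≤ ∷ m≤ ∷ q≤ ∷
              sizes c ∷ big ∷ eq≤ t≡ ∷ 4≤s ∷ [])
          finish : (∃ λ zs → Strand true false (length tasksL * 4 + length (tasksM ++ tasksS) * 4) zs × zs ↭ concat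
              (map [_] A ++ xssL) ++ concat (map [_] B ++ xssR)) →
                   Σ (Cycle R′) λ C → n ≤ len C
          finish (zs , zs-strand , p) = close-up {true} {false} {length tasksL * 4 + length (tasksM ++ tasksS) * 4}
              {zs} zs-strand refl spans (q + 2 * s) dense missing′
            where
            flat : concat (map [_] A ++ xssL) ++ concat (map [_] B ++ xssR) ≡ (A ++ concat xssL) ++
                (B ++ concat xssR)
            flat = cong₂ _++_ (flatten A xssL) (flatten B xssR)
            joined : (concat xssL ++ concat xssR) ++ (A ++ B) ≡ concat (xssL ++ xssR) ++ (A ++ B)
            joined = cong (_++ (A ++ B)) (concat-++ xssL xssR)
            spans : zs ↭ allFin n
            spans = ↭-trans p (↭-trans (↭-reflexive flat) (↭-trans shuffle (↭-trans (↭-reflexive joined) perm)))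

      cycle : Σ (Cycle R′) λ C → n ≤ len C
      cycle = assemble (Flanked.flanks F) (leftover-typ true) (leftover-typ false)
        (leftover-pos true) (leftover-pos false) (spanning)

      3≤n : 3 ≤ n
      3≤n = lin (n ∷ s ∷ t ∷ [])
        (λ n s t → (1000 :* t :≤ n) ∷ (100 :* s :≤ t) ∷ (con 4 :≤ s) ∷ [] ⊢ con 3 :≤ n) 0 (1 ∷ 1 ∷ 1 ∷ [])
        (big ∷ eq≤ t≡ ∷ 4≤s ∷ [])

      restrain : HamCycle R′ → Σ (HamCycle R) λ C → count (λ l → inner? l ×-dec hamEdge? C (proj₁ l) (proj₂ l))
          (pairs n) ≤ 2 * m
      restrain H = widen proj₁ H , ≤-trans (pairs-count≤length _ (edges ++ map flip′ edges) λ (c , h) →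
          in-chosen c (hamEdge-adj H h))
        (≤-reflexive (trans (length-++ edges) (cong₂ _+_ size≡
            (trans (length-map flip′ edges) (trans size≡ (sym (+-identityʳ m)))))))
        where
        flip′ : V × V → V × V
        flip′ (u , v) = v , u
        in-chosen : ∀ {l} → Inner l → Adj R′ (proj₁ l) (proj₂ l) → l ∈ edges ++ map flip′ edges
        in-chosen c (_ , inj₁ (inj₁ l∈)) = ∈-++⁺ˡ l∈
        in-chosen c (_ , inj₁ (inj₂ l∈)) = ∈-++⁺ʳ edges (∈-map⁺ flip′ l∈)
        in-chosen c (_ , inj₂ ¬c) = contradiction c ¬c

      sparing-cycle : Σ (HamCycle R) λ C → count (λ l → inner? l ×-dec hamEdge? C (proj₁ l) (proj₂ l)) (pairs n) ≤ 2
          * m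
      sparing-cycle = restrain (toHamCycle 3≤n (proj₁ cycle) (proj₂ cycle))

    next-cycle : Σ (HamCycle R) λ C → count (λ l → inner? l ×-dec hamEdge? C (proj₁ l) (proj₂ l)) (pairs n) ≤ 2 * m
    next-cycle = from inner-matching
      where
      from : Matching link? m → Σ (HamCycle R) λ C → count (λ l → inner? l ×-dec hamEdge? C (proj₁ l) (proj₂ l))
          (pairs n) ≤ 2 * m
      from M = Build.sparing-cycle M

  bipartite-packing : Σ (Fin ℓ → HamCycle G) EdgeDisjoint
  bipartite-packing = from (packing {G = G} inner? {X = ⊥} ℓ (2 * m) λ j j<ℓ P → inj₂ (next-cycle (<⇒≤ j<ℓ) P))
    where
    from : ⊥ ⊎ Packing {G = G} inner? ℓ (2 * m) → Σ (Fin ℓ → HamCycle G) EdgeDisjoint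
    from (inj₂ P) = Packing.cycles P , Packing.disjoint P

take-⊆ : ∀ {A : Set} {x : A} k xs → x ∈ take k xs → x ∈ xs
take-⊆ (suc k) (y ∷ xs) (here eq) = here eq
take-⊆ (suc k) (y ∷ xs) (there x∈) = there (take-⊆ k xs x∈)

sides : ∀ {n} (f : Fin n → Bool) → # (λ v → f v ≟ᵇ true) + # (λ v → f v ≟ᵇ false) ≡ n
sides f = trans (cong (# (λ v → f v ≟ᵇ true) +_) (#-cong (λ v → f v ≟ᵇ false) (λ v → ¬? (f v ≟ᵇ true))
    (λ eq eq′ → case trans (sym eq) eq′ of λ ()) λ {v} ≢ → not-true (f v) ≢)) (#-∁ (λ v → f v ≟ᵇ true))
  where
  not-true : ∀ b → b ≢ true → b ≡ false
  not-true true ≢ = contradiction refl ≢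
  not-true false ≢ = refl

-- Moving a vertex of large inner degree to the smaller side lowers the excess by 2; this is repeated
-- until the excess is at most 1 or all inner degrees are small.
module Rebalance {n : ℕ} (G : Graph n) (ℓ s t q m₀ : ℕ) (4≤s : 4 ≤ s) (ℓ≤s : ℓ ≤ s) (t≡ : 100 * s ≡ t)
    (big : 1000 * t ≤ n)
  (dense : ∀ v → n ≤ 2 * degree G v)
  (side₀ : Fin n → Bool) (Typ₀ : Bool → Fin n → Set) (typ₀? : ∀ c v → Dec (Typ₀ c v))
      (typ₀-side : ∀ {c v} → Typ₀ c v → side₀ v ≡ c)
  (excess₀ : # (λ v → side₀ v ≟ᵇ true) ≡ # (λ v → side₀ v ≟ᵇ false) + m₀) (m₀≤ : m₀ ≤ 5 * t)
  (sizes₀ : ∀ c → n ≤ 2 * # (typ₀? c) + 5 * t)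
  (missing₀ : ∀ c {u} → Typ₀ c u → # (λ w → typ₀? (not c) w ×-dec ¬? (adj? G u w)) ≤ q) (q≤ : 16 * q ≤ n)
  (room₀ : ∀ u → 43 * t ≤ # (λ w → typ₀? (not (side₀ u)) w ×-dec adj? G u w))
  (hub-count₀ : # (hub? Typ₀ typ₀?) ≤ 3 * t) where

  private
    V = Fin n

  inside₀? : ∀ u → Decidable (λ v → side₀ v ≡ true × Adj G u v)
  inside₀? u v = (side₀ v ≟ᵇ true) ×-dec adj? G u v

  High : V → Set
  High u = side₀ u ≡ true × 46 * t < # (inside₀? u)

  high? : Decidable High
  high? u = (side₀ u ≟ᵇ true) ×-dec (46 * t <? # (inside₀? u))

  record Transfer : Set where
    field
      moved        : List V
      m        : ℕ
      moved-unique : Unique moved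
      moved-high   : ∀ {v} → v ∈ moved → High v
      m₀≡   : m₀ ≡ 2 * length moved + m
      complete : m ≤ 1 ⊎ (∀ {v} → High v → v ∈ moved)

  highs : List V
  highs = filter high? (allFin n)

  highs⁻ : ∀ {v} → v ∈ highs → High v
  highs⁻ v∈ = proj₂ (∈-filter⁻ high? {xs = allFin n} v∈)

  highs-unique : Unique highs
  highs-unique = Uniqueₚ.filter⁺ high? (Uniqueₚ.allFin⁺ n)

  transfer : Transfer
  transfer with 2 * length highs ≤? m₀
  ... | yes le = let (m , eq) = m≤n⇒∃[o]m+o≡n le in record
    { moved = highs ; m = m ; moved-unique = highs-unique ; moved-high = highs⁻ ; m₀≡ = sym eq ; complete =
        inj₂ λ h → ∈-filter⁺ high? (∈-allFin _) h }
  -- More high vertices than can be moved: half of the excess many of them bring it down to its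
  -- parity, so that at most one inner edge is wanted.
  ... | no ≰ = record
    { moved = take (m₀ / 2) highs ; m = m₀ % 2 ; moved-unique = Uniqueₚ.take⁺ (m₀ / 2) highs-unique ; moved-high =
        highs⁻ ∘ take-⊆ (m₀ / 2) highs
    ; m₀≡ = trans (m≡m%n+[m/n]*n m₀ 2) (trans (+-comm (m₀ % 2) _)
        (cong (_+ m₀ % 2) (trans (*-comm (m₀ / 2) 2) (cong (2 *_) (sym lengthT)))))
    ; complete = inj₁ (≤-pred (m%n<n m₀ 2)) }
    where
    lengthT : length (take (m₀ / 2) highs) ≡ m₀ / 2
    lengthT = trans (length-take (m₀ / 2) highs) (m≤n⇒m⊓n≡m (lin (m₀ / 2 ∷ length highs ∷ m₀ ∷ m₀ % 2 ∷
        m₀ / 2 * 2 ∷ [])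
      (λ h l m₀ r h2 → (m₀ :< 2 :* l) ∷ (r :+ h2 :≤ m₀) ∷ (2 :* h :≤ h2) ∷ [] ⊢ h :≤ l) 1 (1 ∷ 1 ∷ 1 ∷ [])
      (≰⇒> ≰ ∷ eq≥ (m≡m%n+[m/n]*n m₀ 2) ∷ eq≥ (*-comm (m₀ / 2) 2) ∷ [])))

  module Moved (X : Transfer) where
    open Transfer X

    side : V → Bool
    side v = if does (v ∈? moved) then false else side₀ v

    side-∉ : ∀ {v} → v ∉ moved → side v ≡ side₀ v
    side-∉ {v} v∉ with v ∈? moved
    ... | yes v∈ = contradiction v∈ v∉
    ... | no _ = refl

    side-true : ∀ {v} → side v ≡ true → side₀ v ≡ true × v ∉ moved
    side-true {v} eq with v ∈? moved
    side-true {v} () | yes _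
    side-true {v} eq | no v∉ = eq , v∉

    -- A moved vertex loses its type: it may miss many vertices of the side that is now opposite, so
    -- it is treated as a hub from here on.
    Typ : Bool → V → Set
    Typ c v = Typ₀ c v × v ∉ moved

    typ? : ∀ c v → Dec (Typ c v)
    typ? c v = typ₀? c v ×-dec ¬? (v ∈? moved)

    #moved : # (_∈? moved) ≡ length moved
    #moved = #∈ moved-unique

    moved≤ : 2 * length moved ≤ 5 * t
    moved≤ = lin (length moved ∷ m ∷ m₀ ∷ t ∷ [])
      (λ l m m₀ t → (2 :* l :+ m :≤ m₀) ∷ (m₀ :≤ 5 :* t) ∷ [] ⊢ 2 :* l :≤ 5 :* t) 0 (1 ∷ 1 ∷ [])
      (eq≥ m₀≡ ∷ m₀≤ ∷ [])

    excess : # (λ v → side v ≟ᵇ true) ≡ # (λ v → side v ≟ᵇ false) + m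
    excess = lin≡ (length moved ∷ m ∷ m₀ ∷ n ∷ # (_∈? moved) ∷ # (λ v → side v ≟ᵇ true) ∷
        # (λ v → side v ≟ᵇ false) ∷ # (λ v → side₀ v ≟ᵇ true) ∷ # (λ v → side₀ v ≟ᵇ false) ∷ [])
      (λ l m m₀ n e x y x₀ y₀ → (m₀ :≤ 2 :* l :+ m) ∷ (2 :* l :+ m :≤ m₀) ∷ (x₀ :≤ y₀ :+ m₀) ∷
        (y₀ :+ m₀ :≤ x₀) ∷ (x :+ y :≤ n) ∷ (n :≤ x :+ y) ∷ (x₀ :+ y₀ :≤ n) ∷ (n :≤ x₀ :+ y₀) ∷ (e :≤ l) ∷
        (l :≤ e) ∷ (x :+ e :≤ x₀) ∷ (x₀ :≤ x :+ e) ∷ [] ⊢ x :≤ y :+ m) 0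
            (1 ∷ 0 ∷ 1 ∷ 0 ∷ 0 ∷ 1 ∷ 1 ∷ 0 ∷ 0 ∷ 2 ∷ 2 ∷ 0 ∷ []) 0
            (0 ∷ 1 ∷ 0 ∷ 1 ∷ 1 ∷ 0 ∷ 0 ∷ 1 ∷ 2 ∷ 0 ∷ 0 ∷ 2 ∷ [])
      (eq≤ m₀≡ ∷ eq≥ m₀≡ ∷ eq≤ excess₀ ∷ eq≥ excess₀ ∷ eq≤ (sides side) ∷ eq≥ (sides side) ∷
        eq≤ (sides side₀) ∷ eq≥ (sides side₀) ∷ eq≤ #moved ∷ eq≥ #moved ∷
        #-⊎≥ (λ v → side₀ v ≟ᵇ true) (λ v → side v ≟ᵇ true) (_∈? moved) (proj₁ ∘ side-true) (proj₁ ∘ moved-high)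
            (proj₂ ∘ side-true) ∷
        #-∪≤ (λ v → side₀ v ≟ᵇ true) (λ v → side v ≟ᵇ true) (_∈? moved)
            (λ {v} eq → case v ∈? moved of λ { (yes v∈) → inj₂ v∈ ; (no v∉) → inj₁ (trans (side-∉ v∉) eq) }) ∷
        [])

    keep : ∀ c → # (typ₀? c) ≤ # (typ? c) + # (_∈? moved)
    keep c = #-∪≤ (typ₀? c) (typ? c) (_∈? moved) λ {v} cv →
        case v ∈? moved of λ { (yes v∈) → inj₂ v∈ ; (no v∉) → inj₁ (cv , v∉) }

    sizes : ∀ c → n ≤ 2 * # (typ? c) + 12 * t
    sizes c = lin (n ∷ t ∷ # (typ? c) ∷ # (typ₀? c) ∷ # (_∈? moved) ∷ length moved ∷ [])
      (λ n t p p₀ e l → (n :≤ 2 :* p₀ :+ 5 :* t) ∷ (p₀ :≤ p :+ e) ∷ (e :≤ l) ∷ (2 :* l :≤ 5 :* t) ∷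
        [] ⊢ n :≤ 2 :* p :+ 12 :* t) 0 (1 ∷ 2 ∷ 2 ∷ 1 ∷ [])
      (sizes₀ c ∷ keep c ∷ eq≤ #moved ∷ moved≤ ∷ [])

    -- An unmoved vertex loses at most `5t/2` of its `43t` typical neighbours to `moved`. A moved
    -- one had more than `46t` neighbours on the old `true` side, of which at most `3t` are hubs and
    -- `5t/2` moved.
    room : ∀ u → 40 * t ≤ # (λ w → typ? (not (side u)) w ×-dec adj? G u w)
    room u with u ∈? moved
    ... | no u∉ = lin (t ∷ # (λ w → typ? (not (side₀ u)) w ×-dec adj? G u w) ∷
        # (λ w → typ₀? (not (side₀ u)) w ×-dec adj? G u w) ∷ # (_∈? moved) ∷ length moved ∷ [])
      (λ t a b e l → (43 :* t :≤ b) ∷ (b :≤ a :+ e) ∷ (e :≤ l) ∷ (2 :* l :≤ 5 :* t) ∷ [] ⊢ 40 :* t :≤ a) 1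
          (2 ∷ 2 ∷ 2 ∷ 1 ∷ [])
      (room₀ u ∷
        #-∪≤ (λ w → typ₀? (not (side₀ u)) w ×-dec adj? G u w) (λ w → typ? (not (side₀ u)) w ×-dec adj? G u w)
            (_∈? moved) (λ {w} (cw , r) → case w ∈? moved of
            λ { (yes w∈) → inj₂ w∈ ; (no w∉) → inj₁ ((cw , w∉) , r) }) ∷
        eq≤ #moved ∷ moved≤ ∷ [])
    ... | yes u∈ = lin (t ∷ # (λ w → typ? true w ×-dec adj? G u w) ∷ # (inside₀? u) ∷
        # (hub? Typ₀ typ₀?) ∷ # (_∈? moved) ∷ length moved ∷
        # (λ w → hub? Typ₀ typ₀? w ⊎-dec (w ∈? moved)) ∷ [])
      (λ t a b h e l r → (46 :* t :< b) ∷ (b :≤ a :+ r) ∷ (r :≤ h :+ e) ∷ (h :≤ 3 :* t) ∷ (e :≤ l) ∷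
        (2 :* l :≤ 5 :* t) ∷ [] ⊢ 40 :* t :≤ a) 1 (2 ∷ 2 ∷ 2 ∷ 2 ∷ 2 ∷ 1 ∷ [])
      (proj₂ (moved-high u∈) ∷
        #-∪≤ (inside₀? u) (λ w → typ? true w ×-dec adj? G u w) (λ w → hub? Typ₀ typ₀? w ⊎-dec (w ∈? moved)) split ∷
        #-∪≤ (λ w → hub? Typ₀ typ₀? w ⊎-dec (w ∈? moved)) (hub? Typ₀ typ₀?) (_∈? moved) id ∷ hub-count₀ ∷
        eq≤ #moved ∷ moved≤ ∷ [])
      where
      split : ∀ {w} → side₀ w ≡ true × Adj G u w → (Typ true w × Adj G u w) ⊎ Hub Typ₀ typ₀? w ⊎ w ∈ moved
      split {w} (eq , r) with w ∈? moved | hub-or-typ Typ₀ typ₀? w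
      ... | yes w∈ | _ = inj₂ (inj₂ w∈)
      ... | no _ | inj₁ h = inj₂ (inj₁ h)
      ... | no w∉ | inj₂ (true , tw) = inj₁ ((tw , w∉) , r)
      ... | no w∉ | inj₂ (false , fw) = case trans (sym eq) (typ₀-side fw) of λ ()

    hub-count : # (hub? Typ typ?) ≤ 6 * t
    hub-count = lin (t ∷ # (hub? Typ typ?) ∷ # (hub? Typ₀ typ₀?) ∷ # (_∈? moved) ∷ length moved ∷ [])
      (λ t h h₀ e l → (h :≤ h₀ :+ e) ∷ (h₀ :≤ 3 :* t) ∷ (e :≤ l) ∷ (2 :* l :≤ 5 :* t) ∷ [] ⊢ h :≤ 6 :* t) 1
          (2 ∷ 2 ∷ 2 ∷ 1 ∷ [])
      (
        #-∪≤ (hub? Typ typ?) (hub? Typ₀ typ₀?) (_∈? moved)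
            (λ {v} (¬t , ¬f) → case v ∈? moved of λ { (yes v∈) → inj₂ v∈ ; (no v∉) →
            inj₁ ((λ t → ¬t (t , v∉)) , (λ f → ¬f (f , v∉))) }) ∷
        hub-count₀ ∷ eq≤ #moved ∷ moved≤ ∷ [])

    inside? : ∀ u → Decidable (λ v → side v ≡ true × Adj G u v)
    inside? u v = (side v ≟ᵇ true) ×-dec adj? G u v

    -- A vertex has at least `n/2` neighbours, and the smaller side offers only `(n − m)/2` of them.
    inner : ∀ u → side u ≡ true → m ≤ 2 * # (inside? u)
    inner u eq = lin (n ∷ m ∷ degree G u ∷ # (inside? u) ∷ # (λ v → side v ≟ᵇ true) ∷
        # (λ v → side v ≟ᵇ false) ∷ [])
      (λ n m d i x y → (n :≤ 2 :* d) ∷ (d :≤ i :+ y) ∷ (y :+ m :≤ x) ∷ (x :+ y :≤ n) ∷ [] ⊢ m :≤ 2 :* i) 0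
          (1 ∷ 2 ∷ 1 ∷ 1 ∷ [])
      (dense u ∷ #-∪≤ (adj? G u) (inside? u) (λ v → side v ≟ᵇ false) (λ {v} r → which (side v) refl r) ∷
        eq≥ excess ∷ eq≤ (sides side) ∷ [])
      where
      which : ∀ {v} c → side v ≡ c → Adj G u v → (side v ≡ true × Adj G u v) ⊎ side v ≡ false
      which true eq r = inj₁ (eq , r)
      which false eq r = inj₂ eq

    low : m ≤ 1 ⊎ (∀ u → side u ≡ true → # (inside? u) ≤ 46 * t)
    low = [ inj₁ , (λ all → inj₂ λ u eq → ≤-trans (#-mono (inside? u) (inside₀? u) λ (w , r) →
        proj₁ (side-true w) , r)
      (≮⇒≥ λ lt → proj₂ (side-true eq) (all (proj₁ (side-true eq) , lt)))) ]′ complete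

    m≤ : m ≤ 5 * t
    m≤ = lin (length moved ∷ m ∷ m₀ ∷ t ∷ [])
      (λ l m m₀ t → (2 :* l :+ m :≤ m₀) ∷ (m₀ :≤ 5 :* t) ∷ [] ⊢ m :≤ 5 :* t) 0 (1 ∷ 1 ∷ [])
      (eq≥ m₀≡ ∷ m₀≤ ∷ [])

    packed : Σ (Fin ℓ → HamCycle G) EdgeDisjoint
    packed = Bipartite.bipartite-packing G ℓ s t m q 4≤s ℓ≤s t≡ big side Typ typ?
        (λ (cv , v∉) → trans (side-∉ v∉) (typ₀-side cv)) excess m≤ sizes
      (λ c {u} (cu , _) → ≤-trans (#-mono (λ w → typ? (not c) w ×-dec ¬? (adj? G u w))
          (λ w → typ₀? (not c) w ×-dec ¬? (adj? G u w)) λ ((cw , _) , ¬r) → cw , ¬r) (missing₀ c cu))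
      q≤ room hub-count inner low

  rebalanced : Σ (Fin ℓ → HamCycle G) EdgeDisjoint
  rebalanced = Moved.packed transfer

-- From a large independent set to a bipartition

module NearBipartite {n : ℕ} (G : Graph n) (ℓ s t : ℕ) (4≤s : 4 ≤ s) (ℓ≤s : ℓ ≤ s) (t≡ : 100 * s ≡ t)
    (big : 1000 * t ≤ n)
  (dense : ∀ v → n ≤ 2 * degree G v)
  (I : List (Fin n)) (I-unique : Unique I) (few : ∀ {x} → x ∈ I → # (λ y → (y ∈? I) ×-dec adj? G x y) ≤ 2 * s)
      (bigI : n ≤ 2 * length I + 22 * s) where

  private
    V = Fin n

  -- The tolerance for typical vertices outside `I` is a fraction of `n` and not `O(s)`: against a
  -- threshold of order `n`, double counting leaves only `O(s)` bad vertices, and switching still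
  -- has enough room with `n/16` missing neighbours.
  q : ℕ
  q = n / 16

  n≤ : n ≤ 16 * q + 15
  n≤ = lin (n ∷ n % 16 ∷ n / 16 * 16 ∷ n / 16 ∷ [])
    (λ n r q16 q → (n :≤ r :+ q16) ∷ (q16 :≤ 16 :* q) ∷ (r :< con 16) ∷ [] ⊢ n :≤ 16 :* q :+ con 15) 0
        (1 ∷ 1 ∷ 1 ∷ [])
    (eq≤ (m≡m%n+[m/n]*n n 16) ∷ eq≤ (*-comm (n / 16) 16) ∷ m%n<n n 16 ∷ [])

  q≤ : 16 * q ≤ n
  q≤ = lin (n ∷ n % 16 ∷ n / 16 * 16 ∷ n / 16 ∷ [])
    (λ n r q16 q → (r :+ q16 :≤ n) ∷ (16 :* q :≤ q16) ∷ [] ⊢ 16 :* q :≤ n) 0 (1 ∷ 1 ∷ [])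
    (eq≥ (m≡m%n+[m/n]*n n 16) ∷ eq≥ (*-comm (n / 16) 16) ∷ [])

  outside? : Decidable (_∉ I)
  outside? v = ¬? (v ∈? I)

  missJ? : ∀ u → Decidable (λ v → v ∉ I × ¬ Adj G u v)
  missJ? u v = outside? v ×-dec ¬? (adj? G u v)

  missI? : ∀ v → Decidable (λ u → u ∈ I × ¬ Adj G v u)
  missI? v u = (u ∈? I) ×-dec ¬? (adj? G v u)

  #I : # (_∈? I) ≡ length I
  #I = #∈ I-unique

  I+J : length I + # outside? ≡ n
  I+J = trans (cong (_+ # outside?) (sym #I)) (#-∁ (_∈? I))

  degreeJ : ∀ {u} → u ∈ I → n ≤ 2 * # (λ v → outside? v ×-dec adj? G u v) + 4 * s
  degreeJ {u} u∈ = lin (n ∷ s ∷ degree G u ∷ # (λ v → (v ∈? I) ×-dec adj? G u v) ∷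
      # (λ v → outside? v ×-dec adj? G u v) ∷ [])
    (λ n s d a b → (n :≤ 2 :* d) ∷ (a :≤ 2 :* s) ∷ (d :≤ a :+ b) ∷ [] ⊢ n :≤ 2 :* b :+ 4 :* s) 0 (1 ∷ 2 ∷ 2 ∷ [])
    (dense u ∷ few u∈ ∷
      #-∪≤ (adj? G u) (λ v → (v ∈? I) ×-dec adj? G u v) (λ v → outside? v ×-dec adj? G u v)
          (λ {v} r → case v ∈? I of λ { (yes v∈) → inj₁ (v∈ , r) ; (no v∉) → inj₂ (v∉ , r) }) ∷
      [])

  -- The complement of `I` has at most `n/2 + 11s` vertices and contains at least `n/2 − 2s`
  -- neighbours of `u`.
  missJ≤ : ∀ {u} → u ∈ I → # (missJ? u) ≤ 13 * s
  missJ≤ {u} u∈ = lin (n ∷ s ∷ # (missJ? u) ∷ # (λ v → outside? v ×-dec adj? G u v) ∷ # outside? ∷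
      length I ∷ [])
    (λ n s m b j a → (n :≤ 2 :* b :+ 4 :* s) ∷ (b :+ m :≤ j) ∷ (a :+ j :≤ n) ∷ (n :≤ 2 :* a :+ 22 :* s) ∷
      [] ⊢ m :≤ 13 :* s) 1 (1 ∷ 2 ∷ 2 ∷ 1 ∷ [])
    (degreeJ u∈ ∷
      #-⊎≥ outside? (λ v → outside? v ×-dec adj? G u v) (missJ? u) proj₁ proj₁ (λ (_ , r) (_ , ¬r) → ¬r r) ∷
      eq≤ I+J ∷ bigI ∷ [])

  J-big : n ≤ 2 * # outside? + 4 * s
  J-big with count>0⇒∃ (_∈? I) (allFin n) (lin (n ∷ s ∷ t ∷ length I ∷ # (_∈? I) ∷ [])
    (λ n s t a a′ → (a :≤ a′) ∷ (n :≤ 2 :* a :+ 22 :* s) ∷ (1000 :* t :≤ n) ∷ (100 :* s :≤ t) ∷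
      (con 4 :≤ s) ∷ [] ⊢ con 0 :< a′) 399911 (2 ∷ 1 ∷ 1 ∷ 1000 ∷ 99978 ∷ [])
    (eq≥ #I ∷ bigI ∷ big ∷ eq≤ t≡ ∷ 4≤s ∷ []))
  ... | u , _ , u∈ = lin (n ∷ s ∷ # (λ v → outside? v ×-dec adj? G u v) ∷ # outside? ∷ [])
    (λ n s b j → (n :≤ 2 :* b :+ 4 :* s) ∷ (b :≤ j) ∷ [] ⊢ n :≤ 2 :* j :+ 4 :* s) 0 (1 ∷ 2 ∷ [])
    (degreeJ u∈ ∷ #-mono (λ v → outside? v ×-dec adj? G u v) outside? proj₁ ∷ [])

  Bad : V → Set
  Bad v = v ∉ I × q ≤ # (missI? v)

  bad? : Decidable Bad
  bad? v = outside? v ×-dec (q ≤? # (missI? v))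

  -- By double counting the non-edges between I and its complement.
  bad-count : # bad? ≤ 221 * s
  bad-count = *-cancelʳ-≤ (# bad?) (221 * s) q {{>-nonZero q>0}} (begin
    # bad? * q                    ≤⟨ pairs-count≥ bad? (λ (v , u) → missI? v u) 1 q
        (λ v (_ , le) → ≤-trans le (eq≥ (*-identityˡ _))) ⟩
    1 * count rows? (pairs n)     ≡⟨ *-identityˡ _ ⟩
    count rows? (pairs n)         ≤⟨ pairs-swap rows? columns? (λ ((v∉ , _) , u∈ , ¬r) → u∈ , v∉ , ¬r ∘ adj-sym G) ⟩
    count columns? (pairs n)      ≤⟨ pairs-count≤ (_∈? I) (λ (u , v) → missJ? u v) (13 * s) (λ u → missJ≤) ⟩
    # (_∈? I) * (13 * s)          ≤⟨ *-monoˡ-≤ (13 * s)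
        (≤-trans (length-filter (_∈? I) (allFin n)) (≤-trans (≤-reflexive (length-allFin n)) n≤17q)) ⟩
    17 * q * (13 * s)             ≡⟨ rearrange q s ⟩
    221 * s * q                   ∎)
    where
    open ≤-Reasoning
    rows? = λ l → bad? (proj₁ l) ×-dec missI? (proj₁ l) (proj₂ l)
    columns? = λ l → (proj₁ l ∈? I) ×-dec missJ? (proj₁ l) (proj₂ l)
    n≤17q : n ≤ 17 * q
    n≤17q = lin (n ∷ s ∷ t ∷ q ∷ [])
      (λ n s t q → (n :≤ 16 :* q :+ con 15) ∷ (1000 :* t :≤ n) ∷ (100 :* s :≤ t) ∷ (con 4 :≤ s) ∷
        [] ⊢ n :≤ 17 :* q) 15 (17 ∷ 1 ∷ 1 ∷ 61 ∷ [])
      (n≤ ∷ big ∷ eq≤ t≡ ∷ 4≤s ∷ [])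
    q>0 : 0 < q
    q>0 = lin (n ∷ s ∷ t ∷ q ∷ [])
      (λ n s t q → (n :≤ 16 :* q :+ con 15) ∷ (1000 :* t :≤ n) ∷ (100 :* s :≤ t) ∷ (con 4 :≤ s) ∷
        [] ⊢ con 0 :< q) 15 (1 ∷ 1 ∷ 1 ∷ 5 ∷ [])
      (n≤ ∷ big ∷ eq≤ t≡ ∷ 4≤s ∷ [])
    rearrange : ∀ q s → 17 * q * (13 * s) ≡ 221 * s * q
    rearrange = solve-∀

  Typ : Bool → V → Set
  Typ true  v = v ∈ I
  Typ false v = v ∉ I × # (missI? v) < q

  typ? : ∀ c v → Dec (Typ c v)
  typ? true  v = v ∈? I
  typ? false v = outside? v ×-dec (# (missI? v) <? q)

  nbrs? : ∀ c u → Decidable (λ w → Typ c w × Adj G u w)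
  nbrs? c u w = typ? c w ×-dec adj? G u w

  -- A bad vertex is put opposite to a set in which it has many typical neighbours. Of the `43t`, at
  -- least `40t` remain after rebalancing and more than `38t` after the edges of earlier cycles are
  -- removed.
  OnI : V → Set
  OnI v = v ∈ I ⊎ (Bad v × 43 * t ≤ # (nbrs? false v))

  onI? : Decidable OnI
  onI? v = (v ∈? I) ⊎-dec (bad? v ×-dec (43 * t ≤? # (nbrs? false v)))

  side : V → Bool
  side v = does (onI? v)

  typ-side : ∀ {c v} → Typ c v → side v ≡ c
  typ-side {true} {v} v∈ = dec-true (onI? v) (inj₁ v∈)
  typ-side {false} {v} (v∉ , lt) = dec-false (onI? v) λ { (inj₁ v∈) → v∉ v∈ ; (inj₂ ((_ , le) , _)) → <⇒≱ lt le }

  kinds : ∀ v → v ∈ I ⊎ Typ false v ⊎ Bad v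
  kinds v with v ∈? I | # (missI? v) <? q
  ... | yes v∈ | _ = inj₁ v∈
  ... | no v∉ | yes lt = inj₂ (inj₁ (v∉ , lt))
  ... | no v∉ | no ≮ = inj₂ (inj₂ (v∉ , ≮⇒≥ ≮))

  degree≤ : ∀ u → degree G u ≤ # (nbrs? true u) + (# (nbrs? false u) + # bad?)
  degree≤ u = ≤-trans (#-∪≤ (adj? G u) (nbrs? true u) (λ w → nbrs? false u w ⊎-dec bad? w)
      λ {w} r → [ (λ w∈ → inj₁ (w∈ , r)) , [ (λ f → inj₂ (inj₁ (f , r))) , inj₂ ∘ inj₂ ]′ ]′ (kinds w))
    (+-monoʳ-≤ _ (#-∪≤ (λ w → nbrs? false u w ⊎-dec bad? w) (nbrs? false u) bad? id))

  sizes : ∀ c → n ≤ 2 * # (typ? c) + 5 * t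
  sizes true = lin (n ∷ s ∷ t ∷ length I ∷ # (_∈? I) ∷ [])
    (λ n s t a a′ → (a :≤ a′) ∷ (n :≤ 2 :* a :+ 22 :* s) ∷ (100 :* s :≤ t) ∷ [] ⊢ n :≤ 2 :* a′ :+ 5 :* t) 0
        (2 ∷ 1 ∷ 1 ∷ [])
    (eq≥ #I ∷ bigI ∷ eq≤ t≡ ∷ [])
  sizes false = lin (n ∷ s ∷ t ∷ # outside? ∷ # (typ? false) ∷ # bad? ∷ [])
    (λ n s t j b x → (n :≤ 2 :* j :+ 4 :* s) ∷ (j :≤ b :+ x) ∷ (x :≤ 221 :* s) ∷ (100 :* s :≤ t) ∷
      [] ⊢ n :≤ 2 :* b :+ 5 :* t) 0 (1 ∷ 2 ∷ 2 ∷ 5 ∷ [])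
    (J-big ∷
      #-∪≤ outside? (typ? false) bad? (λ {v} v∉ → [ (λ v∈ → contradiction v∈ v∉) , id ]′ (kinds v)) ∷
      bad-count ∷ eq≤ t≡ ∷ [])

  missing : ∀ c {u} → Typ c u → # (λ w → typ? (not c) w ×-dec ¬? (adj? G u w)) ≤ q
  missing true {u} u∈ = lin (n ∷ s ∷ t ∷ q ∷ # (λ w → typ? false w ×-dec ¬? (adj? G u w)) ∷ # (missJ? u) ∷ [])
    (λ n s t q a b → (a :≤ b) ∷ (b :≤ 13 :* s) ∷ (n :≤ 16 :* q :+ con 15) ∷ (1000 :* t :≤ n) ∷
      (100 :* s :≤ t) ∷ (con 4 :≤ s) ∷ [] ⊢ a :≤ q) 15 (16 ∷ 16 ∷ 1 ∷ 1 ∷ 3 ∷ 1 ∷ [])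
    (#-mono (λ w → typ? false w ×-dec ¬? (adj? G u w)) (missJ? u) (λ ((w∉ , _) , ¬r) → w∉ , ¬r) ∷
      missJ≤ u∈ ∷ n≤ ∷ big ∷ eq≤ t≡ ∷ 4≤s ∷ [])
  missing false (_ , lt) = <⇒≤ lt

  room : ∀ u → 43 * t ≤ # (λ w → typ? (not (side u)) w ×-dec adj? G u w)
  room u = from (onI? u)
    where
    Room : Bool → Set
    Room c = 43 * t ≤ # (λ w → typ? (not c) w ×-dec adj? G u w)
    on : OnI u → Room true
    on (inj₂ (_ , le)) = le
    on (inj₁ u∈) = lin (n ∷ s ∷ t ∷ degree G u ∷ # (nbrs? true u) ∷ # (nbrs? false u) ∷ # bad? ∷ [])
      (λ n s t d a b x → (n :≤ 2 :* d) ∷ (d :≤ a :+ (b :+ x)) ∷ (a :≤ 2 :* s) ∷ (x :≤ 221 :* s) ∷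
        (1000 :* t :≤ n) ∷ (100 :* s :≤ t) ∷ [] ⊢ 43 :* t :≤ b) 20 (1 ∷ 2 ∷ 2 ∷ 2 ∷ 1 ∷ 5 ∷ [])
      (dense u ∷ degree≤ u ∷ few u∈ ∷ bad-count ∷ big ∷ eq≤ t≡ ∷ [])
    -- A bad vertex with few typical neighbours outside `I` has nearly `n/2` in `I`, since bad
    -- vertices are few; a vertex outside `I` that is not bad misses fewer than `q` of `I`.
    off : ¬ OnI u → Dec (q ≤ # (missI? u)) → Room false
    off ¬o (yes le) = lin (n ∷ s ∷ t ∷ degree G u ∷ # (nbrs? true u) ∷ # (nbrs? false u) ∷ # bad? ∷ [])
      (λ n s t d a b x → (n :≤ 2 :* d) ∷ (d :≤ a :+ (b :+ x)) ∷ (b :< 43 :* t) ∷ (x :≤ 221 :* s) ∷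
        (1000 :* t :≤ n) ∷ (100 :* s :≤ t) ∷ [] ⊢ 43 :* t :≤ a) 19 (1 ∷ 2 ∷ 2 ∷ 2 ∷ 1 ∷ 5 ∷ [])
      (dense u ∷ degree≤ u ∷ ≰⇒> (λ le′ → ¬o (inj₂ ((¬o ∘ inj₁ , le) , le′))) ∷ bad-count ∷ big ∷ eq≤ t≡ ∷ [])
    off ¬o (no ≰) = lin (n ∷ s ∷ t ∷ q ∷ length I ∷ # (_∈? I) ∷ # (nbrs? true u) ∷ # (missI? u) ∷ [])
      (λ n s t q i i′ a m → (i :≤ i′) ∷ (n :≤ 2 :* i :+ 22 :* s) ∷ (i′ :≤ a :+ m) ∷ (m :< q) ∷
        (16 :* q :≤ n) ∷ (1000 :* t :≤ n) ∷ (100 :* s :≤ t) ∷ [] ⊢ 43 :* t :≤ a) 174955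
            (17200 ∷ 8600 ∷ 17200 ∷ 17200 ∷ 1075 ∷ 7525 ∷ 1892 ∷ [])
      (eq≥ #I ∷ bigI ∷
        #-∪≤ (_∈? I) (nbrs? true u) (missI? u) (λ {w} w∈ →
            case adj? G u w of λ { (yes r) → inj₁ (w∈ , r) ; (no ¬r) → inj₂ (w∈ , ¬r) }) ∷
        ≰⇒> ≰ ∷ q≤ ∷ big ∷ eq≤ t≡ ∷ [])
    from : Dec (OnI u) → Room (side u)
    from (yes o) = subst Room (sym (dec-true (onI? u) o)) (on o)
    from (no ¬o) = subst Room (sym (dec-false (onI? u) ¬o)) (off ¬o (q ≤? # (missI? u)))

  hub-bad : ∀ {v} → ¬ Typ true v → ¬ Typ false v → Bad v
  hub-bad {v} ¬t ¬f = [ (λ v∈ → contradiction v∈ ¬t) , [ (λ f → contradiction f ¬f) , id ]′ ]′ (kinds v)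

  bad≤ : # bad? ≤ 3 * t
  bad≤ = lin (s ∷ t ∷ # bad? ∷ [])
    (λ s t x → (x :≤ 221 :* s) ∷ (100 :* s :≤ t) ∷ [] ⊢ x :≤ 3 :* t) 0 (1 ∷ 3 ∷ [])
    (bad-count ∷ eq≤ t≡ ∷ [])

  count-side : Bool → ℕ
  count-side c = # (λ v → side v ≟ᵇ c)

  side-true : count-side true ≤ length I + # bad?
  side-true = ≤-trans (#-∪≤ (λ v → side v ≟ᵇ true) (_∈? I) bad? λ {v} → from (onI? v))
      (+-monoˡ-≤ _ (≤-reflexive #I))
    where
    from : ∀ {v} (o : Dec (OnI v)) → does o ≡ true → v ∈ I ⊎ Bad v
    from (yes (inj₁ v∈)) _ = inj₁ v∈
    from (yes (inj₂ (bad , _))) _ = inj₂ bad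

  side-false : count-side false ≤ # outside?
  side-false = #-mono (λ v → side v ≟ᵇ false) outside? λ {v} → from (onI? v)
    where
    from : ∀ {v} (o : Dec (OnI v)) → does o ≡ false → v ∉ I
    from (no ¬o) _ = ¬o ∘ inj₁

  negated : ∀ c → # (λ v → not (side v) ≟ᵇ c) ≡ count-side (not c)
  negated c = #-cong (λ v → not (side v) ≟ᵇ c) (λ v → side v ≟ᵇ not c)
      (λ eq → trans (sym (not-involutive _)) (cong not eq)) (λ eq → trans (cong not eq) (not-involutive c))

  both : count-side true + count-side false ≡ n
  both = sides side

  near-bipartite : Σ (Fin ℓ → HamCycle G) EdgeDisjoint
  near-bipartite = [ wide , narrow ]′ (≤-total (count-side false) (count-side true))
    where
    wide : count-side false ≤ count-side true → Σ (Fin ℓ → HamCycle G) EdgeDisjoint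
    -- The complement of `I` has at least `n/2 − 2s` vertices and at most `221s` bad ones changed
    -- sides, so the excess is at most `446s`, within `5t`.
    wide le = let (m₀ , eq) = m≤n⇒∃[o]m+o≡n le in Rebalance.rebalanced G ℓ s t q m₀ 4≤s ℓ≤s t≡ big dense side Typ
        typ? typ-side (sym eq)
      (lin (n ∷ s ∷ t ∷ m₀ ∷ count-side true ∷ count-side false ∷ length I ∷ # bad? ∷ # outside? ∷ [])
        (λ n s t m₀ x y i b j → (y :+ m₀ :≤ x) ∷ (n :≤ x :+ y) ∷ (x :≤ i :+ b) ∷ (b :≤ 221 :* s) ∷
          (n :≤ 2 :* j :+ 4 :* s) ∷ (i :+ j :≤ n) ∷ (100 :* s :≤ t) ∷ [] ⊢ m₀ :≤ 5 :* t) 0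
              (1 ∷ 1 ∷ 2 ∷ 2 ∷ 1 ∷ 2 ∷ 5 ∷ [])
        (eq≤ eq ∷ eq≥ both ∷ side-true ∷ bad-count ∷ J-big ∷ eq≤ I+J ∷ eq≤ t≡ ∷ []))
      sizes missing q≤ room (≤-trans (#-mono _ bad? λ (¬t , ¬f) → hub-bad ¬t ¬f) bad≤)
    -- With the colours exchanged, the larger side lies in the complement of `I`, which has at most
    -- `n/2 + 11s` vertices; the excess is at most `22s`.
    narrow : count-side true ≤ count-side false → Σ (Fin ℓ → HamCycle G) EdgeDisjoint
    narrow le = let (m₀ , eq) = m≤n⇒∃[o]m+o≡n le in Rebalance.rebalanced G ℓ s t q m₀ 4≤s ℓ≤s t≡ big dense
        (not ∘ side) (λ c → Typ (not c)) (λ c → typ? (not c))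
      (λ {c} cv → trans (cong not (typ-side cv)) (not-involutive c))
          (trans (negated true) (trans (sym eq) (cong (_+ m₀) (sym (negated false)))))
      (lin (n ∷ s ∷ t ∷ m₀ ∷ count-side true ∷ count-side false ∷ length I ∷ # outside? ∷ [])
        (λ n s t m₀ x y i j → (x :+ m₀ :≤ y) ∷ (n :≤ x :+ y) ∷ (y :≤ j) ∷ (n :≤ 2 :* i :+ 22 :* s) ∷
          (i :+ j :≤ n) ∷ (100 :* s :≤ t) ∷ [] ⊢ m₀ :≤ 5 :* t) 0 (1 ∷ 1 ∷ 2 ∷ 1 ∷ 2 ∷ 1 ∷ [])
        (eq≤ eq ∷ eq≥ both ∷ side-false ∷ bigI ∷ eq≤ I+J ∷ eq≤ t≡ ∷ []))
      (λ c → sizes (not c)) (λ c → missing (not c)) q≤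
      (λ u → subst (λ c → 43 * t ≤ # (λ w → typ? c w ×-dec adj? G u w)) (sym (not-involutive (not (side u))))
          (room u))
      (≤-trans (#-mono _ bad? λ (¬f , ¬t) → hub-bad ¬t ¬f) bad≤)

-- Combining the cases

module Main {n : ℕ} (G : Graph n) (k ℓ s t : ℕ) (2≤k : 2 ≤ k) (2≤ℓ : 2 ≤ ℓ) (s≡ : s ≡ k + ℓ) (t≡ : 100 * s ≡ t)
    (big : 1000 * t ≤ n)
  (deg : MinDegreeCond G k) where

  4≤s : 4 ≤ s
  4≤s = lin (k ∷ ℓ ∷ s ∷ [])
    (λ k ℓ s → (k :+ ℓ :≤ s) ∷ (con 2 :≤ k) ∷ (con 2 :≤ ℓ) ∷ [] ⊢ con 4 :≤ s) 0 (1 ∷ 1 ∷ 1 ∷ [])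
    (eq≥ s≡ ∷ 2≤k ∷ 2≤ℓ ∷ [])

  k≤s : k ≤ s
  k≤s = lin (k ∷ ℓ ∷ s ∷ [])
    (λ k ℓ s → (k :+ ℓ :≤ s) ∷ [] ⊢ k :≤ s) 0 (1 ∷ [])
    (eq≥ s≡ ∷ [])

  ℓ≤s : ℓ ≤ s
  ℓ≤s = lin (k ∷ ℓ ∷ s ∷ [])
    (λ k ℓ s → (k :+ ℓ :≤ s) ∷ [] ⊢ ℓ :≤ s) 0 (1 ∷ [])
    (eq≥ s≡ ∷ [])

  dense : ∀ v → n ≤ 2 * degree G v
  dense v = lin (n ∷ k ∷ degree G v ∷ [])
    (λ n k d → (n :+ k :≤ 2 :* d :+ con 2) ∷ (con 2 :≤ k) ∷ [] ⊢ n :≤ 2 :* d) 0 (1 ∷ 1 ∷ [])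
    (deg v ∷ 2≤k ∷ [])

  module _ {i : ℕ} (i≤ℓ : i ≤ ℓ) (H : Fin i → HamCycle G) where

    dense′ : ∀ v → n ≤ 2 * degree (remaining G H) v + 4 * s
    dense′ v = lin (n ∷ s ∷ degree G v ∷ degree (remaining G H) v ∷ i ∷ ℓ ∷ i * 2 ∷ [])
      (λ n s d r i ℓ i2 → (n :≤ 2 :* d) ∷ (d :≤ r :+ i2) ∷ (i2 :≤ 2 :* i) ∷ (i :≤ ℓ) ∷ (ℓ :≤ s) ∷
        [] ⊢ n :≤ 2 :* r :+ 4 :* s) 0 (1 ∷ 2 ∷ 2 ∷ 4 ∷ 4 ∷ [])
      (dense v ∷ remaining-degree G H v ∷ eq≤ (*-comm i 2) ∷ i≤ℓ ∷ ℓ≤s ∷ [])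

    -- The edges of G that are counted here lie on the cycles H.
    nonadjacent-few : ∀ {xs : List (Fin n)} {x} → (∀ {y} → y ∈ xs → ¬ RemoveCycles G H x y) →
        # (λ y → (y ∈? xs) ×-dec adj? G x y) ≤ 2 * s
    nonadjacent-few {xs} {x} none = ≤-trans (#-mono (λ y → (y ∈? xs) ×-dec adj? G x y) (used? H x) λ {y} (y∈ , r) →
        case used? H x y of λ { (yes h) → h ; (no ¬h) → contradiction (r , ¬h) (none y∈) })
      (used-degree≤ i≤ℓ ℓ≤s H x)

    -- From the packing `H` only the two sets are kept: its edges are available again, and the
    -- packing starts afresh in `G`.
    split-case : ∀ {e} → e ≤ 8 * s → Split (remaining G H) e → Conclusion G k ℓ
    split-case {e} e≤ record { A = A ; B = B ; uniqueA = uniqueA ; uniqueB = uniqueB ; disjoint =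
        disjoint ; nonadj = nonadj ; bigA = bigA ; bigB = bigB } =
      TwoCliques.two-cliques G k ℓ s 2≤k 4≤s k≤s ℓ≤s deg
        (lin (n ∷ s ∷ t ∷ [])
          (λ n s t → (1000 :* t :≤ n) ∷ (100 :* s :≤ t) ∷ [] ⊢ 2000 :* s :≤ n) 0 (1 ∷ 20 ∷ [])
          (big ∷ eq≤ t≡ ∷ []))
        parts parts-unique parts-disjoint parts-few parts-big
      where
      parts : Bool → List (Fin n)
      parts c = if c then A else B
      parts-unique : ∀ c → Unique (parts c)
      parts-unique true = uniqueA
      parts-unique false = uniqueB
      parts-disjoint : ∀ {c d v} → v ∈ parts c → v ∈ parts d → c ≡ d
      parts-disjoint {true} {true} _ _ = refl
      parts-disjoint {true} {false} v∈ v∈′ = contradiction v∈′ (disjoint v∈)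
      parts-disjoint {false} {true} v∈ v∈′ = contradiction v∈ (disjoint v∈′)
      parts-disjoint {false} {false} _ _ = refl
      parts-few : ∀ c {x} → x ∈ parts c → # (λ y → (y ∈? parts (not c)) ×-dec adj? G x y) ≤ 2 * s
      parts-few true x∈ = nonadjacent-few (nonadj x∈)
      parts-few false x∈ = nonadjacent-few λ y∈ r → nonadj y∈ x∈ (adj-sym (remaining G H) r)
      parts-big : ∀ c → n ≤ 2 * length (parts c) + 8 * s
      parts-big true = ≤-trans bigA (+-monoʳ-≤ _ e≤)
      parts-big false = ≤-trans bigB (+-monoʳ-≤ _ e≤)

  -- A packing whose remainder fails to be `k`-connected is discarded too, because the failure
  -- itself yields a split, with error `4s + 2k`.
  finish : Σ (Fin ℓ → HamCycle G) EdgeDisjoint → Conclusion G k ℓ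
  finish (H , disjoint) = [ split-case ≤-refl H (lin (k ∷ s ∷ [])
    (λ k s → (k :≤ s) ∷ [] ⊢ 4 :* s :+ 2 :* k :≤ 8 :* s) 0 (2 ∷ [])
    (k≤s ∷ [])) , (λ connected → H , disjoint , connected) ]′
    (connected-or-split (remaining G H) (4 * s) k (dense′ ≤-refl H) (lin (n ∷ s ∷ t ∷ k ∷ [])
      (λ n s t k → (k :≤ s) ∷ (1000 :* t :≤ n) ∷ (100 :* s :≤ t) ∷ (con 4 :≤ s) ∷ [] ⊢ k :< n) 0
          (1 ∷ 1 ∷ 1 ∷ 1 ∷ [])
      (k≤s ∷ big ∷ eq≤ t≡ ∷ 4≤s ∷ [])))

  -- The greedy phase rations nothing: no pair is special, and each cycle spends 0 of them.
  never? : Decidable (λ (_ : Fin n × Fin n) → ⊥)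
  never? _ = no id

  next : ∀ j → j < ℓ → (P : Packing {G = G} never? j 0) →
         Conclusion G k ℓ ⊎ Σ (HamCycle (remaining G (Packing.cycles P))) λ C →
             count (λ l → never? l ×-dec hamEdge? C (proj₁ l) (proj₂ l)) (pairs n) ≤ 0
  next j j<ℓ P = from (Dichotomy.hamiltonian-or-extremal R (4 * s) (dense′ (<⇒≤ j<ℓ) H)
      (lin (n ∷ s ∷ t ∷ [])
        (λ n s t → (1000 :* t :≤ n) ∷ (100 :* s :≤ t) ∷ (con 4 :≤ s) ∷ [] ⊢ 4 :* s :< n) 0 (1 ∷ 1 ∷ 1 ∷ [])
        (big ∷ eq≤ t≡ ∷ 4≤s ∷ [])))
    where
    H = Packing.cycles P
    R = remaining G H
    from : (Σ (Cycle R) λ C → n ≤ len C) ⊎ Independent R (3 * (4 * s) + 6) ⊎ Split R (4 * s + 2) →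
           Conclusion G k ℓ ⊎ Σ (HamCycle R) λ C → count (λ l → never? l ×-dec hamEdge? C (proj₁ l) (proj₂ l))
               (pairs n) ≤ 0
    from (inj₁ (C , le)) = inj₂ (toHamCycle (lin (n ∷ s ∷ t ∷ [])
      (λ n s t → (1000 :* t :≤ n) ∷ (100 :* s :≤ t) ∷ (con 4 :≤ s) ∷ [] ⊢ con 3 :≤ n) 0 (1 ∷ 1 ∷ 1 ∷ [])
      (big ∷ eq≤ t≡ ∷ 4≤s ∷ [])) C le ,
      ≤-reflexive (count-none _ (pairs n) λ _ (bot , _) → bot))
    from (inj₂ (inj₁ ind)) = inj₁ (finish (NearBipartite.near-bipartite G ℓ s t 4≤s ℓ≤s t≡ big dense
        (Independent.I ind) (Independent.unique ind)
      (λ x∈ → nonadjacent-few (<⇒≤ j<ℓ) H (Independent.indep ind x∈))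
      (lin (n ∷ s ∷ length (Independent.I ind) ∷ [])
        (λ n s i → (n :≤ 2 :* i :+ (3 :* (4 :* s) :+ con 6)) ∷ (con 4 :≤ s) ∷ [] ⊢ n :≤ 2 :* i :+ 22 :* s) 0
            (1 ∷ 2 ∷ [])
        (Independent.bigI ind ∷ 4≤s ∷ []))))
    from (inj₂ (inj₂ split)) = inj₁ (split-case (<⇒≤ j<ℓ) H (lin (s ∷ [])
      (λ s → (con 4 :≤ s) ∷ [] ⊢ 4 :* s :+ con 2 :≤ 8 :* s) 0 (1 ∷ [])
      (4≤s ∷ [])) split)

  conclusion : Conclusion G k ℓ
  conclusion = [ id , (λ P → finish (Packing.cycles P , Packing.disjoint P)) ]′ (packing {G = G} never? ℓ 0 next)

theorem13 : Σ (ℕ → ℕ → ℕ) λ f → Σ ℕ λ C →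
    (∀ k ℓ → 2 ≤ k → 2 ≤ ℓ → f k ℓ ≤ C * (k + ℓ)) ×
    (∀ k ℓ → 2 ≤ k → 2 ≤ ℓ → ∀ n → f k ℓ ≤ n → (G : Graph n) → MinDegreeCond G k →
    Σ (Fin ℓ → HamCycle G) λ H → EdgeDisjoint H × KConnected k (RemoveCycles G H))
-- The constant is that of `Main`: `n` at least `1000t`, with `t = 100s` and `s = k + ℓ`.
theorem13 = (λ k ℓ → 1000 * (100 * (k + ℓ))) , 1000 * 100 , (λ k ℓ _ _ → eq≥ (*-assoc 1000 100 (k + ℓ))) ,
  λ k ℓ 2≤k 2≤ℓ n big G deg → Main.conclusion G k ℓ (k + ℓ) (100 * (k + ℓ)) 2≤k 2≤ℓ refl refl big deg
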